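{- For every finite ordered tree $S$, the Ramsey degree of $S$ in the category $Conn_T$ equals $$rd(S)=\left|\mathcal{P}\big(\{x\in S\colon x\text{ is not the root of }S\text{ and }x\text{ has at most one immediate successor in }S\}\big)\right|,$$ where $\mathcal{P}$ denotes the power set.
   Context: All trees are finite. A tree is a partial order $(T,\sqsubseteq_T)$ with a least element (the root) such that the predecessors of every element are linearly ordered; $v\wedge_T w$ is the largest common predecessor. A tree is ordered if each set of immediate successors carries a linear order; this induces a linear order $\leq_T$ on $T$: $v\leq_T w$ iff $v\sqsubseteq_T w$, or $w\not\sqsubseteq_T v$ and the immediate successor of $v\wedge w$ below $v$ precedes the one below $w$. An embedding $i\colon S\to T$ sends root to root, satisfies $x<_S y\Rightarrow i(x)<_T i(y)$, and $i(x\wedge y)=i(x)\wedge i(y)$. A map $s\colon T\to S$ is a rigid surjection if there is an embedding $i\colon S\to T$ with $s(i(x))=x$ and $i(s(y))\sqsubseteq_T y$ for all $x,y$; then $i=i_s$, $i_s(x)=\bigwedge s^{ -1}(x)$. A connection $(s,i)\colon T\leftrightarrows S$ is a pair with $s\colon T\to S$ a rigid surjection, $i\colon S\to T$ an embedding, and for all $x\in S$: $s(i(x))=x$ and $s(y)\leq_S x$ for all $y<_T i(x)$. $Conn_T$ is the category whose objects are finite ordered trees, with $\mathrm{Hom}(S,T)$ the set of connections $(s,i)\colon T\leftrightarrows S$, and composition $(t,j)\circ(s,i)=(s\circ t, j\circ i)$. For objects $A,B$, $rd(A,B)$ is the least $k$ such that for every $r>0$ there is an object $C$ such that for every $r$-coloring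 of $\mathrm{Hom}(A,C)$ there is $f\in\mathrm{Hom}(B,C)$ with at most $k$ colors on $f\circ\mathrm{Hom}(A,B)$; $rd(A)=\sup_B rd(A,B)$ (possibly $\infty$). -}

module Defs where

open import Data.Nat using (ℕ; zero; suc; _+_; _≤_; _<_; _≤ᵇ_)
open import Data.Bool using (if_then_else_)
open import Data.Fin as Fin using (Fin)
open import Data.List using (List; []; _∷_; length; lookup)
open import Data.List.Membership.Propositional using (_∈_)
open import Data.Product using (Σ; ∃; ∃-syntax; _×_; _,_)
open import Data.Sum using (_⊎_)
open import Relation.Nullary using (¬_; yes; no)
open import Relation.Binary.PropositionalEquality using (_≡_; refl)

-- Finite ordered trees: rose trees. The list of subtrees of a node
-- carries the linear order on its immediate successors.

data Tree : Set where
  node : List Tree → Tree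

children : Tree → List Tree
children (node ts) = ts

data Pos : Tree → Set where
  root  : ∀ {ts} → Pos (node ts)
  child : ∀ {ts} (i : Fin (length ts)) → Pos (lookup ts i) → Pos (node ts)

rootOf : ∀ t → Pos t
rootOf (node ts) = root

data _⊑_ : ∀ {t} → Pos t → Pos t → Set where
  root⊑  : ∀ {ts} {p : Pos (node ts)} → root ⊑ p
  child⊑ : ∀ {ts} {i : Fin (length ts)} {p q : Pos (lookup ts i)} →
           p ⊑ q → child {ts} i p ⊑ child i q

data _<T_ : ∀ {t} → Pos t → Pos t → Set where
  root<   : ∀ {ts} {i : Fin (length ts)} {p : Pos (lookup ts i)} →
            root <T child {ts} i p
  branch< : ∀ {ts} {i j : Fin (length ts)} {p : Pos (lookup ts i)}
              {q : Pos (lookup ts j)} →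
            i Fin.< j → child {ts} i p <T child j q
  deeper< : ∀ {ts} {i : Fin (length ts)} {p q : Pos (lookup ts i)} →
            p <T q → child {ts} i p <T child i q

_≤T_ : ∀ {t} → Pos t → Pos t → Set
x ≤T y = x <T y ⊎ x ≡ y

_∧_ : ∀ {t} → Pos t → Pos t → Pos t
root ∧ q = root
child i p ∧ root = root
child i p ∧ child j q with i Fin.≟ j
... | yes refl = child i (p ∧ q)
... | no _ = root

record IsEmbedding {S T : Tree} (e : Pos S → Pos T) : Set where
  field
    root↦root : e (rootOf S) ≡ rootOf T
    mono      : ∀ x y → x <T y → e x <T e y
    meet      : ∀ x y → e (x ∧ y) ≡ e x ∧ e y

IsRigidSurjection : {T S : Tree} → (Pos T → Pos S) → Set
IsRigidSurjection {T} {S} s =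
  Σ (Pos S → Pos T) λ e → IsEmbedding e ×
    ((∀ x → s (e x) ≡ x) × (∀ y → e (s y) ⊑ y))

record Conn (T S : Tree) : Set where
  field
    s      : Pos T → Pos S
    i      : Pos S → Pos T
    s-rigid : IsRigidSurjection s
    i-emb  : IsEmbedding i
    retr   : ∀ x → s (i x) ≡ x
    below  : ∀ x y → y <T i x → s y ≤T x

Hom : Tree → Tree → Set
Hom A B = Conn B A

_≈_ : ∀ {A B} → Hom A B → Hom A B → Set
h ≈ h' = (∀ y → Conn.s h y ≡ Conn.s h' y) × (∀ x → Conn.i h x ≡ Conn.i h' x)

IsComp : ∀ {A B C} → Hom A C → Hom B C → Hom A B → Set
IsComp h f g =
  (∀ z → Conn.s h z ≡ Conn.s g (Conn.s f z)) ×
  (∀ x → Conn.i h x ≡ Conn.i f (Conn.i g x))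

-- An r-colouring of Hom(A , C): a function on the set of connections,
-- i.e. it does not distinguish equal morphisms.
record Colouring (r : ℕ) (A C : Tree) : Set where
  field
    col  : Hom A C → Fin r
    resp : ∀ h h' → h ≈ h' → col h ≡ col h'

AtMostColours : ∀ {r A B C} → ℕ → Colouring r A C → Hom B C → Set
AtMostColours {r} {A} {B} {C} k χ f =
  Σ (List (Fin r)) λ L → length L ≤ k ×
    (∀ (g : Hom A B) (h : Hom A C) → IsComp h f g → Colouring.col χ h ∈ L)

RamseyProp : Tree → Tree → ℕ → Set
RamseyProp A B k =
  ∀ (r : ℕ) → 0 < r → Σ Tree λ C → ∀ (χ : Colouring r A C) →
    Σ (Hom B C) λ f → AtMostColours {r} {A} {B} {C} k χ f

IsRdPair : Tree → Tree → ℕ → Set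
IsRdPair A B k = RamseyProp A B k × (∀ j → j < k → ¬ RamseyProp A B j)

-- rd(A) = sup_B rd(A , B) = n  (a finite value n).
IsRd : Tree → ℕ → Set
IsRd A n =
  (∀ B k → IsRdPair A B k → k ≤ n) ×
  (∀ j → j < n → Σ Tree λ B → Σ ℕ λ k → IsRdPair A B k × j < k)

mutual
  countLow : Tree → ℕ
  countLow (node ts) = countLowList ts

  countLowList : List Tree → ℕ
  countLowList [] = 0
  countLowList (t ∷ ts) =
    (if length (children t) ≤ᵇ 1 then 1 else 0) + countLow t + countLowList ts

{-# OPTIONS --safe #-}

-- A connection (s , i) is determined by the rigid surjection s, with embedding e, and by
-- i ⊒ e. At a branching node, as at the root, i and e agree, and at the other nodes x the
-- node i x lies strictly below the image under e of the successor of x. Doubling those nodes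
-- x of S for which e x ≠ i x one obtains a tree S′, and (s , i) is the composition of a fixed
-- connection between S′ and S with a rigid surjection onto S′. By the dual Ramsey theorem for
-- trees, applied to each of the 2 ^ countLow S trees S′, the colour of a connection may be
-- assumed to depend on the doubled nodes only. Conversely, colouring a connection by the set
-- of nodes x with e x ≠ i x, no colour can be avoided once all nodes of B that come from the
-- low nodes of S are branching.
--
-- The dual Ramsey theorem concerns words between forests: node values are nodes of a second
-- forest or constants. It is proved by induction on the forest S. For empty S it is an
-- application of the Hales–Jewett theorem. For t ∷ S one first makes the colour depend on the
-- labelled path to the image of the root of t only, by induction on the target forest; the
-- labelled paths are then handled by the Hales–Jewett theorem, with pairs of a label and a
-- direction as letters, and by the pigeonhole principle.

module Submission where

open import Defs
open import Data.Nat using (ℕ; zero; suc; _+_; _*_; _^_; _≤_; _<_; z≤n; s≤s; _<ᵇ_; _≤ᵇ_)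
open import Data.Nat.Properties hiding (_≟_; suc-injective; <-cmp)
open import Data.Bool using (Bool; true; false; if_then_else_; T; not)
open import Data.Bool.Properties using (T-irrelevant)
open import Data.Empty using (⊥; ⊥-elim)
open import Data.Unit using (⊤; tt)
open import Data.Fin as Fin using (Fin; zero; suc; toℕ; fromℕ<; combine; quotient; remainder; splitAt; join; funToFin; finToFun)
open import Data.Fin.Properties using (<-cmp; 1↔⊤; 2↔Bool; *↔×; finToFun-funToFin; splitAt-join; remQuot-combine; pigeonhole; toℕ<n; toℕ-fromℕ<; any?; suc-injective; injective⇒≤)
open import Data.List as List using (List; []; _∷_; length; lookup)
open import Data.List.Properties using (length-tabulate)
open import Data.List.Membership.Propositional using (_∈_)
open import Data.List.Membership.Propositional.Properties using (∈-tabulate⁺)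
open import Data.List.Relation.Unary.Any as ListAny using ()
open import Data.List.Relation.Unary.Any.Properties using (lookup-index)
open import Data.Maybe as Maybe using (Maybe; just; nothing; fromMaybe; maybe′)
open import Data.Product as Product using (Σ; ∃; _×_; _,_; proj₁; proj₂)
open import Data.Sum as Sum using (_⊎_; inj₁; inj₂)
open import Data.Vec as Vec using (Vec; []; _∷_; _++_)
import Data.Vec.Properties as VecP
open import Data.Vec.Relation.Unary.Any as Any using (Any; here; there)
import Data.Vec.Relation.Unary.Any.Properties as AnyP
open import Function using (_∘_; id; _↔_; Inverse)
open import Function.Properties.Inverse using (↔-sym; ↔-trans)
open import Data.Product.Function.NonDependent.Propositional using (_×-↔_)
open import Relation.Nullary using (Dec; yes; no; ¬_)
open import Relation.Binary.Definitions using (tri<; tri≈; tri>)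
open import Relation.Nullary.Decidable using (map′; ⌊_⌋)
open import Relation.Binary.PropositionalEquality using (_≡_; refl; sym; trans; cong; cong₂; subst; subst₂; module ≡-Reasoning)

-- The induction has to look inside a tree of the target, where values may be nodes bound outside
-- that tree. A bound root is therefore turned into a constant, and every Ramsey statement is proved
-- for any positive number of constants; for connections the single constant is the root of `S`.
-- Paths carry labels for the same reason: at the image of a node of `K` the label is not fixed by
-- the word that is sought, but is that of the path in `K`. A monochromatic word must thus be good
-- for all labels of such a node as well as for all directions out of it. A Hales-Jewett line can
-- absorb this because a later star can repeat both the direction and the label of the first one.
-- The node of the first star has a path, and hence a colour, of its own, which no line controls. In
-- the analysis of connections a doubled node is met twice, and the recursion must remember that its
-- upper copy is not to be doubled again.

-- Finite sets and codes of functions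

record Finite (A : Set) : Set where
  field
    size       : ℕ
    enum       : Fin size → A
    index      : A → Fin size
    enum-index : ∀ x → enum (index x) ≡ x

  -- Colouring by codes settles many colourings at once: equal codes mean equal colours at every
  -- argument. `size` serves as a bound on the number of elements.
  code : ∀ {r} → (A → Fin r) → Fin (r ^ size)
  code f = funToFin (f ∘ enum)

  code-injective : ∀ {r} (f g : A → Fin r) → code f ≡ code g → ∀ x → f x ≡ g x
  code-injective f g eq x = begin
    f x                               ≡⟨ cong f (sym (enum-index x)) ⟩
    f (enum (index x))                ≡⟨ sym (finToFun-funToFin (f ∘ enum) (index x)) ⟩
    finToFun (code f) (index x)       ≡⟨ cong (λ c → finToFun c (index x)) eq ⟩
    finToFun (code g) (index x)       ≡⟨ finToFun-funToFin (g ∘ enum) (index x) ⟩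
    g (enum (index x))                ≡⟨ cong g (enum-index x) ⟩
    g x                               ∎
    where open ≡-Reasoning

  index-injective : ∀ {x y} → index x ≡ index y → x ≡ y
  index-injective {x} {y} eq =
    trans (sym (enum-index x)) (trans (cong enum eq) (enum-index y))

  _≟ᶠ_ : (x y : A) → Dec (x ≡ y)
  x ≟ᶠ y = map′ index-injective (cong index) (index x Fin.≟ index y)

open Finite

Finite-retract : ∀ {A B : Set} (to : A → B) (from : B → A) → (∀ x → to (from x) ≡ x) →
                 Finite A → Finite B
Finite-retract to from to-from F = record
  { size       = size F
  ; enum       = to ∘ enum F
  ; index      = index F ∘ from
  ; enum-index = λ x → trans (cong to (enum-index F (from x))) (to-from x)
  }

Finite-Fin : ∀ n → Finite (Fin n)
Finite-Fin n = record { size = n ; enum = id ; index = id ; enum-index = λ _ → refl }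

Finite-⊤ : Finite ⊤
Finite-⊤ = Finite-retract (λ _ → tt) (λ _ → zero) (λ _ → refl) (Finite-Fin 1)

Finite-⊥ : Finite ⊥
Finite-⊥ = Finite-retract (λ ()) (λ ()) (λ ()) (Finite-Fin 0)

Finite-⊎ : ∀ {A B : Set} → Finite A → Finite B → Finite (A ⊎ B)
Finite-⊎ {A} {B} F G =
  Finite-retract (Sum.map (enum F) (enum G) ∘ splitAt (size F))
                 (join (size F) (size G) ∘ Sum.map (index F) (index G))
                 eq (Finite-Fin (size F + size G))
  where
  eq : ∀ x → Sum.map (enum F) (enum G)
               (splitAt (size F) (join (size F) (size G) (Sum.map (index F) (index G) x))) ≡ x
  eq x rewrite splitAt-join (size F) (size G) (Sum.map (index F) (index G) x) with x
  ... | inj₁ a = cong inj₁ (enum-index F a)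
  ... | inj₂ b = cong inj₂ (enum-index G b)

Finite-× : ∀ {A B : Set} → Finite A → Finite B → Finite (A × B)
Finite-× F G =
  Finite-retract (λ k → enum F (quotient {size F} (size G) k) , enum G (remainder {size F} (size G) k))
                 (λ { (a , b) → combine (index F a) (index G b) })
                 (λ { (a , b) → cong₂ _,_
                        (trans (cong (enum F ∘ proj₁) (remQuot-combine {size F} (index F a) (index G b))) (enum-index F a))
                        (trans (cong (enum G ∘ proj₂) (remQuot-combine {size F} (index F a) (index G b))) (enum-index G b)) })
                 (Finite-Fin (size F * size G))

Finite-Vec : ∀ {A : Set} → Finite A → ∀ n → Finite (Vec A n)
Finite-Vec F zero    = Finite-retract (λ _ → []) (λ _ → tt) (λ { [] → refl }) Finite-⊤
Finite-Vec F (suc n) = Finite-retract (λ { (x , xs) → x ∷ xs }) (λ { (x ∷ xs) → x , xs })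
                                      (λ { (x ∷ xs) → refl }) (Finite-× F (Finite-Vec F n))

-- The Hales–Jewett theorem, following Shelah

-- A combinatorial line, with `nothing` at the moving coordinates; `HasStar` says that it is not a
-- single point.
Template : ℕ → ℕ → Set
Template k N = Vec (Maybe (Fin k)) N

fill : ∀ {k N} → Template k N → Fin k → Vec (Fin k) N
fill T x = Vec.map (fromMaybe x) T

HasStar : ∀ {k N} → Template k N → Set
HasStar = Any (_≡ nothing)

-- A combinatorial subspace of dimension `n`, the product of lines on consecutive blocks; `pull`
-- carries a line of this subspace to the ambient space.
data Blocks (k : ℕ) : ℕ → ℕ → Set where
  []  : Blocks k 0 0
  add : ∀ {M n N} (T : Template k M) → HasStar T → Blocks k n N → Blocks k (suc n) (M + N)

fillBlocks : ∀ {k n N} → Blocks k n N → Vec (Fin k) n → Vec (Fin k) N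
fillBlocks []          []      = []
fillBlocks (add T _ B) (x ∷ u) = fill T x ++ fillBlocks B u

pull : ∀ {k n N} → Blocks k n N → Template k n → Template k N
pull []          []            = []
pull (add T _ B) (just c  ∷ L) = Vec.map just (fill T c) ++ pull B L
pull (add T _ B) (nothing ∷ L) = T ++ pull B L

fill-just : ∀ {k N} (v : Vec (Fin k) N) x → fill (Vec.map just v) x ≡ v
fill-just v x = trans (sym (VecP.map-∘ (fromMaybe x) just v)) (VecP.map-id v)

fill-pull : ∀ {k n N} (B : Blocks k n N) L x → fill (pull B L) x ≡ fillBlocks B (fill L x)
fill-pull []          []            x = refl
fill-pull (add T _ B) (just c  ∷ L) x =
  trans (VecP.map-++ (fromMaybe x) (Vec.map just (fill T c)) (pull B L))
        (cong₂ _++_ (fill-just (fill T c) x) (fill-pull B L x))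
fill-pull (add T _ B) (nothing ∷ L) x =
  trans (VecP.map-++ (fromMaybe x) T (pull B L)) (cong (fill T x ++_) (fill-pull B L x))

HasStar-pull : ∀ {k n N} (B : Blocks k n N) L → HasStar L → HasStar (pull B L)
HasStar-pull (add T h B) (just c  ∷ L) (there p) =
  AnyP.++⁺ʳ (Vec.map just (fill T c)) (HasStar-pull B L p)
HasStar-pull (add T h B) (nothing ∷ L) _         = AnyP.++⁺ˡ h

collapse : ∀ {k} → Fin (suc (suc k)) → Fin (suc k)
collapse zero    = zero
collapse (suc x) = x

-- Shelah's test words. For `a < b` the line whose stars are the coordinates from `a` up to `b`
-- passes through the test words of `a` and `b`, at the letters `zero` and `suc zero`.
step : ∀ k {M} → ℕ → Vec (Fin (suc (suc k))) M
step k a = Vec.tabulate (λ i → if toℕ i <ᵇ a then suc zero else zero)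

stepLine : ∀ k {M} → ℕ → ℕ → Template (suc (suc k)) M
stepLine k a b = Vec.tabulate (λ i → if toℕ i <ᵇ a then just (suc zero)
                                else if toℕ i <ᵇ b then nothing else just zero)

fill-stepLine₀ : ∀ k {M} a b → fill (stepLine k {M} a b) zero ≡ step k a
fill-stepLine₀ k a b = trans (sym (VecP.tabulate-∘ _ _)) (VecP.tabulate-cong eq)
  where
  eq : ∀ i → fromMaybe zero (if toℕ i <ᵇ a then just (suc zero)
               else if toℕ i <ᵇ b then nothing else just zero)
             ≡ (if toℕ i <ᵇ a then suc zero else zero)
  eq i with toℕ i <ᵇ a
  ... | true = refl
  ... | false with toℕ i <ᵇ b
  ...   | true  = refl
  ...   | false = refl

fill-stepLine₁ : ∀ k {M} a b → a < b → fill (stepLine k {M} a b) (suc zero) ≡ step k b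
fill-stepLine₁ k a b a<b = trans (sym (VecP.tabulate-∘ _ _)) (VecP.tabulate-cong eq)
  where
  eq : ∀ i → fromMaybe (suc zero) (if toℕ i <ᵇ a then just (suc zero)
               else if toℕ i <ᵇ b then nothing else just zero)
             ≡ (if toℕ i <ᵇ b then suc zero else zero)
  eq i with toℕ i <ᵇ a in eqa | toℕ i <ᵇ b in eqb
  ... | true  | true  = refl
  ... | true  | false =
    ⊥-elim (subst T eqb (<⇒<ᵇ (<-trans (<ᵇ⇒< (toℕ i) a (subst T (sym eqa) tt)) a<b)))
  ... | false | true  = refl
  ... | false | false = refl

HasStar-stepLine : ∀ k {M} a b → a < b → b ≤ M → HasStar (stepLine k {M} a b)
HasStar-stepLine k a b a<b b≤M = AnyP.tabulate⁺ (fromℕ< a<M) eq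
  where
  a<M = ≤-trans a<b b≤M
  eq : (if toℕ (fromℕ< a<M) <ᵇ a then just (suc zero)
        else if toℕ (fromℕ< a<M) <ᵇ b then nothing else just zero) ≡ nothing
  eq rewrite toℕ-fromℕ< a<M with a <ᵇ a in eqa | a <ᵇ b in eqb
  ... | true  | _     = ⊥-elim (<-irrefl refl (<ᵇ⇒< a a (subst T (sym eqa) tt)))
  ... | false | true  = refl
  ... | false | false = ⊥-elim (subst T eqb (<⇒<ᵇ a<b))

-- The first block comes from the pigeonhole principle for the `suc M` test words, each coloured by
-- its behaviour in front of all words of length `N`. The other blocks are found for a colouring
-- that records all letters in the first block, hence `r ^ suc (suc k)` in the recursive call.
fuse-letters : ∀ k n r → Σ ℕ λ N → ∀ (χ : Vec (Fin (suc (suc k))) N → Fin r) →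
               Σ (Blocks (suc (suc k)) n N) λ B →
                 ∀ u → χ (fillBlocks B u) ≡ χ (fillBlocks B (Vec.map (suc ∘ collapse) u))
fuse-letters k zero    r = 0 , λ χ → [] , λ { [] → refl }
fuse-letters k (suc n) r with fuse-letters k n (r ^ suc (suc k))
... | N , H = M + N , λ χ → go χ
  where
  F = Finite-Vec (Finite-Fin (suc (suc k))) N
  M = r ^ size F
  go : (χ : Vec (Fin (suc (suc k))) (M + N) → Fin r) →
       Σ (Blocks (suc (suc k)) (suc n) (M + N)) λ B →
         ∀ u → χ (fillBlocks B u) ≡ χ (fillBlocks B (Vec.map (suc ∘ collapse) u))
  go χ with pigeonhole (n<1+n M) (λ a → code F (λ y → χ (step k (toℕ a) ++ y)))
  ... | a , b , a<b , same = add L star B , eq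
    where
    L = stepLine k {M} (toℕ a) (toℕ b)
    star = HasStar-stepLine k (toℕ a) (toℕ b) a<b (≤-pred (toℕ<n b))
    A = Finite-Fin (suc (suc k))
    HB = H (λ y → code A (λ x → χ (fill L x ++ y)))
    B = proj₁ HB
    swap : ∀ x y → χ (fill L x ++ y) ≡ χ (fill L (suc (collapse x)) ++ y)
    swap (suc x) y = refl
    swap zero    y = begin
      χ (fill L zero ++ y)         ≡⟨ cong (λ v → χ (v ++ y)) (fill-stepLine₀ k (toℕ a) (toℕ b)) ⟩
      χ (step k (toℕ a) ++ y)      ≡⟨ code-injective F _ _ same y ⟩
      χ (step k (toℕ b) ++ y)      ≡⟨ cong (λ v → χ (v ++ y)) (sym (fill-stepLine₁ k (toℕ a) (toℕ b) a<b)) ⟩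
      χ (fill L (suc zero) ++ y)   ∎
      where open ≡-Reasoning
    eq : ∀ u → χ (fillBlocks (add L star B) u)
               ≡ χ (fillBlocks (add L star B) (Vec.map (suc ∘ collapse) u))
    eq (x ∷ u) = trans (code-injective A (λ x → χ (fill L x ++ fillBlocks B u))
                         (λ x → χ (fill L x ++ fillBlocks B (Vec.map (suc ∘ collapse) u)))
                         (proj₂ HB u) x)
                       (swap x (fillBlocks B (Vec.map (suc ∘ collapse) u)))

HalesJewett : ∀ k r → Σ ℕ λ N → ∀ (χ : Vec (Fin (suc k)) N → Fin r) →
              Σ (Template (suc k) N) λ T → HasStar T ×
                (∀ x y → χ (fill T x) ≡ χ (fill T y))
HalesJewett zero    r = 1 , λ χ → nothing ∷ [] , here refl , λ { zero zero → refl }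
HalesJewett (suc k) r with HalesJewett k r
... | n , H with fuse-letters k n r
... | N , G = N , go
  where
  go : (χ : Vec (Fin (suc (suc k))) N → Fin r) →
       Σ (Template (suc (suc k)) N) λ T → HasStar T × (∀ x y → χ (fill T x) ≡ χ (fill T y))
  go χ with G χ
  ... | B , inv with H (λ u → χ (fillBlocks B (Vec.map suc u)))
  ... | T₀ , star , mono = pull B T₁ , HasStar-pull B T₁ star₁ ,
        λ x y → trans (reduce x) (trans (mono (collapse x) (collapse y)) (sym (reduce y)))
    where
    T₁ = Vec.map (Maybe.map suc) T₀
    star₁ = AnyP.map⁺ (Any.map (λ { refl → refl }) star)
    lower : ∀ {n} (T : Template (suc k) n) x →
            Vec.map (suc ∘ collapse) (fill (Vec.map (Maybe.map suc) T) x) ≡ Vec.map suc (fill T (collapse x))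
    lower []            x = refl
    lower (just c  ∷ T) x = cong (_ ∷_) (lower T x)
    lower (nothing ∷ T) x = cong (_ ∷_) (lower T x)
    reduce : ∀ x → χ (fill (pull B T₁) x) ≡ χ (fillBlocks B (Vec.map suc (fill T₀ (collapse x))))
    reduce x = begin
      χ (fill (pull B T₁) x)                                    ≡⟨ cong χ (fill-pull B T₁ x) ⟩
      χ (fillBlocks B (fill T₁ x))                              ≡⟨ inv (fill T₁ x) ⟩
      χ (fillBlocks B (Vec.map (suc ∘ collapse) (fill T₁ x)))   ≡⟨ cong (χ ∘ fillBlocks B) (lower T₀ x) ⟩
      χ (fillBlocks B (Vec.map suc (fill T₀ (collapse x))))     ∎
      where open ≡-Reasoning

-- Words

Forest : Set
Forest = List Tree

private variable
  a b c : ℕ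
  t u   : Tree
  V     : Set
  B C C₁ C₂ D F K S S′ S₁ S₁′ S₂ S₂′ : Forest

infixr 5 _◂_

_◂_ : ∀ {X : Set} {n} → X → (Fin n → X) → Fin (suc n) → X
(x ◂ ρ) zero    = x
(x ◂ ρ) (suc l) = ρ l

lift : (Fin b → Fin a) → Fin (suc b) → Fin (suc a)
lift σ = zero ◂ suc ∘ σ

-- A word of Word a C S encodes a map assigning to each node of C one of a constants or a
-- node of S, together with an embedding of S into C sending x to the least node of value x.
-- In skip the first tree of C contains no node of the image; in pass it contains the image
-- of the tree t, above its root, which has a constant value; in bind its root is the image of
-- the root of a tree of S, which from there on counts as an additional constant. Since the
-- trees of S have to go to different trees of C, words with one constant between children
-- of two trees are the rigid surjections of these trees.
data Word : ℕ → Forest → Forest → Set where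
  []   : Word a [] []
  skip : Fin a → Word a C₁ [] → Word a C₂ S → Word a (node C₁ ∷ C₂) S
  pass : Fin a → Word a C₁ (t ∷ []) → Word a C₂ S → Word a (node C₁ ∷ C₂) (t ∷ S)
  bind : Word (suc a) C₁ S₁ → Word a C₂ S₂ → Word a (node C₁ ∷ C₂) (node S₁ ∷ S₂)

skip-cong : ∀ {l l′ : Fin a} {w v : Word a C₁ []} {w′ v′ : Word a C₂ S} →
            l ≡ l′ → w ≡ v → w′ ≡ v′ → skip l w w′ ≡ skip l′ v v′
skip-cong refl refl refl = refl

pass-cong : ∀ {l l′ : Fin a} {w v : Word a C₁ (t ∷ [])} {w′ v′ : Word a C₂ S} →
            l ≡ l′ → w ≡ v → w′ ≡ v′ → pass l w w′ ≡ pass l′ v v′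
pass-cong refl refl refl = refl

bind-cong : ∀ {w v : Word (suc a) C₁ S₁} {w′ v′ : Word a C₂ S₂} →
            w ≡ v → w′ ≡ v′ → Word.bind w w′ ≡ bind v v′
bind-cong refl refl = refl

relabel : (Fin b → Fin a) → Word b C S → Word a C S
relabel σ []            = []
relabel σ (skip l w w′) = skip (σ l) (relabel σ w) (relabel σ w′)
relabel σ (pass l w w′) = pass (σ l) (relabel σ w) (relabel σ w′)
relabel σ (bind w w′)   = bind (relabel (lift σ) w) (relabel σ w′)

-- `σ` interprets the constants of the first word. Below a `bind` the bound root is one more
-- constant: it becomes `m` if the second word gives this root the value `m`, and stays new if the
-- second word binds it too. The continuations ending in `[]` arise because only the first tree of
-- `K` lies in a tree that is passed.
comp : (Fin b → Fin a) → Word b C K → Word a K S → Word a C S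
comp σ []            []            = []
comp σ (skip l w w′) v             = skip (σ l) (comp σ w []) (comp σ w′ v)
comp σ (pass l w w′) (skip m v v′) = skip (σ l) (comp σ w (skip m v [])) (comp σ w′ v′)
comp σ (pass l w w′) (pass m v v′) = pass (σ l) (comp σ w (pass m v [])) (comp σ w′ v′)
comp σ (pass l w w′) (bind v v′)   = pass (σ l) (comp σ w (bind v [])) (comp σ w′ v′)
comp σ (bind w w′)   (skip m v v′) = skip m (comp (m ◂ σ) w v) (comp σ w′ v′)
comp σ (bind w w′)   (pass m v v′) = pass m (comp (m ◂ σ) w v) (comp σ w′ v′)
comp σ (bind w w′)   (bind v v′)   = bind (comp (lift σ) w v) (comp σ w′ v′)

infixr 6 _•_

_•_ : Word a C K → Word a K S → Word a C S
w • v = comp id w v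

-- The substitution σ is only determined up to pointwise equality.
comp-assoc : ∀ {τ : Fin b → Fin a} {ρ : Fin c → Fin b} {σ : Fin c → Fin a} →
             (∀ l → τ (ρ l) ≡ σ l) →
             (w : Word c C D) (v : Word b D K) (u : Word a K S) →
             comp τ (comp ρ w v) u ≡ comp σ w (comp τ v u)
comp-assoc h [] [] [] = refl
comp-assoc h (skip l w w′) v u =
  skip-cong (h l) (comp-assoc h w [] []) (comp-assoc h w′ v u)
comp-assoc h (pass l w w′) (skip m v v′) u =
  skip-cong (h l) (comp-assoc h w (skip m v []) []) (comp-assoc h w′ v′ u)
comp-assoc h (pass l w w′) (pass m v v′) (skip n u u′) =
  skip-cong (h l) (comp-assoc h w (pass m v []) (skip n u [])) (comp-assoc h w′ v′ u′)
comp-assoc h (pass l w w′) (pass m v v′) (pass n u u′) =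
  pass-cong (h l) (comp-assoc h w (pass m v []) (pass n u [])) (comp-assoc h w′ v′ u′)
comp-assoc h (pass l w w′) (pass m v v′) (bind u u′) =
  pass-cong (h l) (comp-assoc h w (pass m v []) (bind u [])) (comp-assoc h w′ v′ u′)
comp-assoc h (pass l w w′) (bind v v′) (skip n u u′) =
  skip-cong (h l) (comp-assoc h w (bind v []) (skip n u [])) (comp-assoc h w′ v′ u′)
comp-assoc h (pass l w w′) (bind v v′) (pass n u u′) =
  pass-cong (h l) (comp-assoc h w (bind v []) (pass n u [])) (comp-assoc h w′ v′ u′)
comp-assoc h (pass l w w′) (bind v v′) (bind u u′) =
  pass-cong (h l) (comp-assoc h w (bind v []) (bind u [])) (comp-assoc h w′ v′ u′)
comp-assoc h (bind w w′) (skip m v v′) u =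
  skip-cong refl (comp-assoc (λ { zero → refl ; (suc l) → h l }) w v []) (comp-assoc h w′ v′ u)
comp-assoc h (bind w w′) (pass m v v′) (skip n u u′) =
  skip-cong refl (comp-assoc (λ { zero → refl ; (suc l) → h l }) w v (skip n u [])) (comp-assoc h w′ v′ u′)
comp-assoc h (bind w w′) (pass m v v′) (pass n u u′) =
  pass-cong refl (comp-assoc (λ { zero → refl ; (suc l) → h l }) w v (pass n u [])) (comp-assoc h w′ v′ u′)
comp-assoc h (bind w w′) (pass m v v′) (bind u u′) =
  pass-cong refl (comp-assoc (λ { zero → refl ; (suc l) → h l }) w v (bind u [])) (comp-assoc h w′ v′ u′)
comp-assoc h (bind w w′) (bind v v′) (skip n u u′) =
  skip-cong refl (comp-assoc (λ { zero → refl ; (suc l) → h l }) w v u) (comp-assoc h w′ v′ u′)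
comp-assoc h (bind w w′) (bind v v′) (pass n u u′) =
  pass-cong refl (comp-assoc (λ { zero → refl ; (suc l) → h l }) w v u) (comp-assoc h w′ v′ u′)
comp-assoc h (bind w w′) (bind v v′) (bind u u′) =
  bind-cong (comp-assoc (λ { zero → refl ; (suc l) → cong suc (h l) }) w v u) (comp-assoc h w′ v′ u′)

comp-cong : ∀ {σ σ′ : Fin b → Fin a} → (∀ l → σ l ≡ σ′ l) →
            (w : Word b C K) (v : Word a K S) → comp σ w v ≡ comp σ′ w v
comp-cong h []            []            = refl
comp-cong h (skip l w w′) v             = skip-cong (h l) (comp-cong h w []) (comp-cong h w′ v)
comp-cong h (pass l w w′) (skip m v v′) = skip-cong (h l) (comp-cong h w (skip m v [])) (comp-cong h w′ v′)
comp-cong h (pass l w w′) (pass m v v′) = pass-cong (h l) (comp-cong h w (pass m v [])) (comp-cong h w′ v′)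
comp-cong h (pass l w w′) (bind v v′)   = pass-cong (h l) (comp-cong h w (bind v [])) (comp-cong h w′ v′)
comp-cong h (bind w w′)   (skip m v v′) =
  skip-cong refl (comp-cong (λ { zero → refl ; (suc l) → h l }) w v) (comp-cong h w′ v′)
comp-cong h (bind w w′)   (pass m v v′) =
  pass-cong refl (comp-cong (λ { zero → refl ; (suc l) → h l }) w v) (comp-cong h w′ v′)
comp-cong h (bind w w′)   (bind v v′)   =
  bind-cong (comp-cong (λ { zero → refl ; (suc l) → cong suc (h l) }) w v) (comp-cong h w′ v′)

comp-relabel : ∀ {τ : Fin b → Fin a} {ρ : Fin c → Fin b} {σ : Fin c → Fin a} →
               (∀ l → τ (ρ l) ≡ σ l) → (w : Word c C K) (v : Word a K S) →
               comp τ (relabel ρ w) v ≡ comp σ w v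
comp-relabel h []            []            = refl
comp-relabel h (skip l w w′) v             = skip-cong (h l) (comp-relabel h w []) (comp-relabel h w′ v)
comp-relabel h (pass l w w′) (skip m v v′) = skip-cong (h l) (comp-relabel h w (skip m v [])) (comp-relabel h w′ v′)
comp-relabel h (pass l w w′) (pass m v v′) = pass-cong (h l) (comp-relabel h w (pass m v [])) (comp-relabel h w′ v′)
comp-relabel h (pass l w w′) (bind v v′)   = pass-cong (h l) (comp-relabel h w (bind v [])) (comp-relabel h w′ v′)
comp-relabel h (bind w w′)   (skip m v v′) =
  skip-cong refl (comp-relabel (λ { zero → refl ; (suc l) → h l }) w v) (comp-relabel h w′ v′)
comp-relabel h (bind w w′)   (pass m v v′) =
  pass-cong refl (comp-relabel (λ { zero → refl ; (suc l) → h l }) w v) (comp-relabel h w′ v′)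
comp-relabel h (bind w w′)   (bind v v′)   =
  bind-cong (comp-relabel (λ { zero → refl ; (suc l) → cong suc (h l) }) w v) (comp-relabel h w′ v′)

•-[] : (w : Word a C []) → w • [] ≡ w
•-[] []            = refl
•-[] (skip l w w′) = skip-cong refl (•-[] w) (•-[] w′)

infixr 5 _⧺_

_⧺_ : Word a C S → Word a D K → Word a (C List.++ D) (S List.++ K)
[]          ⧺ v = v
skip l w w′ ⧺ v = skip l w (w′ ⧺ v)
pass l w w′ ⧺ v = pass l w (w′ ⧺ v)
bind w w′   ⧺ v = bind w (w′ ⧺ v)

-- The interchange law, by which the first tree of `K` and the rest can be treated separately and
-- put side by side.
comp-⧺ : ∀ (σ : Fin b → Fin a) (w : Word b C K) (w₂ : Word b C₂ D) (v : Word a K S) (v₂ : Word a D S₂) →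
         comp σ (w ⧺ w₂) (v ⧺ v₂) ≡ comp σ w v ⧺ comp σ w₂ v₂
comp-⧺ σ []            w₂ []            v₂ = refl
comp-⧺ σ (skip l w w′) w₂ v             v₂ = skip-cong refl refl (comp-⧺ σ w′ w₂ v v₂)
comp-⧺ σ (pass l w w′) w₂ (skip m v v′) v₂ = skip-cong refl refl (comp-⧺ σ w′ w₂ v′ v₂)
comp-⧺ σ (pass l w w′) w₂ (pass m v v′) v₂ = pass-cong refl refl (comp-⧺ σ w′ w₂ v′ v₂)
comp-⧺ σ (pass l w w′) w₂ (bind v v′)   v₂ = pass-cong refl refl (comp-⧺ σ w′ w₂ v′ v₂)
comp-⧺ σ (bind w w′)   w₂ (skip m v v′) v₂ = skip-cong refl refl (comp-⧺ σ w′ w₂ v′ v₂)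
comp-⧺ σ (bind w w′)   w₂ (pass m v v′) v₂ = pass-cong refl refl (comp-⧺ σ w′ w₂ v′ v₂)
comp-⧺ σ (bind w w′)   w₂ (bind v v′)   v₂ = bind-cong refl (comp-⧺ σ w′ w₂ v′ v₂)

•-assoc : (w : Word a C D) (v : Word a D K) (u : Word a K S) → (w • v) • u ≡ w • (v • u)
•-assoc = comp-assoc (λ _ → refl)

relabel-comp : ∀ {τ : Fin b → Fin a} {ρ : Fin c → Fin b} {σ : Fin c → Fin a} →
               (∀ l → τ (ρ l) ≡ σ l) → (w : Word c C K) (v : Word b K S) →
               relabel τ (comp ρ w v) ≡ comp σ w (relabel τ v)
relabel-comp h [] [] = refl
relabel-comp h (skip l w w′) v =
  skip-cong (h l) (relabel-comp h w []) (relabel-comp h w′ v)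
relabel-comp h (pass l w w′) (skip m v v′) =
  skip-cong (h l) (relabel-comp h w (skip m v [])) (relabel-comp h w′ v′)
relabel-comp h (pass l w w′) (pass m v v′) =
  pass-cong (h l) (relabel-comp h w (pass m v [])) (relabel-comp h w′ v′)
relabel-comp h (pass l w w′) (bind v v′) =
  pass-cong (h l) (relabel-comp h w (bind v [])) (relabel-comp h w′ v′)
relabel-comp h (bind w w′) (skip m v v′) =
  skip-cong refl (relabel-comp (λ { zero → refl ; (suc l) → h l }) w v) (relabel-comp h w′ v′)
relabel-comp h (bind w w′) (pass m v v′) =
  pass-cong refl (relabel-comp (λ { zero → refl ; (suc l) → h l }) w v) (relabel-comp h w′ v′)
relabel-comp h (bind w w′) (bind v v′) =
  bind-cong (relabel-comp (λ { zero → refl ; (suc l) → cong suc (h l) }) w v) (relabel-comp h w′ v′)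

relabel-inverse : ∀ {τ : Fin b → Fin a} {ρ : Fin a → Fin b} →
                  (∀ l → τ (ρ l) ≡ l) → (w : Word a C S) → relabel τ (relabel ρ w) ≡ w
relabel-inverse h []            = refl
relabel-inverse h (skip l w w′) =
  skip-cong (h l) (relabel-inverse h w) (relabel-inverse h w′)
relabel-inverse h (pass l w w′) =
  pass-cong (h l) (relabel-inverse h w) (relabel-inverse h w′)
relabel-inverse h (bind w w′) =
  bind-cong (relabel-inverse (λ { zero → refl ; (suc l) → cong suc (h l) }) w) (relabel-inverse h w′)

instantiate : Fin a → Word (suc a) C S → Word a C S
instantiate l = relabel (l ◂ id)

weaken : Word a C S → Word (suc a) C S
weaken = relabel suc

-- In `w • weaken v` the new constant comes from `w` alone. One word `w` with an extra constant thus
-- covers all values `l` of a bound root.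
instantiate-comp : ∀ l (w : Word (suc a) C K) (v : Word a K S) →
                   instantiate l (w • weaken v) ≡ comp (l ◂ id) w v
instantiate-comp l w v =
  trans (relabel-comp (λ _ → refl) w (weaken v))
        (cong (comp (l ◂ id) w) (relabel-inverse (λ _ → refl) v))

constant : ∀ C → Word (suc a) C []
constant []            = []
constant (node C ∷ C′) = skip zero (constant C) (constant C′)

-- Labelled paths to the root of a tree of the forest, or to a node above it: the
-- labels are those of the proper predecessors of the end point.
data Path : ℕ → Forest → Set where
  stop : Path a (t ∷ C)
  down : Fin a → Path a C₁ → Path a (node C₁ ∷ C₂)
  next : Path a C → Path a (t ∷ C)

firstPath : Word a C (t ∷ S) → Path a C
firstPath (skip l w w′) = next (firstPath w′)
firstPath (pass l w w′) = down l (firstPath w)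
firstPath (bind w w′)   = stop

-- Nodes outside the image of `K` take their labels from the word. At the image of a node of `K` the
-- label `m` of the path is used, and it also replaces the constant bound there.
comp-path : (Fin b → Fin a) → Word b C K → Path a K → Path a C
comp-path σ (skip l w w′) p          = next (comp-path σ w′ p)
comp-path σ (pass l w w′) stop       = down (σ l) (comp-path σ w stop)
comp-path σ (pass l w w′) (down m p) = down (σ l) (comp-path σ w (down m p))
comp-path σ (pass l w w′) (next p)   = next (comp-path σ w′ p)
comp-path σ (bind w w′)   stop       = stop
comp-path σ (bind w w′)   (down m p) = down m (comp-path (m ◂ σ) w p)
comp-path σ (bind w w′)   (next p)   = next (comp-path σ w′ p)

_•ₚ_ : Word a C K → Path a K → Path a C
w •ₚ p = comp-path id w p

infixr 6 _•ₚ_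

firstPath-comp : ∀ (σ : Fin b → Fin a) (w : Word b C K) (v : Word a K (t ∷ S)) →
                 firstPath (comp σ w v) ≡ comp-path σ w (firstPath v)
firstPath-comp σ (skip l w w′) v             = cong next (firstPath-comp σ w′ v)
firstPath-comp σ (pass l w w′) (skip m v v′) = cong next (firstPath-comp σ w′ v′)
firstPath-comp σ (pass l w w′) (pass m v v′) = cong (down _) (firstPath-comp σ w (pass m v []))
firstPath-comp σ (pass l w w′) (bind v v′)   = cong (down _) (firstPath-comp σ w (bind v []))
firstPath-comp σ (bind w w′)   (skip m v v′) = cong next (firstPath-comp σ w′ v′)
firstPath-comp σ (bind w w′)   (pass m v v′) = cong (down m) (firstPath-comp (m ◂ σ) w v)
firstPath-comp σ (bind w w′)   (bind v v′)   = refl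

comp-path-assoc : ∀ {τ : Fin b → Fin a} {ρ : Fin c → Fin b} {σ : Fin c → Fin a} →
                  (∀ l → τ (ρ l) ≡ σ l) →
                  (w : Word c C D) (v : Word b D K) (p : Path a K) →
                  comp-path τ (comp ρ w v) p ≡ comp-path σ w (comp-path τ v p)
comp-path-assoc h [] [] ()
comp-path-assoc h (skip l w w′) v p = cong next (comp-path-assoc h w′ v p)
comp-path-assoc h (pass l w w′) (skip m v v′) p = cong next (comp-path-assoc h w′ v′ p)
comp-path-assoc h (pass l w w′) (pass m v v′) stop =
  cong₂ down (h l) (comp-path-assoc h w (pass m v []) stop)
comp-path-assoc h (pass l w w′) (pass m v v′) (down n p) =
  cong₂ down (h l) (comp-path-assoc h w (pass m v []) (down n p))
comp-path-assoc h (pass l w w′) (pass m v v′) (next p) = cong next (comp-path-assoc h w′ v′ p)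
comp-path-assoc h (pass l w w′) (bind v v′) stop =
  cong₂ down (h l) (comp-path-assoc h w (bind v []) stop)
comp-path-assoc h (pass l w w′) (bind v v′) (down n p) =
  cong₂ down (h l) (comp-path-assoc h w (bind v []) (down n p))
comp-path-assoc h (pass l w w′) (bind v v′) (next p) = cong next (comp-path-assoc h w′ v′ p)
comp-path-assoc h (bind w w′) (skip m v v′) p = cong next (comp-path-assoc h w′ v′ p)
comp-path-assoc h (bind w w′) (pass m v v′) stop =
  cong (down _) (comp-path-assoc (λ { zero → refl ; (suc l) → h l }) w v stop)
comp-path-assoc h (bind w w′) (pass m v v′) (down n p) =
  cong (down _) (comp-path-assoc (λ { zero → refl ; (suc l) → h l }) w v (down n p))
comp-path-assoc h (bind w w′) (pass m v v′) (next p) = cong next (comp-path-assoc h w′ v′ p)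
comp-path-assoc h (bind w w′) (bind v v′) stop = refl
comp-path-assoc h (bind w w′) (bind v v′) (down n p) =
  cong (down _) (comp-path-assoc (λ { zero → refl ; (suc l) → h l }) w v p)
comp-path-assoc h (bind w w′) (bind v v′) (next p) = cong next (comp-path-assoc h w′ v′ p)

comp-path-relabel : ∀ {τ : Fin b → Fin a} {ρ : Fin c → Fin b} {σ : Fin c → Fin a} →
                    (∀ l → τ (ρ l) ≡ σ l) → (w : Word c C K) (p : Path a K) →
                    comp-path τ (relabel ρ w) p ≡ comp-path σ w p
comp-path-relabel h (skip l w w′) p          = cong next (comp-path-relabel h w′ p)
comp-path-relabel h (pass l w w′) stop       = cong₂ down (h l) (comp-path-relabel h w stop)
comp-path-relabel h (pass l w w′) (down m p) = cong₂ down (h l) (comp-path-relabel h w (down m p))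
comp-path-relabel h (pass l w w′) (next p)   = cong next (comp-path-relabel h w′ p)
comp-path-relabel h (bind w w′)   stop       = refl
comp-path-relabel h (bind w w′)   (down m p) =
  cong (down m) (comp-path-relabel (λ { zero → refl ; (suc l) → h l }) w p)
comp-path-relabel h (bind w w′)   (next p)   = cong next (comp-path-relabel h w′ p)

relabel-path : (Fin b → Fin a) → Path b C → Path a C
relabel-path σ stop       = stop
relabel-path σ (down l p) = down (σ l) (relabel-path σ p)
relabel-path σ (next p)   = next (relabel-path σ p)

firstPath-relabel : ∀ (σ : Fin b → Fin a) (w : Word b C (t ∷ S)) →
                    firstPath (relabel σ w) ≡ relabel-path σ (firstPath w)
firstPath-relabel σ (skip l w w′) = cong next (firstPath-relabel σ w′)
firstPath-relabel σ (pass l w w′) = cong (down (σ l)) (firstPath-relabel σ w)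
firstPath-relabel σ (bind w w′)   = refl

Finite-Word : ∀ a C S → Finite (Word a C S)
Finite-Word a [] []      = Finite-retract (λ _ → []) (λ _ → tt) (λ { [] → refl }) Finite-⊤
Finite-Word a [] (s ∷ S) = Finite-retract (λ ()) (λ ()) (λ ()) Finite-⊥
Finite-Word a (node C ∷ C′) [] =
  Finite-retract (λ { (l , w , w′) → skip l w w′ }) (λ { (skip l w w′) → l , w , w′ })
                 (λ { (skip l w w′) → refl })
                 (Finite-× (Finite-Fin a) (Finite-× (Finite-Word a C []) (Finite-Word a C′ [])))
Finite-Word a (node C ∷ C′) (node T ∷ S) =
  Finite-retract (λ { (inj₁ (l , w , w′)) → skip l w w′
                    ; (inj₂ (inj₁ (l , w , w′))) → pass l w w′
                    ; (inj₂ (inj₂ (w , w′))) → bind w w′ })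
                 (λ { (skip l w w′) → inj₁ (l , w , w′)
                    ; (pass l w w′) → inj₂ (inj₁ (l , w , w′))
                    ; (bind w w′) → inj₂ (inj₂ (w , w′)) })
                 (λ { (skip l w w′) → refl ; (pass l w w′) → refl ; (bind w w′) → refl })
                 (Finite-⊎ (Finite-× (Finite-Fin a) (Finite-× (Finite-Word a C []) (Finite-Word a C′ (node T ∷ S))))
                   (Finite-⊎ (Finite-× (Finite-Fin a) (Finite-× (Finite-Word a C (node T ∷ [])) (Finite-Word a C′ S)))
                             (Finite-× (Finite-Word (suc a) C T) (Finite-Word a C′ S))))

Finite-Path : ∀ a C → Finite (Path a C)
Finite-Path a [] = Finite-retract (λ ()) (λ ()) (λ ()) Finite-⊥
Finite-Path a (node C ∷ C′) =
  Finite-retract (λ { (inj₁ tt) → stop ; (inj₂ (inj₁ (l , p))) → down l p ; (inj₂ (inj₂ p)) → next p })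
                 (λ { stop → inj₁ tt ; (down l p) → inj₂ (inj₁ (l , p)) ; (next p) → inj₂ (inj₂ p) })
                 (λ { stop → refl ; (down l p) → refl ; (next p) → refl })
                 (Finite-⊎ Finite-⊤ (Finite-⊎ (Finite-× (Finite-Fin a) (Finite-Path a C)) (Finite-Path a C′)))

-- The dual Ramsey theorem

-- A common form of the Ramsey statements: the elements of `X C` are coloured, `M C` consists of the
-- copies of the small structure in `C`, `Y` of the objects in the small structure, and `R` tells
-- which of these are to get the same colour.
record Problem : Set₁ where
  field
    Obj : Set
    X   : Obj → Set
    M   : Obj → Set
    Y   : Set
    R   : Y → Y → Set
    act : ∀ {C} → M C → Y → X C
    finX : ∀ C → Finite (X C)
    finY : Finite Y

Arrow : Problem → Set
Arrow P = ∀ r → Σ Obj λ C → ∀ (χ : X C → Fin r) →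
          Σ (M C) λ w → ∀ v v′ → R v v′ → χ (act w v) ≡ χ (act w v′)
  where open Problem P

_⊗_ : Problem → Problem → Problem
P ⊗ Q = record
  { Obj = P.Obj × Q.Obj
  ; X = λ { (C , D) → P.X C × Q.X D }
  ; M = λ { (C , D) → P.M C × Q.M D }
  ; Y = P.Y × Q.Y
  ; R = λ { (u , v) (u′ , v′) → P.R u u′ × Q.R v v′ }
  ; act = λ { (w , z) (u , v) → P.act w u , Q.act z v }
  ; finX = λ { (C , D) → Finite-× (P.finX C) (Q.finX D) }
  ; finY = Finite-× P.finY Q.finY
  }
  where module P = Problem P
        module Q = Problem Q

-- The product argument: `z` is chosen for colours recording all of `P.X C₀`, then `w` for colours
-- recording all of `Q.Y`. Hence `C₀` has to be fixed before `D₀`.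
Arrow-⊗ : ∀ P Q → Arrow P → Arrow Q → Arrow (P ⊗ Q)
Arrow-⊗ P Q HP HQ r = (C₀ , D₀) , go
  where
  module P = Problem P
  module Q = Problem Q
  C₀ = proj₁ (HP (r ^ size Q.finY))
  D₀ = proj₁ (HQ (r ^ size (P.finX C₀)))
  go : (χ : P.X C₀ × Q.X D₀ → Fin r) → Σ (P.M C₀ × Q.M D₀) λ { (w , z) →
       ∀ v v′ → P.R (proj₁ v) (proj₁ v′) × Q.R (proj₂ v) (proj₂ v′) →
       χ (P.act w (proj₁ v) , Q.act z (proj₂ v)) ≡ χ (P.act w (proj₁ v′) , Q.act z (proj₂ v′)) }
  go χ with proj₂ (HQ (r ^ size (P.finX C₀))) (λ y → code (P.finX C₀) (λ x → χ (x , y)))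
  ... | z , hz with proj₂ (HP (r ^ size Q.finY)) (λ x → code Q.finY (λ v → χ (x , Q.act z v)))
  ... | w , hw = (w , z) , λ { (u , v) (u′ , v′) (ru , rv) →
        trans (code-injective (P.finX C₀) (λ x → χ (x , Q.act z v)) (λ x → χ (x , Q.act z v′)) (hz v v′ rv) (P.act w u))
              (code-injective Q.finY (λ v → χ (P.act w u , Q.act z v)) (λ v → χ (P.act w u′ , Q.act z v)) (hw u u′ ru) v′) }

-- Here words act between arbitrary forests, so that solutions of different problems can be
-- composed.
record System (a : ℕ) : Set₁ where
  field
    X        : Forest → Set
    R        : ∀ {K} → X K → X K → Set
    act      : ∀ {C K} → Word a C K → X K → X C
    finX     : ∀ K → Finite (X K)
    act-comp : ∀ {C D K} (w : Word a C D) (u : Word a D K) v → act (w • u) v ≡ act w (act u v)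
    R-act    : ∀ {C K} (w : Word a C K) {v v′} → R v v′ → R (act w v) (act w v′)

At : ∀ {a} → System a → Forest → Problem
At {a} 𝒳 K = record
  { Obj = Forest ; X = X ; M = λ C → Word a C K ; Y = X K ; R = R ; act = act
  ; finX = finX ; finY = finX K }
  where open System 𝒳

_⊕_ : ∀ {a} → System a → System a → System a
𝒳 ⊕ 𝒴 = record
  { X = λ K → X.X K ⊎ Y.X K
  ; R = λ { (inj₁ x) (inj₁ x′) → X.R x x′ ; (inj₂ y) (inj₂ y′) → Y.R y y′ ; _ _ → ⊥ }
  ; act = λ w → Sum.map (X.act w) (Y.act w)
  ; finX = λ K → Finite-⊎ (X.finX K) (Y.finX K)
  ; act-comp = λ { w u (inj₁ x) → cong inj₁ (X.act-comp w u x)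
                 ; w u (inj₂ y) → cong inj₂ (Y.act-comp w u y) }
  ; R-act = λ { w {inj₁ x} {inj₁ x′} r → X.R-act w r ; w {inj₂ y} {inj₂ y′} r → Y.R-act w r }
  }
  where module X = System 𝒳
        module Y = System 𝒴

-- `w` settles the colours of the second kind on all of `D₀`, and `u` those of the first kind within
-- `D₀`. What `w` achieved survives because `u` preserves the relation.
Arrow-⊕ : ∀ {a} (𝒳 𝒴 : System a) K → Arrow (At 𝒳 K) → (∀ D₀ → Arrow (At 𝒴 D₀)) → Arrow (At (𝒳 ⊕ 𝒴) K)
Arrow-⊕ {a} 𝒳 𝒴 K HX HY r = C₀ , go
  where
  module X = System 𝒳
  module Y = System 𝒴
  D₀ = proj₁ (HX r)
  C₀ = proj₁ (HY D₀ r)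
  go : (χ : X.X C₀ ⊎ Y.X C₀ → Fin r) → Σ (Word a C₀ K) λ w → ∀ v v′ → System.R (𝒳 ⊕ 𝒴) {K} v v′ →
       χ (System.act (𝒳 ⊕ 𝒴) w v) ≡ χ (System.act (𝒳 ⊕ 𝒴) w v′)
  go χ with proj₂ (HY D₀ r) (χ ∘ inj₂)
  ... | w , hw with proj₂ (HX r) (λ x → χ (inj₁ (X.act w x)))
  ... | u , hu = w • u , λ
    { (inj₁ x) (inj₁ x′) e →
        trans (cong (χ ∘ inj₁) (X.act-comp w u x))
              (trans (hu x x′ e) (cong (χ ∘ inj₁) (sym (X.act-comp w u x′))))
    ; (inj₂ y) (inj₂ y′) e →
        trans (cong (χ ∘ inj₂) (Y.act-comp w u y))
              (trans (hw (Y.act u y) (Y.act u y′) (Y.R-act u e))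
                     (cong (χ ∘ inj₂) (sym (Y.act-comp w u y′)))) }

record Congruence (S : Forest) : Set₁ where
  field
    rel         : ∀ {a C} → Word a C S → Word a C S → Set
    rel-comp    : ∀ {a b C K} (σ : Fin b → Fin a) (w : Word b C K) {v v′ : Word a K S} →
                  rel v v′ → rel (comp σ w v) (comp σ w v′)
    rel-relabel : ∀ {a b C} (σ : Fin b → Fin a) {v v′ : Word b C S} →
                  rel v v′ → rel (relabel σ v) (relabel σ v′)

total : ∀ S → Congruence S
total S = record { rel = λ _ _ → ⊤ ; rel-comp = λ _ _ _ → tt ; rel-relabel = λ _ _ → tt }

samePath : ∀ t S → Congruence (t ∷ S)
samePath t S = record
  { rel = λ v v′ → firstPath v ≡ firstPath v′
  ; rel-comp = λ σ w {v} {v′} e → trans (firstPath-comp σ w v)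
      (trans (cong (comp-path σ w) e) (sym (firstPath-comp σ w v′)))
  ; rel-relabel = λ σ {v} {v′} e → trans (firstPath-relabel σ v)
      (trans (cong (relabel-path σ) e) (sym (firstPath-relabel σ v′)))
  }

words : ∀ a {S} → Congruence S → System a
words a {S} ρ = record
  { X = λ K → Word a K S ; R = rel ; act = _•_ ; finX = λ K → Finite-Word a K S
  ; act-comp = •-assoc ; R-act = rel-comp id }
  where open Congruence ρ

-- The pair of `l` and `v` stands for the word `pass l v []` over a single tree. A word that binds
-- the root of this tree acts on it with the bound constant replaced by `l`.
instances : ∀ a {S} → Congruence S → System (suc a)
instances a {S} ρ = record
  { X = λ K → Fin a × Word a K S
  ; R = λ { (l , v) (l′ , v′) → l ≡ l′ × rel v v′ }
  ; act = λ { w (l , v) → l , comp (l ◂ id) w v }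
  ; finX = λ K → Finite-× (Finite-Fin a) (Finite-Word a K S)
  ; act-comp = λ { w u (l , v) → cong (l ,_) (comp-assoc (λ _ → refl) w u v) }
  ; R-act = λ { w (refl , e) → refl , rel-comp _ w e }
  }
  where open Congruence ρ

-- A word with one more constant is coloured by the colours of all its instances, and
-- `instantiate-comp` recovers each of them.
Arrow-instances : ∀ a {S} (ρ : Congruence S) K → Arrow (At (words (suc a) ρ) K) → Arrow (At (instances a ρ) K)
Arrow-instances a {S} ρ K H r = proj₁ (H (r ^ a)) , go
  where
  open Congruence ρ
  C₀ = proj₁ (H (r ^ a))
  go : (χ : Fin a × Word a C₀ S → Fin r) → Σ (Word (suc a) C₀ K) λ w →
       ∀ v v′ → System.R (instances a ρ) {K} v v′ →
       χ (System.act (instances a ρ) w v) ≡ χ (System.act (instances a ρ) w v′)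
  go χ with proj₂ (H (r ^ a)) (λ u → code (Finite-Fin a) (λ l → χ (l , instantiate l u)))
  ... | w , hw = w , λ { (l , v) (.l , v′) (refl , e) →
    trans (cong (λ u → χ (l , u)) (sym (instantiate-comp l w v)))
      (trans (code-injective (Finite-Fin a) (λ l → χ (l , instantiate l (w • weaken v)))
                (λ l → χ (l , instantiate l (w • weaken v′)))
                (hw (weaken v) (weaken v′) (rel-relabel suc e)) l)
             (cong (λ u → χ (l , u)) (instantiate-comp l w v′))) }

next-injective : ∀ {a t C} {p q : Path a C} → next {t = t} p ≡ next q → p ≡ q
next-injective refl = refl

down-injective : ∀ {a C₁ C₂ l m} {p q : Path a C₁} →
                 down {C₂ = C₂} l p ≡ down m q → l ≡ m × p ≡ q
down-injective refl = refl , refl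

Ramsey : Forest → Set
Ramsey S = ∀ a K → Arrow (At (words (suc a) (total S)) K)

-- Making the colour depend on the first path only

module _ (S₁ : Forest) (H₁ : Ramsey S₁) (H₀ : Ramsey []) where

  SamePathRamsey : ℕ → Forest → Forest → Set
  SamePathRamsey a S K = Arrow (At (words (suc a) (samePath (node S₁) S)) K)

  -- The two kinds of words from a single tree to `node S₁`: the root of the target carries a label,
  -- or it is the image of the root of `node S₁`.
  inside : ∀ a → System (suc (suc a))
  inside a = instances (suc a) (samePath (node S₁) []) ⊕ words (suc (suc a)) (total S₁)

  first : ∀ a → System (suc a)
  first a = words (suc a) (samePath (node S₁) []) ⊕ words (suc a) (total [])

  rest : ∀ a S → System (suc a)
  rest a S = words (suc a) (samePath (node S₁) S) ⊕ words (suc a) (total S)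

  abstract
    Arrow-inside : ∀ K a → SamePathRamsey (suc a) [] K → Arrow (At (inside a) K)
    Arrow-inside K a Q =
      Arrow-⊕ (instances (suc a) (samePath (node S₁) [])) (words (suc (suc a)) (total S₁)) K
        (Arrow-instances (suc a) (samePath (node S₁) []) K Q) (H₁ (suc a))

    Arrow-first-rest : ∀ K₁ K₂ a S → Ramsey S → SamePathRamsey a [] K₁ → SamePathRamsey a S K₂ →
                       Arrow (At (first a) K₁ ⊗ At (rest a S) K₂)
    Arrow-first-rest K₁ K₂ a S H Q₁ Q₂ = Arrow-⊗ (At (first a) K₁) (At (rest a S) K₂)
      (Arrow-⊕ (words (suc a) (samePath (node S₁) [])) (words (suc a) (total [])) K₁ Q₁ (H₀ a))
      (Arrow-⊕ (words (suc a) (samePath (node S₁) S)) (words (suc a) (total S)) K₂ Q₂ (H a))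

  -- All words `bind v []` have the path `stop` and must get one colour, which the Ramsey property
  -- of `S₁` gives. For `pass l v []` the path consists of `l` and the path of `v`, and the
  -- assumption for `K` applies.
  samePath-tree : ∀ K a → SamePathRamsey (suc a) [] K → SamePathRamsey a [] (node K ∷ [])
  samePath-tree K a Q r with Arrow-inside K a Q r
  ... | C , colour = node C ∷ [] , go
    where
    build : System.X (inside a) C → Word (suc a) (node C ∷ []) (node S₁ ∷ [])
    build (inj₁ (l , w)) = pass l w []
    build (inj₂ w)       = bind w []
    go : (χ : Word (suc a) (node C ∷ []) (node S₁ ∷ []) → Fin r) →
         Σ (Word (suc a) (node C ∷ []) (node K ∷ [])) λ w →
           ∀ v v′ → firstPath v ≡ firstPath v′ → χ (w • v) ≡ χ (w • v′)
    go χ with colour (χ ∘ build)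
    ... | w , mono = bind w [] , mono′
      where
      unlift : ∀ v → comp (lift id) w v ≡ w • v
      unlift = comp-cong (λ { zero → refl ; (suc l) → refl }) w
      mono′ : ∀ v v′ → firstPath v ≡ firstPath v′ → χ (bind w [] • v) ≡ χ (bind w [] • v′)
      mono′ (pass l v []) (pass m u []) e = mono (inj₁ (l , v)) (inj₁ (m , u)) (down-injective e)
      mono′ (bind v [])   (bind u [])   e =
        trans (cong (λ z → χ (bind z [])) (unlift v))
              (trans (mono (inj₂ v) (inj₂ u) tt) (cong (λ z → χ (bind z [])) (sym (unlift u))))
      mono′ (pass l v []) (bind u [])   ()
      mono′ (bind v [])   (pass m u []) ()

  -- The image of `node S₁` lies either in the first part or in the second. The other two
  -- combinations are not words; `extend` gives them the extra colour `zero`.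
  glue : ∀ {a S C₁ C₂} → System.X (first a) C₁ → System.X (rest a S) C₂ →
         Maybe (Word (suc a) (C₁ List.++ C₂) (node S₁ ∷ S))
  glue (inj₁ w) (inj₂ w′) = just (w ⧺ w′)
  glue (inj₂ w) (inj₁ w′) = just (w ⧺ w′)
  glue _        _         = nothing

  extend : ∀ {r a S C₁ C₂} → (Word (suc a) (C₁ List.++ C₂) (node S₁ ∷ S) → Fin r) →
           System.X (first a) C₁ × System.X (rest a S) C₂ → Fin (suc r)
  extend χ (x , y) = maybe′ (suc ∘ χ) zero (glue x y)

  glue-mono : ∀ {r a S C₁ C₂ K₁ K₂} (χ : Word (suc a) (C₁ List.++ C₂) (node S₁ ∷ S) → Fin r)
              (w : Word (suc a) C₁ (node K₁ ∷ [])) (w′ : Word (suc a) C₂ K₂) →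
              let P = At (first a) (node K₁ ∷ []) ⊗ At (rest a S) K₂ in
              (∀ v v′ → Problem.R P v v′ →
                extend χ (Problem.act P (w , w′) v) ≡ extend χ (Problem.act P (w , w′) v′)) →
              ∀ v v′ → firstPath v ≡ firstPath v′ → χ ((w ⧺ w′) • v) ≡ χ ((w ⧺ w′) • v′)
  glue-mono χ w w′ mono (skip l v v₂) (skip m u u₂) e =
    trans (cong χ (comp-⧺ id w w′ (skip l v []) v₂)) (trans
      (suc-injective (mono (inj₂ (skip l v []) , inj₁ v₂) (inj₂ (skip m u []) , inj₁ u₂) (tt , next-injective e)))
      (cong χ (sym (comp-⧺ id w w′ (skip m u []) u₂))))
  glue-mono χ w w′ mono (pass l v v₂) (pass m u u₂) e =
    trans (cong χ (comp-⧺ id w w′ (pass l v []) v₂)) (trans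
      (suc-injective (mono (inj₁ (pass l v []) , inj₂ v₂) (inj₁ (pass m u []) , inj₂ u₂)
        (Product.uncurry (cong₂ down) (down-injective e) , tt)))
      (cong χ (sym (comp-⧺ id w w′ (pass m u []) u₂))))
  glue-mono χ w w′ mono (bind v v₂)   (bind u u₂)   e =
    trans (cong χ (comp-⧺ id w w′ (bind v []) v₂)) (trans
      (suc-injective (mono (inj₁ (bind v []) , inj₂ v₂) (inj₁ (bind u []) , inj₂ u₂) (refl , tt)))
      (cong χ (sym (comp-⧺ id w w′ (bind u []) u₂))))
  glue-mono χ w w′ mono (skip l v v₂) (pass m u u₂) ()
  glue-mono χ w w′ mono (skip l v v₂) (bind u u₂)   ()
  glue-mono χ w w′ mono (pass l v v₂) (skip m u u₂) ()
  glue-mono χ w w′ mono (pass l v v₂) (bind u u₂)   ()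
  glue-mono χ w w′ mono (bind v v₂)   (skip m u u₂) ()
  glue-mono χ w w′ mono (bind v v₂)   (pass m u u₂) ()

  -- If `K` is empty, there are no words to colour. Inside the first tree of `K` only `node S₁` has
  -- to be placed, so the call for `K₁` has nothing beside it and one more constant for the bound
  -- root.
  samePath-ramsey : ∀ K a S → Ramsey S → SamePathRamsey a S K
  samePath-ramsey []             a S H r = [] , λ χ → [] , λ ()
  samePath-ramsey (node K₁ ∷ K₂) a S H r with
    Arrow-first-rest (node K₁ ∷ []) K₂ a S H (samePath-tree K₁ a (samePath-ramsey K₁ (suc a) [] H₀))
                     (samePath-ramsey K₂ a S H) (suc r)
  ... | (C₁ , C₂) , colour = C₁ List.++ C₂ , λ χ →
    let (w , w′) , mono = colour (extend χ) in w ⧺ w′ , glue-mono χ w w′ mono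

-- The case of empty S: Hales-Jewett lines on combs

unitProblem : Problem
unitProblem = record
  { Obj = ⊤ ; X = λ _ → ⊤ ; M = λ _ → ⊤ ; Y = ⊤ ; R = λ _ _ → ⊤ ; act = λ _ _ → tt
  ; finX = λ _ → Finite-⊤ ; finY = Finite-⊤ }

power : Problem → ℕ → Problem
power P zero    = unitProblem
power P (suc N) = P ⊗ power P N

Arrow-power : ∀ P → Arrow P → ∀ N → Arrow (power P N)
Arrow-power P H zero    r = tt , λ χ → tt , λ _ _ _ → refl
Arrow-power P H (suc N) = Arrow-⊗ P (power P N) H (Arrow-power P H N)

module Comb (a : ℕ) (K : Forest) where

  P : ℕ → Problem
  P = power (At (words (suc a) (total [])) K)

  open module Pow N = Problem (P N) using () renaming (Obj to Obj; X to X; M to M; Y to Y; R to R; act to act; finX to finX; finY to finY)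

  -- The spine holds a word of `N` letters. A forest with room for `K` hangs from each of its
  -- letters, as the place of the first star is not known in advance.
  comb : ∀ N → Obj N → Tree
  comb zero    _        = node []
  comb (suc N) (D , Ds) = node (comb N Ds ∷ D)

  label : ∀ N Ds → Vec (Fin (suc a)) N → X N Ds → Word (suc a) (comb N Ds ∷ []) []
  label zero    _        _       _        = skip zero [] []
  label (suc N) (D , Ds) (x ∷ u) (d , ds) = skip x (label N Ds u ds ⧺ d) []

  constants : ∀ N → Y N
  constants zero    = tt
  constants (suc N) = constant K , constants N

  -- The forest K is embedded in the forest D hanging from the first star of the template,
  -- so that the node of that star is the meet of the images of its trees. After the first
  -- star everything else, in particular the later forests, carries constants.
  afterStar : ∀ {N Ds} → Template (suc a) N → M N Ds → Word (suc (suc a)) (comb N Ds ∷ []) []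
  afterStar []      _        = skip (suc zero) [] []
  afterStar (c ∷ T) (w , ws) =
    skip (maybe′ suc zero c) (afterStar T ws ⧺ weaken (w • constant K)) []

  line : ∀ {N Ds} (T : Template (suc a) N) → HasStar T → M N Ds →
         Word (suc a) (comb N Ds ∷ []) (node K ∷ [])
  line (just c  ∷ T) (there h) (w , ws) = pass c (line T h ws ⧺ (w • constant K)) []
  line (nothing ∷ T) _         (w , ws) = bind (afterStar T ws ⧺ weaken w) []

  -- How `v` shows up in the hanging forests: itself at the first star, constants elsewhere.
  insert : ∀ {N} (T : Template (suc a) N) → HasStar T → Word (suc a) K [] → Y N
  insert (just c  ∷ T) (there h) v = constant K , insert T h v
  insert {suc N} (nothing ∷ T) _   v = v , constants N

  afterStar-comp : ∀ {N Ds} (T : Template (suc a) N) (ws : M N Ds) l →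
                   comp (l ◂ id) (afterStar T ws) [] ≡ label N Ds (fill T l) (act N ws (constants N))
  afterStar-comp []      ws       l = refl
  afterStar-comp (c ∷ T) (w , ws) l = skip-cong (letter c)
    (trans (comp-⧺ (l ◂ id) (afterStar T ws) (weaken (w • constant K)) [] [])
           (cong₂ _⧺_ (afterStar-comp T ws l)
             (trans (comp-relabel (λ _ → refl) (w • constant K) []) (•-[] (w • constant K)))))
    refl
    where
    letter : ∀ c → (l ◂ id) (maybe′ suc zero c) ≡ fromMaybe l c
    letter (just c) = refl
    letter nothing  = refl

  line-comp : ∀ {N Ds} (T : Template (suc a) N) (h : HasStar T) (ws : M N Ds) l v →
              line T h ws • skip l v [] ≡ label N Ds (fill T l) (act N ws (insert T h v))
  line-comp (just c  ∷ T) (there h) (w , ws) l v = skip-cong refl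
    (trans (comp-⧺ id (line T h ws) (w • constant K) (skip l v []) [])
           (cong₂ _⧺_ (line-comp T h ws l v) (•-[] (w • constant K))))
    refl
  line-comp (nothing ∷ T) h (w , ws) l v = skip-cong refl
    (trans (comp-⧺ (l ◂ id) (afterStar T ws) (weaken w) [] v)
           (cong₂ _⧺_ (afterStar-comp T ws l) (comp-relabel (λ _ → refl) w v)))
    refl

  all-related : ∀ N v v′ → R N v v′
  all-related zero    _       _         = tt
  all-related (suc N) (_ , v) (_ , v′) = tt , all-related N v v′

  -- A word over `node K` is a root label and a word over `K`. The choice of `ws` removes the
  -- dependence on the latter, for all spine words at once; the root label is the letter put at the
  -- stars, and the line removes the dependence on it.
  tree-arrow : Arrow (At (words (suc a) (total [])) K) → Arrow (At (words (suc a) (total [])) (node K ∷ []))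
  tree-arrow H r with HalesJewett a r
  ... | N , HJ with Arrow-power (At (words (suc a) (total [])) K) H N (r ^ size (Finite-Vec (Finite-Fin (suc a)) N))
  ... | Ds , colour = comb N Ds ∷ [] , go
    where
    vecs = Finite-Vec (Finite-Fin (suc a)) N
    go : (χ : Word (suc a) (comb N Ds ∷ []) [] → Fin r) →
         Σ (Word (suc a) (comb N Ds ∷ []) (node K ∷ [])) λ w →
           ∀ v v′ → ⊤ → χ (w • v) ≡ χ (w • v′)
    go χ with colour (λ ds → code vecs (λ u → χ (label N Ds u ds)))
    ... | ws , indep with HJ (λ u → χ (label N Ds u (act N ws (constants N))))
    ... | T , h , mono = line T h ws , λ v v′ _ → trans (reduce v) (trans (mono _ _) (sym (reduce v′)))
      where
      letter : Word (suc a) (node K ∷ []) [] → Fin (suc a)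
      letter (skip l _ _) = l
      reduce : ∀ v → χ (line T h ws • v) ≡ χ (label N Ds (fill T (letter v)) (act N ws (constants N)))
      reduce (skip l v []) = trans (cong χ (line-comp T h ws l v))
        (code-injective vecs (λ u → χ (label N Ds u (act N ws (insert T h v))))
           (λ u → χ (label N Ds u (act N ws (constants N))))
           (indep (insert T h v) (constants N) (all-related N (insert T h v) (constants N))) (fill T l))

abstract
  ramsey-[] : Ramsey []
  ramsey-[] a []             r = [] , λ χ → [] , λ { [] [] _ → refl }
  ramsey-[] a (node K₁ ∷ K₂) r with
    Arrow-⊗ (At (words (suc a) (total [])) (node K₁ ∷ [])) (At (words (suc a) (total [])) K₂)
      (Comb.tree-arrow a K₁ (ramsey-[] a K₁)) (ramsey-[] a K₂) r
  ... | (C₁ , C₂) , colour = C₁ List.++ C₂ , λ χ →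
    let (w , w′) , mono = colour (λ { (x , y) → χ (x ⧺ y) }) in w ⧺ w′ ,
    λ { (skip l v v₂) (skip m u u₂) _ →
      trans (cong χ (comp-⧺ id w w′ (skip l v []) v₂)) (trans
        (mono (skip l v [] , v₂) (skip m u [] , u₂) (tt , tt))
        (cong χ (sym (comp-⧺ id w w′ (skip m u []) u₂)))) }

-- Monochromatic words for colourings of labelled paths

sum-update : ∀ {r} (v : Vec ℕ r) i {k} → Vec.lookup v i ≡ suc k → Vec.sum v ≡ suc (Vec.sum (v Vec.[ i ]≔ k))
sum-update (x ∷ v) zero    refl = refl
sum-update (x ∷ v) (suc i) eq   = trans (cong (x +_) (sum-update v i eq)) (+-suc x _)

lookup≤sum : ∀ {r} (v : Vec ℕ r) i → Vec.lookup v i ≤ Vec.sum v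
lookup≤sum (x ∷ v) zero    = m≤m+n x _
lookup≤sum (x ∷ v) (suc i) = ≤-trans (lookup≤sum v i) (m≤n+m _ x)

sum-replicate : ∀ r h → Vec.sum (Vec.replicate r h) ≡ r * h
sum-replicate zero    h = refl
sum-replicate (suc r) h = cong (h +_) (sum-replicate r h)

copies : ℕ → Forest → Forest
copies zero    F = []
copies (suc m) F = F List.++ copies m F

widen : ∀ D → Path a C → Path a (C List.++ D)
widen D stop       = stop
widen D (down l p) = down l p
widen D (next p)   = next (widen D p)

shift : ∀ C → Path a D → Path a (C List.++ D)
shift []      p = p
shift (t ∷ C) p = next (shift C p)

pad : ∀ D → Word (suc a) C F → Word (suc a) (C List.++ D) F
pad D []            = constant D
pad D (skip l w w′) = skip l w (pad D w′)
pad D (pass l w w′) = pass l w (pad D w′)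
pad D (bind w w′)   = bind w (pad D w′)

pad-path : ∀ (σ : Fin (suc b) → Fin a) D (w : Word (suc b) C F) p →
           comp-path σ (pad D w) p ≡ widen D (comp-path σ w p)
pad-path σ D (skip l w w′) p          = cong next (pad-path σ D w′ p)
pad-path σ D (pass l w w′) stop       = refl
pad-path σ D (pass l w w′) (down m p) = refl
pad-path σ D (pass l w w′) (next p)   = cong next (pad-path σ D w′ p)
pad-path σ D (bind w w′)   stop       = refl
pad-path σ D (bind w w′)   (down m p) = refl
pad-path σ D (bind w w′)   (next p)   = cong next (pad-path σ D w′ p)

⧺-path : ∀ (σ : Fin b → Fin a) (w : Word b C K) (v : Word b D S) p →
         (Σ (Path a K) λ q → comp-path σ (w ⧺ v) p ≡ widen D (comp-path σ w q)) ⊎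
         (Σ (Path a S) λ q → comp-path σ (w ⧺ v) p ≡ shift C (comp-path σ v q))
⧺-path σ []            v p          = inj₂ (p , refl)
⧺-path σ (skip l w w′) v p          =
  Sum.map (Product.map₂ (cong next)) (Product.map₂ (cong next)) (⧺-path σ w′ v p)
⧺-path σ (pass l w w′) v stop       = inj₁ (stop , refl)
⧺-path σ (pass l w w′) v (down m p) = inj₁ (down m p , refl)
⧺-path σ (pass l w w′) v (next p)   =
  Sum.map (λ { (q , e) → next q , cong next e }) (Product.map₂ (cong next)) (⧺-path σ w′ v p)
⧺-path σ (bind w w′)   v stop       = inj₁ (stop , refl)
⧺-path σ (bind w w′)   v (down m p) = inj₁ (down m p , refl)
⧺-path σ (bind w w′)   v (next p)   =
  Sum.map (λ { (q , e) → next q , cong next e }) (Product.map₂ (cong next)) (⧺-path σ w′ v p)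

copies-of : ∀ m → (Fin m → Word a C F) → Word a (copies m C) (copies m F)
copies-of zero    W = []
copies-of (suc m) W = W zero ⧺ copies-of m (W ∘ suc)

at : ∀ {m} → Fin m → Path a C → Path a (copies m C)
at             zero    p = widen _ p
at {C = C} (suc d) p = shift C (at d p)

copies-of-path : ∀ (σ : Fin b → Fin a) m (W : Fin m → Word b C F) p →
                 Σ (Fin m) λ d → Σ (Path a F) λ q → comp-path σ (copies-of m W) p ≡ at d (comp-path σ (W d) q)
copies-of-path σ (suc m) W p with ⧺-path σ (W zero) (copies-of m (W ∘ suc)) p
... | inj₁ (q , e) = zero , q , e
... | inj₂ (p′ , e) with copies-of-path σ m (W ∘ suc) p′
...   | d , q , e′ = suc d , q , trans e (cong (shift _) e′)

pick : ∀ {m} → Fin m → Word (suc a) C F → Word (suc a) (copies m C) F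
pick             zero    w = pad _ w
pick {C = C} (suc d) w = constant C ⧺ pick d w

constant-⧺-path : ∀ (σ : Fin (suc b) → Fin a) C (w : Word (suc b) D F) p →
                  comp-path σ (constant C ⧺ w) p ≡ shift C (comp-path σ w p)
constant-⧺-path σ []            w p = refl
constant-⧺-path σ (node _ ∷ C) w p = cong next (constant-⧺-path σ C w p)

pick-path : ∀ (σ : Fin (suc b) → Fin a) {m} (d : Fin m) (w : Word (suc b) C F) p →
            comp-path σ (pick d w) p ≡ at d (comp-path σ w p)
pick-path σ zero    w p = pad-path σ _ w p
pick-path {C = C} σ (suc d) w p =
  trans (constant-⧺-path σ C (pick d w) p) (cong (shift C) (pick-path σ d w p))

Monochromatic : ∀ {r} → (Path (suc a) C → Fin r) → Fin r → Forest → Set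
Monochromatic {a} {C} χ i F = Σ (Word (suc a) C F) λ w → ∀ p → χ (w •ₚ p) ≡ i

nodes : Forest → ℕ
nodes []             = 0
nodes (node C ∷ C′) = suc (nodes C + nodes C′)

module Towers (m′ : ℕ) where

  m : ℕ
  m = suc m′

  -- The complete `m`-ary tree with `k` levels; by `fit`, copies of it contain every small forest.
  tower : ℕ → Forest
  tower zero    = []
  tower (suc k) = node (copies m (tower k)) ∷ []

  under : ∀ k → Fin a → Word a C (tower k) → Word a (node C ∷ []) (tower k)
  under zero    l w = skip l w []
  under (suc k) l w = pass l w []

  under-path : ∀ (σ : Fin b → Fin a) k l (w : Word b C (tower k)) p →
               comp-path σ (under k l w) p ≡ down (σ l) (comp-path σ w p)
  under-path σ (suc k) l w stop       = refl
  under-path σ (suc k) l w (down n p) = refl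

  -- The complete `m`-ary tree of `N` levels with a copy of `D` on top of every branch: a path into
  -- one of the copies is a word of `N` letters, each a direction with a label, followed by a path
  -- in `D`.
  crown : ℕ → Tree → Tree
  crown zero    D = D
  crown (suc N) D = node (copies m (crown N D ∷ []))

  Letters : ℕ → ℕ → Set
  Letters a N = Vec (Fin m × Fin a) N

  along : ∀ {N D} → Letters a N → Path a (D ∷ []) → Path a (crown N D ∷ [])
  along []            q = q
  along ((d , l) ∷ u) q = down l (at d (along u q))

  through : ∀ {N D} k → Letters (suc a) N → Word (suc a) (D ∷ []) (tower k) →
            Word (suc a) (crown N D ∷ []) (tower k)
  through k []            w = w
  through k ((d , l) ∷ u) w = under k l (pick d (through k u w))

  through-path : ∀ (σ : Fin (suc b) → Fin a) {N D} k (u : Letters (suc b) N) (w : Word (suc b) (D ∷ []) (tower k)) p →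
                 comp-path σ (through k u w) p ≡ along (Vec.map (Product.map₂ σ) u) (comp-path σ w p)
  through-path σ k []            w p = refl
  through-path σ k ((d , l) ∷ u) w p = trans (under-path σ k l (pick d (through k u w)) p)
    (cong (down (σ l)) (trans (pick-path σ d (through k u w) p) (cong (at d) (through-path σ k u w p))))

  module Spread (a : ℕ) where

    A : ℕ
    A = m * suc a

    letter : Fin A → Fin m × Fin (suc a)
    letter x = quotient {m} (suc a) x , remainder {m} (suc a) x

    letters : ∀ {N} → Vec (Fin A) N → Letters (suc a) N
    letters = Vec.map letter

    afterStar : ∀ {N} → Fin m → Template A N → Letters (suc (suc a)) N
    afterStar d = Vec.map (maybe′ (Product.map₂ suc ∘ letter) (d , zero))

    -- The first star becomes the root of the larger tower, with a smaller tower in every direction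
    -- `d`. At later stars this tower again takes the direction `d` and the constant of the new root
    -- as label; so a path leaving the root with label `l` follows the line at the one letter
    -- `combine d l`.
    spread : ∀ {N D} k (T : Template A N) → HasStar T → Word (suc a) (D ∷ []) (tower k) →
             Word (suc a) (crown N D ∷ []) (tower (suc k))
    spread k (just x  ∷ T) (there h) w =
      pass (proj₂ (letter x)) (pick (proj₁ (letter x)) (spread k T h w)) []
    spread k (nothing ∷ T) _         w =
      bind (copies-of m (λ d → through k (afterStar d T) (weaken w))) []

    starPath : ∀ {N D} (T : Template A N) → HasStar T → Path (suc a) (crown N D ∷ [])
    starPath (just x  ∷ T) (there h) = down (proj₂ (letter x)) (at (proj₁ (letter x)) (starPath T h))
    starPath (nothing ∷ T) _         = stop

    fill-afterStar : ∀ {N} d l (T : Template A N) →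
                     Vec.map (Product.map₂ (l ◂ id)) (afterStar d T) ≡ letters (fill T (combine d l))
    fill-afterStar d l []            = refl
    fill-afterStar d l (just x  ∷ T) = cong (_ ∷_) (fill-afterStar d l T)
    fill-afterStar d l (nothing ∷ T) = cong₂ _∷_ (sym (remQuot-combine {m} d l)) (fill-afterStar d l T)

    spread-path : ∀ {N D} k (T : Template A N) (h : HasStar T) (w : Word (suc a) (D ∷ []) (tower k)) p →
                  (spread k T h w •ₚ p ≡ starPath T h) ⊎
                  (Σ (Fin A) λ x → Σ (Path (suc a) (tower k)) λ q →
                    spread k T h w •ₚ p ≡ along (letters (fill T x)) (w •ₚ q))
    spread-path k (just x ∷ T) (there h) w p =
      Sum.map (trans (descend p) ∘ cong (down (proj₂ (letter x)) ∘ at (proj₁ (letter x))))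
              (λ { (y , q , e) → y , q , trans (descend p) (cong (down (proj₂ (letter x)) ∘ at (proj₁ (letter x))) e) })
              (spread-path k T h w p)
      where
      descend : ∀ p → spread k (just x ∷ T) (there h) w •ₚ p
                   ≡ down (proj₂ (letter x)) (at (proj₁ (letter x)) (spread k T h w •ₚ p))
      descend stop       = cong (down _) (pick-path id (proj₁ (letter x)) (spread k T h w) stop)
      descend (down n p) = cong (down _) (pick-path id (proj₁ (letter x)) (spread k T h w) (down n p))
    spread-path k (nothing ∷ T) h w stop = inj₁ refl
    spread-path k (nothing ∷ T) h w (down l p)
      with copies-of-path (l ◂ id) m (λ d → through k (afterStar d T) (weaken w)) p
    ... | d , q , e = inj₂ (combine d l , q , (begin
      down l (comp-path (l ◂ id) (copies-of m (λ d → through k (afterStar d T) (weaken w))) p)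
        ≡⟨ cong (down l) e ⟩
      down l (at d (comp-path (l ◂ id) (through k (afterStar d T) (weaken w)) q))
        ≡⟨ cong (down l ∘ at d) (through-path (l ◂ id) k (afterStar d T) (weaken w) q) ⟩
      down l (at d (along (Vec.map (Product.map₂ (l ◂ id)) (afterStar d T)) (comp-path (l ◂ id) (weaken w) q)))
        ≡⟨ cong₂ (λ u q → down l (at d (along u q))) (fill-afterStar d l T) (weaken-path q) ⟩
      down l (at d (along (letters (fill T (combine d l))) (w •ₚ q)))
        ≡⟨ cong (λ y → along (y ∷ letters (fill T (combine d l))) (w •ₚ q)) (sym (remQuot-combine {m} d l)) ⟩
      along (letters (fill (nothing ∷ T) (combine d l))) (w •ₚ q)  ∎))
      where
      open ≡-Reasoning
      weaken-path : ∀ q → comp-path (l ◂ id) (weaken w) q ≡ w •ₚ q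
      weaken-path q = comp-path-relabel (λ _ → refl) w q

  empty-tower : ∀ {r k} (χ : Path (suc a) C → Fin r) i → k ≡ 0 → Monochromatic χ i (tower k)
  empty-tower χ i refl = constant _ , λ ()

  -- The sum of the counts makes the induction work: the node of the first star has a colour,
  -- whose count may be lowered in the trees above, and if the tower found there has the same
  -- colour, that node can serve as its root.
  TowerProperty : ℕ → ℕ → ℕ → Tree → Set
  TowerProperty a r n D = ∀ (χ : Path (suc a) (D ∷ []) → Fin (suc r)) (cnt : Vec ℕ (suc r)) → Vec.sum cnt ≤ n →
                          Σ (Fin (suc r)) λ i → Monochromatic χ i (tower (Vec.lookup cnt i))

  module AddLevel {a r n : ℕ} {D : Tree} (IH : TowerProperty a r n D) {N : ℕ} where

    open Spread a

    FD : Finite (Path (suc a) (D ∷ []))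
    FD = Finite-Path (suc a) (D ∷ [])

    module _ (χ : Path (suc a) (crown N D ∷ []) → Fin (suc r)) (T : Template A N) (h : HasStar T)
             (mono : ∀ x y → code FD (λ q → χ (along (letters (fill T x)) q))
                           ≡ code FD (λ q → χ (along (letters (fill T y)) q))) where

      ψ : Path (suc a) (D ∷ []) → Fin (suc r)
      ψ q = χ (along (letters (fill T zero)) q)

      through-mono : ∀ {i} k → Monochromatic ψ i (tower k) → Monochromatic χ i (tower k)
      through-mono k (w , all-i) = through k branch w , λ p → trans (cong χ (colour p)) (all-i p)
        where
        branch : Letters (suc a) N
        branch = letters (fill T zero)
        colour : ∀ p → through k branch w •ₚ p ≡ along branch (w •ₚ p)
        colour p = trans (through-path id k branch w p) (cong (λ u → along u (w •ₚ p)) (VecP.map-id branch))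

      spread-mono : ∀ {i} k → i ≡ χ (starPath T h) → Monochromatic ψ i (tower k) → Monochromatic χ i (tower (suc k))
      spread-mono k star (w , all-i) = spread k T h w , colour
        where
        colour : ∀ p → χ (spread k T h w •ₚ p) ≡ _
        colour p with spread-path k T h w p
        ... | inj₁ e           = trans (cong χ e) (sym star)
        ... | inj₂ (x , q , e) = trans (cong χ e)
          (trans (code-injective FD (λ q → χ (along (letters (fill T x)) q)) ψ (mono x zero) (w •ₚ q)) (all-i q))

      add-level : ∀ cnt → Vec.sum cnt ≤ suc n → Σ (Fin (suc r)) λ i → Monochromatic χ i (tower (Vec.lookup cnt i))
      add-level cnt le with Vec.lookup cnt (χ (starPath T h)) in count
      ... | zero  = χ (starPath T h) , empty-tower χ _ count
      ... | suc k with IH ψ (cnt Vec.[ χ (starPath T h) ]≔ k) (≤-pred (subst (_≤ suc n) (sum-update cnt _ count) le))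
      ...   | i , M with i Fin.≟ χ (starPath T h)
      ...     | yes refl = i , subst (λ k → Monochromatic χ i (tower k))
                                 (trans (cong suc (VecP.lookup∘update i cnt k)) (sym count)) (spread-mono _ refl M)
      ...     | no  i≢i₀ = i , subst (λ k → Monochromatic χ i (tower k)) (VecP.lookup∘update′ i≢i₀ cnt k) (through-mono _ M)

  abstract
    tower-in-tree : ∀ a r n → Σ Tree (TowerProperty a r n)
    tower-in-tree a r zero = node [] , λ χ cnt le →
      χ stop , empty-tower χ _ (n≤0⇒n≡0 (≤-trans (lookup≤sum cnt _) le))
    tower-in-tree a r (suc n) with tower-in-tree a r n
    -- `HalesJewett k` concerns `suc k` letters, and `suc (a + m′ * suc a)` is the number `A` of
    -- pairs of direction and label. The colour of a branch records the colours of all paths in the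
    -- copy of `D` on top of it.
    ... | D , IH with HalesJewett (a + m′ * suc a) (suc r ^ size (Finite-Path (suc a) (D ∷ [])))
    ... | N , HJ = crown N D , λ χ cnt le →
      let T , h , mono = HJ (λ u → code (Finite-Path (suc a) (D ∷ [])) (λ q → χ (along (Spread.letters a u) q)))
      in AddLevel.add-level IH χ T h mono cnt le

  ForestProperty : ℕ → ℕ → Tree → ℕ → ℕ → Set
  ForestProperty a r c h N = ∀ (χ : Path (suc a) (copies N (c ∷ [])) → Fin (suc r)) (cnt : Vec ℕ (suc r)) → Vec.sum cnt ≤ N →
    Σ (Fin (suc r)) λ i → Monochromatic χ i (copies (Vec.lookup cnt i) (tower h))

  -- The pigeonhole principle with a required number for every colour: each tree supplies a tower of
  -- some colour, and the number for this colour drops by one.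
  towers-in-forest : ∀ a r c h →
    (∀ (χ : Path (suc a) (c ∷ []) → Fin (suc r)) → Σ (Fin (suc r)) λ i → Monochromatic χ i (tower h)) →
    ∀ N → ForestProperty a r c h N
  towers-in-forest a r c h H N χ cnt le = go N χ cnt le
    where
    none : ∀ {C k} (χ : Path (suc a) C → Fin (suc r)) i → k ≡ 0 → Monochromatic χ i (copies k (tower h))
    none χ i refl = constant _ , λ ()
    more : ∀ {N i k} (χ : Path (suc a) (copies (suc N) (c ∷ [])) → Fin (suc r)) →
           Monochromatic (χ ∘ widen (copies N (c ∷ []))) i (tower h) →
           Monochromatic (χ ∘ next) i (copies k (tower h)) → Monochromatic χ i (copies (suc k) (tower h))
    more χ (w , all-w) (v , all-v) = w ⧺ v , colour
      where
      colour : ∀ p → χ ((w ⧺ v) •ₚ p) ≡ _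
      colour p with ⧺-path id w v p
      ... | inj₁ (q , e) = trans (cong χ e) (all-w q)
      ... | inj₂ (q , e) = trans (cong χ e) (all-v q)
    fewer : ∀ {N i F} (χ : Path (suc a) (copies (suc N) (c ∷ [])) → Fin (suc r)) →
            Monochromatic (χ ∘ next) i F → Monochromatic χ i F
    fewer χ (v , all-v) = constant (c ∷ []) ⧺ v ,
      λ p → trans (cong χ (constant-⧺-path id (c ∷ []) v p)) (all-v p)
    go : ∀ N → ForestProperty a r c h N
    go zero    χ cnt le = zero , none χ zero (n≤0⇒n≡0 (≤-trans (lookup≤sum cnt zero) le))
    go (suc N) χ cnt le with H (χ ∘ widen (copies N (c ∷ [])))
    ... | i₀ , W with Vec.lookup cnt i₀ in count
    ...   | zero  = i₀ , none χ i₀ count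
    ...   | suc k with go N (χ ∘ next) (cnt Vec.[ i₀ ]≔ k) (≤-pred (subst (_≤ suc N) (sum-update cnt i₀ count) le))
    ...     | i , V with i Fin.≟ i₀
    ...       | yes refl = i , subst (λ k → Monochromatic χ i (copies k (tower h)))
                                 (trans (cong suc (VecP.lookup∘update i cnt k)) (sym count)) (more {N} {k = Vec.lookup (cnt Vec.[ i ]≔ k) i} χ W V)
    ...       | no  i≢i₀ = i , fewer {N} χ (subst (λ k → Monochromatic (χ ∘ next) i (copies k (tower h)))
                                 (VecP.lookup∘update′ i≢i₀ cnt k) V)

  -- Each tree of `K` uses up one of the `J` copies; above its root `m` copies with one level less
  -- are available.
  fit : ∀ K h J → nodes K ≤ h → nodes K ≤ J → nodes K ≤ m → Word (suc a) (copies J (tower h)) K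
  fit []             h       J       _          _          _   = constant _
  fit (node K₁ ∷ K₂) (suc h) (suc J) (s≤s K≤h) (s≤s K≤J) K≤m =
    bind (fit K₁ h m (≤-trans (m≤m+n _ _) K≤h) K₁≤m K₁≤m)
         (fit K₂ (suc h) J (≤-trans (m≤n+m _ (nodes K₁)) (≤-trans K≤h (n≤1+n h))) (≤-trans (m≤n+m _ (nodes K₁)) K≤J)
              (≤-trans (≤-trans (m≤n+m _ (nodes K₁)) (n≤1+n _)) K≤m))
    where
    K₁≤m = ≤-trans (≤-trans (m≤m+n _ _) (n≤1+n _)) K≤m

path-ramsey : ∀ a K r → Σ Forest λ C → ∀ (χ : Path (suc a) C → Fin (suc r)) → ∃ λ i → Monochromatic χ i K
path-ramsey a K r with Towers.tower-in-tree (nodes K) a r (suc r * suc (nodes K))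
... | c , trees = copies (suc r * n) (c ∷ []) , go
  where
  open Towers (nodes K)
  n : ℕ
  n = suc (nodes K)
  cnt : Vec ℕ (suc r)
  cnt = Vec.replicate (suc r) n
  cnt-n : ∀ i → Vec.lookup cnt i ≡ n
  cnt-n i = VecP.lookup-replicate i n
  budget : Vec.sum cnt ≤ suc r * n
  budget = ≤-reflexive (sum-replicate (suc r) n)
  tree : ∀ (χ : Path (suc a) (c ∷ []) → Fin (suc r)) → Σ (Fin (suc r)) λ i → Monochromatic χ i (tower n)
  tree χ with trees χ cnt budget
  ... | i , M = i , subst (λ k → Monochromatic χ i (tower k)) (cnt-n i) M
  go : ∀ (χ : Path (suc a) (copies (suc r * n) (c ∷ [])) → Fin (suc r)) → ∃ λ i → Monochromatic χ i K
  go χ with towers-in-forest a r c n tree (suc r * n) χ cnt budget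
  ... | i , M with subst (λ k → Monochromatic χ i (copies k (tower n))) (cnt-n i) M
  ...   | w , all-i = i , w • v , λ p → trans (cong χ (comp-path-assoc (λ _ → refl) w v p)) (all-i (v •ₚ p))
    where
    v : Word (suc a) (copies n (tower n)) K
    v = fit K n n (n≤1+n _) (n≤1+n _) (n≤1+n _)

-- The extra colour `zero` is for the elements outside the image of `g`.
factor : ∀ {A B : Set} {r} → Finite A → Finite B → (g : A → B) (f : A → Fin r) →
         (∀ x y → g x ≡ g y → f x ≡ f y) → Σ (B → Fin (suc r)) λ ψ → ∀ x → ψ (g x) ≡ suc (f x)
factor {A} {B} {r} FA FB g f resp = (λ y → value (preimage? y)) , (λ x → correct x (preimage? (g x)))
  where
  Preimage : B → Set
  Preimage y = ∃ λ k → g (enum FA k) ≡ y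
  preimage? : ∀ y → Dec (Preimage y)
  preimage? y = any? (λ k → _≟ᶠ_ FB (g (enum FA k)) y)
  value : ∀ {y} → Dec (Preimage y) → Fin (suc r)
  value (yes (k , _)) = suc (f (enum FA k))
  value (no _)        = zero
  correct : ∀ x (d : Dec (Preimage (g x))) → value d ≡ suc (f x)
  correct x (yes (k , e)) = cong suc (resp (enum FA k) x e)
  correct x (no none)     = ⊥-elim (none (index FA x , cong g (enum-index FA x)))

abstract
  ramsey : ∀ S → Ramsey S
  ramsey [] = ramsey-[]
  -- With parameter `r`, `path-ramsey` is about `suc r` colours: those of the words and the extra
  -- one of `factor`.
  ramsey (node S₁ ∷ S) a K r with path-ramsey a K r
  ... | D , paths with samePath-ramsey S₁ (ramsey S₁) ramsey-[] D a S (ramsey S) r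
  ... | C , colour = C , go
    where
    go : (χ : Word (suc a) C (node S₁ ∷ S) → Fin r) → Σ (Word (suc a) C K) λ w → ∀ v v′ → ⊤ → χ (w • v) ≡ χ (w • v′)
    go χ with colour χ
    ... | w , same with factor (Finite-Word (suc a) D (node S₁ ∷ S)) (Finite-Path (suc a) D) firstPath (λ v → χ (w • v)) same
    ... | ψ , ψ-firstPath with paths ψ
    ... | i , u , mono = w • u , λ v v′ _ → suc-injective (trans (reduce v) (sym (reduce v′)))
      where
      reduce : ∀ v → suc (χ ((w • u) • v)) ≡ i
      reduce v = begin
        suc (χ ((w • u) • v))     ≡⟨ cong (suc ∘ χ) (•-assoc w u v) ⟩
        suc (χ (w • (u • v)))     ≡⟨ sym (ψ-firstPath (u • v)) ⟩
        ψ (firstPath (u • v))     ≡⟨ cong ψ (firstPath-comp id u v) ⟩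
        ψ (u •ₚ firstPath v)      ≡⟨ mono (firstPath v) ⟩
        i                         ∎
        where open ≡-Reasoning

-- Words as rigid surjections

⊑-refl : ∀ {t} (x : Pos t) → x ⊑ x
⊑-refl root        = root⊑
⊑-refl (child i x) = child⊑ (⊑-refl x)

⊑-reflexive : ∀ {t} {x y : Pos t} → x ≡ y → x ⊑ y
⊑-reflexive {x = x} refl = ⊑-refl x

⊑-trans : ∀ {t} {x y z : Pos t} → x ⊑ y → y ⊑ z → x ⊑ z
⊑-trans root⊑      _          = root⊑
⊑-trans (child⊑ p) (child⊑ q) = child⊑ (⊑-trans p q)

⊑-antisym : ∀ {t} {x y : Pos t} → x ⊑ y → y ⊑ x → x ≡ y
⊑-antisym root⊑      root⊑      = refl
⊑-antisym (child⊑ p) (child⊑ q) = cong (child _) (⊑-antisym p q)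

⊑⇒≤T : ∀ {t} {x y : Pos t} → x ⊑ y → x ≤T y
⊑⇒≤T {y = root}      root⊑      = inj₂ refl
⊑⇒≤T {y = child i y} root⊑      = inj₁ root<
⊑⇒≤T                 (child⊑ p) = Sum.map deeper< (cong (child _)) (⊑⇒≤T p)

<T-irrefl : ∀ {t} {x : Pos t} → ¬ x <T x
<T-irrefl (branch< i<i) = <-irrefl refl i<i
<T-irrefl (deeper< p)   = <T-irrefl p

<T-trans : ∀ {t} {x y z : Pos t} → x <T y → y <T z → x <T z
<T-trans root<       (branch< _) = root<
<T-trans root<       (deeper< _) = root<
<T-trans (branch< p) (branch< q) = branch< (<-trans p q)
<T-trans (branch< p) (deeper< _) = branch< p
<T-trans (deeper< _) (branch< q) = branch< q
<T-trans (deeper< p) (deeper< q) = deeper< (<T-trans p q)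

<T-≤T-trans : ∀ {t} {x y z : Pos t} → x <T y → y ≤T z → x <T z
<T-≤T-trans p (inj₁ q)    = <T-trans p q
<T-≤T-trans p (inj₂ refl) = p

≤T-<T-trans : ∀ {t} {x y z : Pos t} → x ≤T y → y <T z → x <T z
≤T-<T-trans (inj₁ p)    q = <T-trans p q
≤T-<T-trans (inj₂ refl) q = q

<T-total : ∀ {t} (x y : Pos t) → x ≤T y ⊎ y <T x
<T-total root        root        = inj₁ (inj₂ refl)
<T-total root        (child j y) = inj₁ (inj₁ root<)
<T-total (child i x) root        = inj₂ root<
<T-total (child i x) (child j y) with <-cmp i j
... | tri< i<j _ _  = inj₁ (inj₁ (branch< i<j))
... | tri> _ _ j<i  = inj₂ (branch< j<i)
... | tri≈ _ refl _ = Sum.map (Sum.map deeper< (cong (child i))) deeper< (<T-total x y)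

∧-same : ∀ {ts} i (p q : Pos (lookup ts i)) → child {ts} i p ∧ child i q ≡ child i (p ∧ q)
∧-same i p q with i Fin.≟ i
... | yes refl = refl
... | no  i≢i  = ⊥-elim (i≢i refl)

∧-branch : ∀ {ts i j} {p : Pos (lookup ts i)} {q : Pos (lookup ts j)} → ¬ i ≡ j →
           child {ts} i p ∧ child j q ≡ root
∧-branch {i = i} {j} i≢j with i Fin.≟ j
... | yes i≡j = ⊥-elim (i≢j i≡j)
... | no  _   = refl

∧-rootʳ : ∀ {ts} (x : Pos (node ts)) → x ∧ root ≡ root
∧-rootʳ root        = refl
∧-rootʳ (child i x) = refl

∧-comm : ∀ {t} (x y : Pos t) → x ∧ y ≡ y ∧ x
∧-comm root        y           = sym (∧-rootʳ y)
∧-comm (child i x) root        = refl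
∧-comm (child i x) (child j y) with i Fin.≟ j
... | yes refl = trans (cong (child i) (∧-comm x y)) (sym (∧-same i y x))
... | no  i≢j  = sym (∧-branch (i≢j ∘ sym))

⊑⇒∧ : ∀ {t} {x y : Pos t} → x ⊑ y → x ∧ y ≡ x
⊑⇒∧ root⊑              = refl
⊑⇒∧ (child⊑ {i = i} p) = trans (∧-same i _ _) (cong (child i) (⊑⇒∧ p))

∧-⊑ : ∀ {t} (x y : Pos t) → (x ∧ y) ⊑ x
∧-⊑ root        y           = root⊑
∧-⊑ (child i x) root        = root⊑
∧-⊑ (child i x) (child j y) with i Fin.≟ j
... | yes refl = child⊑ (∧-⊑ x y)
... | no  _    = root⊑

∧⇒⊑ : ∀ {t} {x y : Pos t} → x ∧ y ≡ x → x ⊑ y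
∧⇒⊑ {x = x} {y} e = subst (_⊑ y) (trans (∧-comm y x) e) (∧-⊑ y x)

child-injective : ∀ {ts} {i : Fin (length ts)} {p q : Pos (lookup ts i)} → child {ts} i p ≡ child i q → p ≡ q
child-injective refl = refl

_≟ₚ_ : ∀ {t} (x y : Pos t) → Dec (x ≡ y)
root      ≟ₚ root      = yes refl
root      ≟ₚ child j y = no λ ()
child i x ≟ₚ root      = no λ ()
child i x ≟ₚ child j y with i Fin.≟ j
... | no i≢j   = no λ { refl → i≢j refl }
... | yes refl = map′ (cong (child i)) child-injective (x ≟ₚ y)

module Emb {S T : Tree} {e : Pos S → Pos T} (E : IsEmbedding e) where
  open IsEmbedding E public

  ⊑-mono : ∀ {x y} → x ⊑ y → e x ⊑ e y
  ⊑-mono {x} {y} p = ∧⇒⊑ (trans (sym (meet x y)) (cong e (⊑⇒∧ p)))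

embedding-∘ : ∀ {R S T} {f : Pos S → Pos T} {g : Pos R → Pos S} → IsEmbedding f → IsEmbedding g → IsEmbedding (f ∘ g)
embedding-∘ {f = f} {g} F G = record
  { root↦root = trans (cong f G.root↦root) F.root↦root
  ; mono = λ x y p → F.mono _ _ (G.mono x y p)
  ; meet = λ x y → trans (cong f (G.meet x y)) (F.meet _ _) }
  where module F = IsEmbedding F
        module G = IsEmbedding G

_∘ᶜ_ : ∀ {A B C} → Hom B C → Hom A B → Hom A C
_∘ᶜ_ {A} {B} {C} f g = record
  { s = g.s ∘ f.s
  ; i = f.i ∘ g.i
  ; s-rigid = eᶠ ∘ eᵍ , embedding-∘ Eᶠ Eᵍ ,
              (λ x → trans (cong g.s (proj₁ rᶠ (eᵍ x))) (proj₁ rᵍ x)) ,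
              (λ y → ⊑-trans (Emb.⊑-mono Eᶠ (proj₂ rᵍ (f.s y))) (proj₂ rᶠ y))
  ; i-emb = embedding-∘ f.i-emb g.i-emb
  ; retr = λ x → trans (cong g.s (f.retr (g.i x))) (g.retr x)
  ; below = λ x y p → below′ x y (f.below (g.i x) y p)
  }
  where
  module f = Conn f
  module g = Conn g
  eᶠ = proj₁ f.s-rigid
  Eᶠ = proj₁ (proj₂ f.s-rigid)
  rᶠ = proj₂ (proj₂ f.s-rigid)
  eᵍ = proj₁ g.s-rigid
  Eᵍ = proj₁ (proj₂ g.s-rigid)
  rᵍ = proj₂ (proj₂ g.s-rigid)
  below′ : ∀ x y → f.s y ≤T g.i x → g.s (f.s y) ≤T x
  below′ x y (inj₁ p) = g.below x (f.s y) p
  below′ x y (inj₂ e) = inj₂ (trans (cong g.s e) (g.retr x))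

shiftₚ : Pos (node C) → Pos (node (t ∷ C))
shiftₚ root        = root
shiftₚ (child i p) = child (suc i) p

shiftₚ-∧ : ∀ (x y : Pos (node C)) → shiftₚ {t = t} (x ∧ y) ≡ shiftₚ x ∧ shiftₚ y
shiftₚ-∧ root        y           = refl
shiftₚ-∧ (child i x) root        = refl
shiftₚ-∧ (child i x) (child j y) with i Fin.≟ j
... | yes refl = refl
... | no  _    = refl

shiftₚ-< : ∀ {x y : Pos (node C)} → x <T y → shiftₚ {t = t} x <T shiftₚ y
shiftₚ-< root<       = root<
shiftₚ-< (branch< p) = branch< (s≤s p)
shiftₚ-< (deeper< p) = deeper< p

shiftₚ-⊑ : ∀ {x y : Pos (node C)} → x ⊑ y → shiftₚ {t = t} x ⊑ shiftₚ y
shiftₚ-⊑ root⊑      = root⊑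
shiftₚ-⊑ (child⊑ p) = child⊑ p

rooted : ∀ {X : Set} → X → (Pos t → X) → Pos (node (t ∷ [])) → X
rooted x κ root           = x
rooted x κ (child zero q) = κ q

-- The root is not a node of the forest; its value κ root is a convention.
val : ∀ {X : Set} → (Fin a → X) → (Pos (node S) → X) → Word a C S → Pos (node C) → X
val ρ κ w             root              = κ root
val ρ κ (skip l w w′) (child zero p)    = val ρ (λ _ → ρ l) w p
val ρ κ (skip l w w′) (child (suc i) p) = val ρ κ w′ (child i p)
val ρ κ (pass l w w′) (child zero p)    = val ρ (rooted (ρ l) (κ ∘ child zero)) w p
val ρ κ (pass l w w′) (child (suc i) p) = val ρ (κ ∘ shiftₚ) w′ (child i p)
val ρ κ (bind w w′)   (child zero p)    = val (κ (child zero root) ◂ ρ) (κ ∘ child zero) w p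
val ρ κ (bind w w′)   (child (suc i) p) = val ρ (κ ∘ shiftₚ) w′ (child i p)

pos : Word a C S → Pos (node S) → Pos (node C)
pos w             root              = root
pos (skip l w w′) (child j q)       = shiftₚ (pos w′ (child j q))
pos (pass l w w′) (child zero q)    = child zero (pos w (child zero q))
pos (pass l w w′) (child (suc j) q) = shiftₚ (pos w′ (child j q))
pos (bind w w′)   (child zero q)    = child zero (pos w q)
pos (bind w w′)   (child (suc j) q) = shiftₚ (pos w′ (child j q))

val-cong : ∀ {X : Set} {ρ ρ′ : Fin a → X} {κ κ′ : Pos (node S) → X} →
           (∀ l → ρ l ≡ ρ′ l) → (∀ x → κ x ≡ κ′ x) → (w : Word a C S) → ∀ y → val ρ κ w y ≡ val ρ′ κ′ w y
val-cong r k w             root              = k root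
val-cong r k (skip l w w′) (child zero p)    = val-cong r (λ _ → r l) w p
val-cong r k (skip l w w′) (child (suc i) p) = val-cong r k w′ (child i p)
val-cong r k (pass l w w′) (child zero p)    = val-cong r (λ { root → r l ; (child zero q) → k (child zero q) }) w p
val-cong r k (pass l w w′) (child (suc i) p) = val-cong r (k ∘ shiftₚ) w′ (child i p)
val-cong r k (bind w w′)   (child zero p)    =
  val-cong (λ { zero → k (child zero root) ; (suc l) → r l }) (k ∘ child zero) w p
val-cong r k (bind w w′)   (child (suc i) p) = val-cong r (k ∘ shiftₚ) w′ (child i p)

val-natural : ∀ {X Y : Set} (φ : X → Y) {ρ : Fin a → X} {κ : Pos (node S) → X} (w : Word a C S) y →
              φ (val ρ κ w y) ≡ val (φ ∘ ρ) (φ ∘ κ) w y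
val-natural φ w             root              = refl
val-natural φ (skip l w w′) (child zero p)    = val-natural φ w p
val-natural φ (skip l w w′) (child (suc i) p) = val-natural φ w′ (child i p)
val-natural φ (pass l w w′) (child zero p)    =
  trans (val-natural φ w p) (val-cong (λ _ → refl) (λ { root → refl ; (child zero q) → refl }) w p)
val-natural φ (pass l w w′) (child (suc i) p) = val-natural φ w′ (child i p)
val-natural φ (bind w w′)   (child zero p)    =
  trans (val-natural φ w p) (val-cong (λ { zero → refl ; (suc l) → refl }) (λ _ → refl) w p)
val-natural φ (bind w w′)   (child (suc i) p) = val-natural φ w′ (child i p)

val-comp : ∀ {X : Set} (σ : Fin b → Fin a) (w : Word b C K) (v : Word a K S) (ρ : Fin a → X) κ y →
           val ρ κ (comp σ w v) y ≡ val (ρ ∘ σ) (val ρ κ v) w y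
val-comp σ w v ρ κ root = refl
val-comp σ (skip l w w′) v ρ κ (child zero p) =
  trans (val-comp σ w [] ρ _ p) (val-cong (λ _ → refl) (λ { root → refl ; (child () _) }) w p)
val-comp σ (skip l w w′) v ρ κ (child (suc i) p) = val-comp σ w′ v ρ κ (child i p)
val-comp σ (pass l w w′) (skip m v v′) ρ κ (child zero p) =
  trans (val-comp σ w (skip m v []) ρ _ p)
        (val-cong (λ _ → refl) (λ { root → refl ; (child zero q) → refl }) w p)
val-comp σ (pass l w w′) (skip m v v′) ρ κ (child (suc i) p) =
  trans (val-comp σ w′ v′ ρ κ (child i p))
        (val-cong (λ _ → refl) (λ { root → refl ; (child j q) → refl }) w′ (child i p))
val-comp σ (pass l w w′) (pass m v v′) ρ κ (child zero p) =
  trans (val-comp σ w (pass m v []) ρ _ p)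
        (val-cong (λ _ → refl) (λ { root → refl ; (child zero q) → val-cong (λ _ → refl) (λ { root → refl ; (child zero z) → refl }) v q }) w p)
val-comp σ (pass l w w′) (pass m v v′) ρ κ (child (suc i) p) =
  trans (val-comp σ w′ v′ ρ (κ ∘ shiftₚ) (child i p))
        (val-cong (λ _ → refl) (λ { root → refl ; (child j q) → refl }) w′ (child i p))
val-comp σ (pass l w w′) (bind v v′) ρ κ (child zero p) =
  trans (val-comp σ w (bind v []) ρ _ p)
        (val-cong (λ _ → refl) (λ { root → refl ; (child zero q) → refl }) w p)
val-comp σ (pass l w w′) (bind v v′) ρ κ (child (suc i) p) =
  trans (val-comp σ w′ v′ ρ (κ ∘ shiftₚ) (child i p))
        (val-cong (λ _ → refl) (λ { root → refl ; (child j q) → refl }) w′ (child i p))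
val-comp σ (bind w w′) (skip m v v′) ρ κ (child zero p) =
  trans (val-comp (m ◂ σ) w v ρ _ p) (val-cong (λ { zero → refl ; (suc l) → refl }) (λ _ → refl) w p)
val-comp σ (bind w w′) (skip m v v′) ρ κ (child (suc i) p) =
  trans (val-comp σ w′ v′ ρ κ (child i p))
        (val-cong (λ _ → refl) (λ { root → refl ; (child j q) → refl }) w′ (child i p))
val-comp σ (bind w w′) (pass m v v′) ρ κ (child zero p) =
  trans (val-comp (m ◂ σ) w v ρ _ p) (val-cong (λ { zero → refl ; (suc l) → refl }) (λ _ → refl) w p)
val-comp σ (bind w w′) (pass m v v′) ρ κ (child (suc i) p) =
  trans (val-comp σ w′ v′ ρ (κ ∘ shiftₚ) (child i p))
        (val-cong (λ _ → refl) (λ { root → refl ; (child j q) → refl }) w′ (child i p))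
val-comp σ (bind w w′) (bind v v′) ρ κ (child zero p) =
  trans (val-comp (lift σ) w v _ _ p) (val-cong (λ { zero → refl ; (suc l) → refl }) (λ _ → refl) w p)
val-comp σ (bind w w′) (bind v v′) ρ κ (child (suc i) p) =
  trans (val-comp σ w′ v′ ρ (κ ∘ shiftₚ) (child i p))
        (val-cong (λ _ → refl) (λ { root → refl ; (child j q) → refl }) w′ (child i p))

pos-skip : ∀ {l} {w : Word a C₁ []} (w′ : Word a C₂ S) x → pos (skip l w w′) x ≡ shiftₚ (pos w′ x)
pos-skip w′ root        = refl
pos-skip w′ (child j q) = refl

pos-pass : ∀ {l} {w : Word a C₁ (t ∷ [])} (w′ : Word a C₂ S) x → pos (pass l w w′) (shiftₚ x) ≡ shiftₚ (pos w′ x)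
pos-pass w′ root        = refl
pos-pass w′ (child j q) = refl

pos-bind : ∀ {w : Word (suc a) C₁ S} (w′ : Word a C₂ D) x → pos (bind w w′) (shiftₚ x) ≡ shiftₚ (pos w′ x)
pos-bind w′ root        = refl
pos-bind w′ (child j q) = refl

pos-comp : ∀ (σ : Fin b → Fin a) (w : Word b C K) (v : Word a K S) x → pos (comp σ w v) x ≡ pos w (pos v x)
pos-comp σ w v root = refl
pos-comp σ [] [] (child () q)
pos-comp σ (skip l w w′) v x@(child j q) = trans (cong shiftₚ (pos-comp σ w′ v x)) (sym (pos-skip w′ (pos v x)))
pos-comp σ (pass l w w′) (skip m v v′) x@(child j q) =
  trans (cong shiftₚ (pos-comp σ w′ v′ x)) (sym (pos-pass w′ (pos v′ x)))
pos-comp σ (pass l w w′) (pass m v v′) (child zero q) = cong (child zero) (pos-comp σ w (pass m v []) (child zero q))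
pos-comp σ (pass l w w′) (pass m v v′) (child (suc j) q) =
  trans (cong shiftₚ (pos-comp σ w′ v′ (child j q))) (sym (pos-pass w′ (pos v′ (child j q))))
pos-comp σ (pass l w w′) (bind v v′) (child zero q) = cong (child zero) (pos-comp σ w (bind v []) (child zero q))
pos-comp σ (pass l w w′) (bind v v′) (child (suc j) q) =
  trans (cong shiftₚ (pos-comp σ w′ v′ (child j q))) (sym (pos-pass w′ (pos v′ (child j q))))
pos-comp σ (bind w w′) (skip m v v′) x@(child j q) =
  trans (cong shiftₚ (pos-comp σ w′ v′ x)) (sym (pos-bind w′ (pos v′ x)))
pos-comp σ (bind w w′) (pass m v v′) (child zero q) = cong (child zero) (pos-comp (m ◂ σ) w v (child zero q))
pos-comp σ (bind w w′) (pass m v v′) (child (suc j) q) =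
  trans (cong shiftₚ (pos-comp σ w′ v′ (child j q))) (sym (pos-bind w′ (pos v′ (child j q))))
pos-comp σ (bind w w′) (bind v v′) (child zero q) = cong (child zero) (pos-comp (lift σ) w v q)
pos-comp σ (bind w w′) (bind v v′) (child (suc j) q) =
  trans (cong shiftₚ (pos-comp σ w′ v′ (child j q))) (sym (pos-bind w′ (pos v′ (child j q))))

module _ {X : Set} where

  val-skip : ∀ {l} {w : Word a C₁ []} (w′ : Word a C₂ S) (ρ : Fin a → X) κ y →
             val ρ κ (skip l w w′) (shiftₚ y) ≡ val ρ κ w′ y
  val-skip w′ ρ κ root        = refl
  val-skip w′ ρ κ (child i p) = refl

  val-pass : ∀ {l} {w : Word a C₁ (t ∷ [])} (w′ : Word a C₂ S) (ρ : Fin a → X) κ y →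
             val ρ κ (pass l w w′) (shiftₚ y) ≡ val ρ (κ ∘ shiftₚ) w′ y
  val-pass w′ ρ κ root        = refl
  val-pass w′ ρ κ (child i p) = refl

  val-bind : ∀ {w : Word (suc a) C₁ S} (w′ : Word a C₂ D) (ρ : Fin a → X) κ y →
             val ρ κ (bind w w′) (shiftₚ y) ≡ val ρ (κ ∘ shiftₚ) w′ y
  val-bind w′ ρ κ root        = refl
  val-bind w′ ρ κ (child i p) = refl

  val-pos : (w : Word a C S) (ρ : Fin a → X) → ∀ κ x → val ρ κ w (pos w x) ≡ κ x
  val-pos w             ρ κ root              = refl
  val-pos (skip l w w′) ρ κ x@(child j q)     = trans (val-skip w′ ρ κ (pos w′ x)) (val-pos w′ ρ κ x)
  val-pos (pass l w w′) ρ κ (child zero q)    = val-pos w ρ _ (child zero q)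
  val-pos (pass l w w′) ρ κ (child (suc j) q) =
    trans (val-pass w′ ρ κ (pos w′ (child j q))) (val-pos w′ ρ (κ ∘ shiftₚ) (child j q))
  val-pos (bind w w′)   ρ κ (child zero q)    = val-pos w _ (κ ∘ child zero) q
  val-pos (bind w w′)   ρ κ (child (suc j) q) =
    trans (val-bind w′ ρ κ (pos w′ (child j q))) (val-pos w′ ρ (κ ∘ shiftₚ) (child j q))

  -- The form that the condition `i(s(y)) ⊑ y` of a rigid surjection takes in the presence of
  -- constants, which have no position in the forest.
  val-cases : (w : Word a C S) (ρ : Fin a → X) → ∀ κ y →
              (∃ λ l → val ρ κ w y ≡ ρ l) ⊎ (∃ λ x → val ρ κ w y ≡ κ x × pos w x ⊑ y)
  val-cases w             ρ κ root              = inj₂ (root , refl , root⊑)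
  val-cases (skip l w w′) ρ κ (child zero p)    with val-cases w ρ (λ _ → ρ l) p
  ... | inj₁ c            = inj₁ c
  ... | inj₂ (_ , e , _)  = inj₁ (l , e)
  val-cases (skip l w w′) ρ κ (child (suc i) p) with val-cases w′ ρ κ (child i p)
  ... | inj₁ c            = inj₁ c
  ... | inj₂ (x , e , le) = inj₂ (x , e , ⊑-trans (⊑-reflexive (pos-skip w′ x)) (shiftₚ-⊑ le))
  val-cases (pass l w w′) ρ κ (child zero p)    with val-cases w ρ (rooted (ρ l) (κ ∘ child zero)) p
  ... | inj₁ c                        = inj₁ c
  ... | inj₂ (root , e , _)           = inj₁ (l , e)
  ... | inj₂ (child zero q , e , le)  = inj₂ (child zero q , e , child⊑ le)
  val-cases (pass l w w′) ρ κ (child (suc i) p) with val-cases w′ ρ (κ ∘ shiftₚ) (child i p)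
  ... | inj₁ c            = inj₁ c
  ... | inj₂ (x , e , le) = inj₂ (shiftₚ x , e , ⊑-trans (⊑-reflexive (pos-pass w′ x)) (shiftₚ-⊑ le))
  val-cases (bind w w′)   ρ κ (child zero p)    with val-cases w (κ (child zero root) ◂ ρ) (κ ∘ child zero) p
  ... | inj₁ (zero , e)   = inj₂ (child zero root , e , child⊑ root⊑)
  ... | inj₁ (suc l , e)  = inj₁ (l , e)
  ... | inj₂ (x , e , le) = inj₂ (child zero x , e , child⊑ le)
  val-cases (bind w w′)   ρ κ (child (suc i) p) with val-cases w′ ρ (κ ∘ shiftₚ) (child i p)
  ... | inj₁ c            = inj₁ c
  ... | inj₂ (x , e , le) = inj₂ (shiftₚ x , e , ⊑-trans (⊑-reflexive (pos-bind w′ x)) (shiftₚ-⊑ le))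

data NonRoot : Pos t → Set where
  child : ∀ {ts} i p → NonRoot (child {ts} i p)

NonRoot-shift : ∀ {x : Pos (node C)} → NonRoot x → NonRoot (shiftₚ {t = t} x)
NonRoot-shift (child i p) = child (suc i) p

pos-NonRoot : ∀ (w : Word a C S) j q → NonRoot (pos w (child j q))
pos-NonRoot (skip l w w′) j       q = NonRoot-shift (pos-NonRoot w′ j q)
pos-NonRoot (pass l w w′) zero    q = child _ _
pos-NonRoot (pass l w w′) (suc j) q = NonRoot-shift (pos-NonRoot w′ j q)
pos-NonRoot (bind w w′)   zero    q = child _ _
pos-NonRoot (bind w w′)   (suc j) q = NonRoot-shift (pos-NonRoot w′ j q)

NonRoot-> : ∀ {x : Pos (node C)} → NonRoot x → root <T x
NonRoot-> (child i p) = root<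

zero-<-shift : ∀ {x : Pos t} {y : Pos (node C)} → NonRoot y → child {t ∷ C} zero x <T shiftₚ y
zero-<-shift (child i p) = branch< (s≤s z≤n)

zero-∧-shift : ∀ (x : Pos t) (y : Pos (node C)) → child {t ∷ C} zero x ∧ shiftₚ y ≡ root
zero-∧-shift x root        = refl
zero-∧-shift x (child i y) = refl

pos-mono : ∀ (w : Word a C S) x y → x <T y → pos w x <T pos w y
pos-mono w .root (child j q) root< = NonRoot-> (pos-NonRoot w j q)
pos-mono (skip l w w′) x@(child _ _) y@(child _ _) x<y = shiftₚ-< (pos-mono w′ x y x<y)
pos-mono (pass l w w′) (child zero p) (child zero q) (branch< ())
pos-mono (pass l w w′) (child zero p) (child zero q) (deeper< p<q) = deeper< (pos-mono w _ _ (deeper< p<q))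
pos-mono (pass l w w′) (child zero p) (child (suc j) q) _ = zero-<-shift (pos-NonRoot w′ j q)
pos-mono (pass l w w′) (child (suc i) p) (child (suc j) q) (branch< (s≤s i<j)) = shiftₚ-< (pos-mono w′ _ _ (branch< i<j))
pos-mono (pass l w w′) (child (suc i) p) (child (suc j) q) (deeper< p<q) = shiftₚ-< (pos-mono w′ _ _ (deeper< p<q))
pos-mono (bind w w′) (child zero p) (child zero q) (branch< ())
pos-mono (bind w w′) (child zero p) (child zero q) (deeper< p<q) = deeper< (pos-mono w _ _ p<q)
pos-mono (bind w w′) (child zero p) (child (suc j) q) _ = zero-<-shift (pos-NonRoot w′ j q)
pos-mono (bind w w′) (child (suc i) p) (child (suc j) q) (branch< (s≤s i<j)) = shiftₚ-< (pos-mono w′ _ _ (branch< i<j))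
pos-mono (bind w w′) (child (suc i) p) (child (suc j) q) (deeper< p<q) = shiftₚ-< (pos-mono w′ _ _ (deeper< p<q))

pos-meet : ∀ (w : Word a C S) x y → pos w (x ∧ y) ≡ pos w x ∧ pos w y
pos-meet w root          y    = refl
pos-meet w x@(child _ _) root = sym (∧-rootʳ (pos w x))
pos-meet (skip l w w′) x@(child _ _) y@(child _ _) =
  trans (pos-skip w′ (x ∧ y)) (trans (cong shiftₚ (pos-meet w′ x y)) (shiftₚ-∧ (pos w′ x) (pos w′ y)))
pos-meet (pass l w w′) (child zero x) (child zero y) = cong (child zero) (pos-meet w (child zero x) (child zero y))
pos-meet (pass l w w′) (child zero x) (child (suc j) y) = sym (zero-∧-shift _ (pos w′ (child j y)))
pos-meet (pass l w w′) (child (suc i) x) (child zero y) =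
  sym (trans (∧-comm (shiftₚ (pos w′ (child i x))) _) (zero-∧-shift _ (pos w′ (child i x))))
pos-meet (pass l w w′) (child (suc i) x) (child (suc j) y) =
  trans (cong (pos (pass l w w′)) (sym (shiftₚ-∧ (child i x) (child j y))))
  (trans (pos-pass w′ (child i x ∧ child j y))
  (trans (cong shiftₚ (pos-meet w′ (child i x) (child j y))) (shiftₚ-∧ (pos w′ (child i x)) (pos w′ (child j y)))))
pos-meet (bind w w′) (child zero x) (child zero y) = cong (child zero) (pos-meet w x y)
pos-meet (bind w w′) (child zero x) (child (suc j) y) = sym (zero-∧-shift _ (pos w′ (child j y)))
pos-meet (bind w w′) (child (suc i) x) (child zero y) =
  sym (trans (∧-comm (shiftₚ (pos w′ (child i x))) _) (zero-∧-shift _ (pos w′ (child i x))))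
pos-meet (bind w w′) (child (suc i) x) (child (suc j) y) =
  trans (cong (pos (bind w w′)) (sym (shiftₚ-∧ (child i x) (child j y))))
  (trans (pos-bind w′ (child i x ∧ child j y))
  (trans (cong shiftₚ (pos-meet w′ (child i x) (child j y))) (shiftₚ-∧ (pos w′ (child i x)) (pos w′ (child j y)))))

pos-embedding : (w : Word a C S) → IsEmbedding {node S} {node C} (pos w)
pos-embedding w = record { root↦root = refl ; mono = pos-mono w ; meet = pos-meet w }

-- The root of `node S` can serve as the constant, since its image lies below every node.
retraction : Word 1 C S → Pos (node C) → Pos (node S)
retraction = val (λ _ → root) id

pos-retraction : ∀ (w : Word 1 C S) y → pos w (retraction w y) ⊑ y
pos-retraction w y with val-cases w (λ _ → root) id y
... | inj₁ (_ , e)      = subst (λ x → pos w x ⊑ y) (sym e) root⊑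
... | inj₂ (x , e , le) = subst (λ x → pos w x ⊑ y) (sym e) le

retraction-rigid : (w : Word 1 C S) → IsRigidSurjection {node C} {node S} (retraction w)
retraction-rigid w = pos w , pos-embedding w , val-pos w _ id , pos-retraction w

wordConn : Word 1 C S → Hom (node S) (node C)
wordConn w = record
  { s = retraction w ; i = pos w ; s-rigid = retraction-rigid w ; i-emb = pos-embedding w
  ; retr = val-pos w _ id ; below = below′ }
  where
  below′ : ∀ x y → y <T pos w x → retraction w y ≤T x
  below′ x y y<x with <T-total (retraction w y) x
  ... | inj₁ le = le
  -- If `x` preceded `retraction w y`, then `pos w x` would precede `pos w (retraction w y)`, which
  -- lies below `y`.
  ... | inj₂ gt = ⊥-elim (<T-irrefl (<T-trans (<T-≤T-trans (pos-mono w _ _ gt) (⊑⇒≤T (pos-retraction w y))) y<x))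

-- Doubled nodes

Low : Forest → Set
Low S = T (length S ≤ᵇ 1)

-- A single tree can be moved up into the first tree of a forest; two trees would have to go to
-- different trees.
raise : ∀ R → Low S → Fin (suc a) → Word (suc a) C S → Word (suc a) (node C ∷ R) S
raise {S = []}         R _  l w = skip l w (constant R)
raise {S = s ∷ []}     R _  l w = pass l w (constant R)
raise {S = s ∷ u ∷ S}  R () l w

pos-raise : ∀ R (low : Low S) l (w : Word (suc a) C S) j q → pos (raise R low l w) (child j q) ≡ child zero (pos w (child j q))
pos-raise {S = []}        R _  l w () q
pos-raise {S = s ∷ []}    R _  l w zero q = refl
pos-raise {S = s ∷ u ∷ S} R () l w j q

override : ∀ {X : Set} → X → (Pos (node S) → X) → Pos (node S) → X
override x κ root        = x
override x κ (child j q) = κ (child j q)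

val-raise : ∀ {X : Set} R (low : Low S) l (w : Word (suc a) C S) (ρ : Fin (suc a) → X) κ p →
            val ρ κ (raise R low l w) (child zero p) ≡ val ρ (override (ρ l) κ) w p
val-raise {S = []}        R _  l w ρ κ p = val-cong (λ _ → refl) (λ { root → refl ; (child () _) }) w p
val-raise {S = s ∷ []}    R _  l w ρ κ p = val-cong (λ _ → refl) (λ { root → refl ; (child zero q) → refl }) w p
val-raise {S = s ∷ u ∷ S} R () l w ρ κ p

-- S′ arises from S by replacing some nodes x with at most one immediate successor by two
-- nodes x ⊏ x⁺, with the successor of x above x⁺ and a further forest R above x. In the
-- connection extConn the node x goes to x⁺ if up holds, and to the lower node otherwise,
-- whereas the embedding of the rigid surjection always sends x to the lower node.
infix 4 _⇝_

data _⇝_ : Forest → Forest → Set where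
  []     : [] ⇝ []
  keep   : S₁ ⇝ S₁′ → S₂ ⇝ S₂′ → node S₁ ∷ S₂ ⇝ node S₁′ ∷ S₂′
  double : (up : Bool) (R : Forest) → Low S₁ → S₁ ⇝ S₁′ → S₂ ⇝ S₂′ →
           node S₁ ∷ S₂ ⇝ node (node S₁′ ∷ R) ∷ S₂′

baseWord topWord : S ⇝ S′ → Word (suc a) S′ S
baseWord []                     = []
baseWord (keep d d′)            = bind (baseWord d) (baseWord d′)
baseWord (double up R low d d′) = bind (raise R low zero (baseWord d)) (baseWord d′)

topWord []                        = []
topWord (keep d d′)               = bind (topWord d) (topWord d′)
topWord (double true  R low d d′) = pass zero (bind (topWord d) (constant R)) (topWord d′)
topWord (double false R low d d′) = bind (raise R low zero (topWord d)) (topWord d′)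

module _ {X : Set} where

  -- The upper copy of a doubled node has the right value because `baseWord` labels it by the
  -- constant `zero`, which is the lower copy just bound.
  val-top : ∀ (d : S ⇝ S′) (ρ : Fin (suc a) → X) κ x → val ρ κ (baseWord d) (pos (topWord {a = a} d) x) ≡ κ x
  val-top d ρ κ root = refl
  val-top [] ρ κ (child () q)
  val-top (keep d d′) ρ κ (child zero q) = val-top d _ (κ ∘ child zero) q
  val-top (keep d d′) ρ κ (child (suc j) q) =
    trans (val-bind (baseWord d′) ρ κ (pos (topWord d′) (child j q))) (val-top d′ ρ (κ ∘ shiftₚ) (child j q))
  val-top (double true R low d d′) ρ κ (child zero root) = val-raise R low zero (baseWord d) _ (κ ∘ child zero) root
  val-top (double true R low d d′) ρ κ (child zero (child j q)) =
    trans (val-raise R low zero (baseWord d) _ (κ ∘ child zero) (pos (topWord d) (child j q)))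
          (val-top d _ (override _ (κ ∘ child zero)) (child j q))
  val-top (double true R low d d′) ρ κ (child (suc j) q) =
    trans (val-bind (baseWord d′) ρ κ (pos (topWord d′) (child j q))) (val-top d′ ρ (κ ∘ shiftₚ) (child j q))
  val-top (double false R low d d′) ρ κ (child zero root) = refl
  val-top (double false R low d d′) ρ κ (child zero (child j q)) =
    trans (cong (val _ (κ ∘ child zero) (raise R low zero (baseWord d))) (pos-raise R low zero (topWord d) j q))
    (trans (val-raise R low zero (baseWord d) _ (κ ∘ child zero) (pos (topWord d) (child j q)))
           (val-top d _ (override _ (κ ∘ child zero)) (child j q)))
  val-top (double false R low d d′) ρ κ (child (suc j) q) =
    trans (val-bind (baseWord d′) ρ κ (pos (topWord d′) (child j q))) (val-top d′ ρ (κ ∘ shiftₚ) (child j q))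

-- The two embeddings may differ only this far: the upper image of a node still precedes the lower
-- images of all later nodes. This yields the field `below` of `extConn`.
top<base : ∀ (d : S ⇝ S′) x y → x <T y → pos (topWord {a = a} d) x <T pos (baseWord {a = a} d) y
top<base d root (child j q) root< = NonRoot-> (pos-NonRoot (baseWord d) j q)
top<base (keep d d′) (child zero p) (child zero q) (branch< ())
top<base (keep d d′) (child zero p) (child zero q) (deeper< p<q) = deeper< (top<base d p q p<q)
top<base (keep d d′) (child zero p) (child (suc j) q) _ = zero-<-shift (pos-NonRoot (baseWord d′) j q)
top<base (keep d d′) (child (suc i) p) (child (suc j) q) (branch< (s≤s i<j)) = shiftₚ-< (top<base d′ _ _ (branch< i<j))
top<base (keep d d′) (child (suc i) p) (child (suc j) q) (deeper< p<q) = shiftₚ-< (top<base d′ _ _ (deeper< p<q))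
top<base (double up R low d d′) (child zero p) (child zero q) (branch< ())
top<base {a = a} (double true R low d d′) (child zero root) (child zero (child j q)) (deeper< p<q) =
  deeper< (subst (_ <T_) (sym (pos-raise R low zero (baseWord {a = suc a} d) j q))
                 (deeper< (NonRoot-> (pos-NonRoot (baseWord d) j q))))
top<base {a = a} (double true R low d d′) (child zero p@(child _ _)) (child zero (child j q)) (deeper< p<q) =
  deeper< (subst (_ <T_) (sym (pos-raise R low zero (baseWord {a = suc a} d) j q)) (deeper< (top<base d p (child j q) p<q)))
top<base {a = a} (double false R low d d′) (child zero root) (child zero (child j q)) (deeper< p<q) =
  deeper< (NonRoot-> (pos-NonRoot (raise R low zero (baseWord d)) j q))
top<base {a = a} (double false R low d d′) (child zero (child i p)) (child zero (child j q)) (deeper< p<q) =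
  deeper< (subst₂ _<T_ (sym (pos-raise R low zero (topWord {a = suc a} d) i p))
                       (sym (pos-raise R low zero (baseWord {a = suc a} d) j q))
                       (deeper< (top<base d (child i p) (child j q) p<q)))
top<base (double true R low d d′) (child zero p) (child (suc j) q) _ = zero-<-shift (pos-NonRoot (baseWord d′) j q)
top<base (double true R low d d′) (child (suc i) p) (child (suc j) q) (branch< (s≤s i<j)) = shiftₚ-< (top<base d′ _ _ (branch< i<j))
top<base (double true R low d d′) (child (suc i) p) (child (suc j) q) (deeper< p<q) = shiftₚ-< (top<base d′ _ _ (deeper< p<q))
top<base (double false R low d d′) (child zero p) (child (suc j) q) _ = zero-<-shift (pos-NonRoot (baseWord d′) j q)
top<base (double false R low d d′) (child (suc i) p) (child (suc j) q) (branch< (s≤s i<j)) = shiftₚ-< (top<base d′ _ _ (branch< i<j))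
top<base (double false R low d d′) (child (suc i) p) (child (suc j) q) (deeper< p<q) = shiftₚ-< (top<base d′ _ _ (deeper< p<q))

extConn : S ⇝ S′ → Hom (node S) (node S′)
extConn d = record
  { s = retraction (baseWord d) ; i = pos (topWord {a = 0} d)
  ; s-rigid = retraction-rigid (baseWord d) ; i-emb = pos-embedding (topWord {a = 0} d)
  ; retr = val-top d _ id ; below = below′ }
  where
  below′ : ∀ x y → y <T pos (topWord {a = 0} d) x → retraction (baseWord d) y ≤T x
  below′ x y y<x with <T-total (retraction (baseWord d) y) x
  ... | inj₁ le = le
  ... | inj₂ gt = ⊥-elim (<T-irrefl (<T-trans (<T-≤T-trans (top<base {a = 0} d _ _ gt)
                                                (⊑⇒≤T (pos-retraction (baseWord d) y))) y<x))

Bit : Bool → Set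
Bit b = if b then Bool else ⊤

-- A set of low nodes. At other nodes `Bit` offers no choice, which makes the number of marks the
-- power of two in the theorem.
Mark : Forest → Set
Mark []            = ⊤
Mark (node S₁ ∷ S) = Bit (length S₁ ≤ᵇ 1) × Mark S₁ × Mark S

Bit↔ : ∀ b → Bit b ↔ Fin (2 ^ (if b then 1 else 0))
Bit↔ true  = ↔-sym 2↔Bool
Bit↔ false = ↔-sym 1↔⊤

Mark↔ : ∀ S → Mark S ↔ Fin (2 ^ countLowList S)
Mark↔ []            = ↔-sym 1↔⊤
Mark↔ (node S₁ ∷ S) =
  subst (λ n → Mark (node S₁ ∷ S) ↔ Fin n) (sym power-sum)
    (↔-trans (Bit↔ (length S₁ ≤ᵇ 1) ×-↔ ↔-trans (Mark↔ S₁ ×-↔ Mark↔ S) (↔-sym *↔×)) (↔-sym *↔×))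
  where
  l : ℕ
  l = if length S₁ ≤ᵇ 1 then 1 else 0
  power-sum : 2 ^ countLowList (node S₁ ∷ S) ≡ 2 ^ l * (2 ^ countLowList S₁ * 2 ^ countLowList S)
  power-sum = trans (^-distribˡ-+-* 2 (l + countLowList S₁) (countLowList S))
    (trans (cong (_* 2 ^ countLowList S) (^-distribˡ-+-* 2 l (countLowList S₁)))
           (*-assoc (2 ^ l) (2 ^ countLowList S₁) (2 ^ countLowList S)))

marked : ∀ b → Bit b → Bool
marked true  x = x
marked false _ = false

marked⇒ : ∀ b x → T (marked b x) → T b
marked⇒ true x _ = tt

doubleTree : Bool → Forest → Tree
doubleTree true  F = node (node F ∷ [])
doubleTree false F = node F

doubled : ∀ S → Mark S → Forest
doubled []            _             = []
doubled (node S₁ ∷ S) (x , m₁ , m) = doubleTree (marked (length S₁ ≤ᵇ 1) x) (doubled S₁ m₁) ∷ doubled S m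

doubledTree⇝ : ∀ b → (T b → Low S₁) → S₁ ⇝ S₁′ → S₂ ⇝ S₂′ → node S₁ ∷ S₂ ⇝ doubleTree b S₁′ ∷ S₂′
doubledTree⇝ true  low d d′ = double true [] (low tt) d d′
doubledTree⇝ false low d d′ = keep d d′

doubled⇝ : ∀ S m → S ⇝ doubled S m
doubled⇝ []            _             = []
doubled⇝ (node S₁ ∷ S) (x , m₁ , m) =
  doubledTree⇝ (marked (length S₁ ≤ᵇ 1) x) (marked⇒ (length S₁ ≤ᵇ 1) x) (doubled⇝ S₁ m₁) (doubled⇝ S m)

fullTree : Bool → Forest → Tree
fullTree true  F = node (node F ∷ node [] ∷ [])
fullTree false F = node F

-- Because of the additional leaf the lower copy of a node is branching, so that both
-- embeddings of a connection agree on it.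
full : Forest → Forest
full []            = []
full (node S₁ ∷ S) = fullTree (length S₁ ≤ᵇ 1) (full S₁) ∷ full S

fullTree⇝ : ∀ b → (T b → Low S₁) → Bit b → S₁ ⇝ S₁′ → S₂ ⇝ S₂′ → node S₁ ∷ S₂ ⇝ fullTree b S₁′ ∷ S₂′
fullTree⇝ true  low up d d′ = double up (node [] ∷ []) (low tt) d d′
fullTree⇝ false low _  d d′ = keep d d′

full⇝ : ∀ S → Mark S → S ⇝ full S
full⇝ []            _             = []
full⇝ (node S₁ ∷ S) (x , m₁ , m) = fullTree⇝ (length S₁ ≤ᵇ 1) id x (full⇝ S₁ m₁) (full⇝ S m)

-- Factorisation of connections through doubled trees

deg : Pos t → ℕ
deg {node ts} root = length ts
deg (child i p)    = deg p

-- The part of a connection seen in a forest C: s is the surjection, with values in V,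
-- i the embedding of the connection and e the one coming from the rigid surjection.
record Placement (ρ : Fin a → V) (κ : Pos t → V) (s : Pos (node C) → V) : Set where
  field
    e i       : Pos t → Pos (node C)
    e-mono    : ∀ x y → x <T y → e x <T e y
    i-mono    : ∀ x y → x <T y → i x <T i y
    e-meet    : ∀ x y → e (x ∧ y) ≡ e x ∧ e y
    i-meet    : ∀ x y → i (x ∧ y) ≡ i x ∧ i y
    e⊑i       : ∀ x → e x ⊑ i x
    i<e       : ∀ x y → x <T y → i x <T e y
    branching : ∀ x → 2 ≤ deg x → e x ≡ i x
    s-e       : ∀ x → s (e x) ≡ κ x
    s-i       : ∀ x → s (i x) ≡ κ x
    values    : ∀ y → (∃ λ l → s y ≡ ρ l) ⊎ (∃ λ x → s y ≡ κ x × e x ⊑ y)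

  e-⊑ : ∀ {x y} → x ⊑ y → e x ⊑ e y
  e-⊑ {x} {y} p = ∧⇒⊑ (trans (sym (e-meet x y)) (cong e (⊑⇒∧ p)))

  i-⊑ : ∀ {x y} → x ⊑ y → i x ⊑ i y
  i-⊑ {x} {y} p = ∧⇒⊑ (trans (sym (i-meet x y)) (cong i (⊑⇒∧ p)))

record Frame (k : Pos t → Pos u) : Set where
  field
    k-∧         : ∀ x y → k (x ∧ y) ≡ k x ∧ k y
    k-injective : ∀ {x y} → k x ≡ k y → x ≡ y
    k-<⁻        : ∀ {x y} → k x <T k y → x <T y
    k-⊑⁻        : ∀ {x y} → k x ⊑ k y → x ⊑ y

shift-frame : Frame (shiftₚ {C} {t})
shift-frame {C} {t} = record { k-∧ = shiftₚ-∧ ; k-injective = inj ; k-<⁻ = <⁻ ; k-⊑⁻ = ⊑⁻ }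
  where
  inj : ∀ {x y : Pos (node C)} → shiftₚ {t = t} x ≡ shiftₚ y → x ≡ y
  inj {root}      {root}      refl = refl
  inj {child i p} {child .i .p} refl = refl
  <⁻ : ∀ {x y : Pos (node C)} → shiftₚ {t = t} x <T shiftₚ y → x <T y
  <⁻ {root}      {child j q} _                  = root<
  <⁻ {child i p} {child j q} (branch< (s≤s lt)) = branch< lt
  <⁻ {child i p} {child .i q} (deeper< lt)      = deeper< lt
  ⊑⁻ : ∀ {x y : Pos (node C)} → shiftₚ {t = t} x ⊑ shiftₚ y → x ⊑ y
  ⊑⁻ {root}                   _          = root⊑
  ⊑⁻ {child i p} {child .i q} (child⊑ p⊑q) = child⊑ p⊑q

zero-frame : Frame (λ (p : Pos t) → child {t ∷ C} zero p)
zero-frame = record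
  { k-∧ = λ _ _ → refl ; k-injective = child-injective
  ; k-<⁻ = λ { (branch< ()) ; (deeper< lt) → lt } ; k-⊑⁻ = λ { (child⊑ p) → p } }

-- The last hypothesis serves the field `values`: a node lost in the restriction may occur as a
-- value only if its value is that of a constant.
restrict : ∀ {ρ : Fin a → V} {κ : Pos t → V} {s : Pos (node C) → V} (P : Placement ρ κ s) →
           let open Placement P in
           ∀ {k : Pos (node C₁) → Pos (node C)} → Frame k →
           {g : Pos u → Pos t} → (∀ x y → x <T y → g x <T g y) → (∀ x y → g (x ∧ y) ≡ g x ∧ g y) →
           (∀ x → 2 ≤ deg x → 2 ≤ deg (g x)) →
           (e′ i′ : Pos u → Pos (node C₁)) → (∀ x → k (e′ x) ≡ e (g x)) → (∀ x → k (i′ x) ≡ i (g x)) →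
           (∀ y x → e x ⊑ k y → (∃ λ l → κ x ≡ ρ l) ⊎ (∃ λ x′ → g x′ ≡ x)) →
           Placement ρ (κ ∘ g) (s ∘ k)
restrict {ρ = ρ} {κ} {s} P {k} F {g} g-< g-∧ g-deg e′ i′ ke ki cover = record
  { e = e′ ; i = i′
  ; e-mono = λ x y p → k-<⁻ (subst₂ _<T_ (sym (ke x)) (sym (ke y)) (e-mono _ _ (g-< x y p)))
  ; i-mono = λ x y p → k-<⁻ (subst₂ _<T_ (sym (ki x)) (sym (ki y)) (i-mono _ _ (g-< x y p)))
  ; e-meet = λ x y → k-injective (trans (ke (x ∧ y)) (trans (cong e (g-∧ x y)) (trans (e-meet _ _)
      (trans (cong₂ _∧_ (sym (ke x)) (sym (ke y))) (sym (k-∧ _ _))))))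
  ; i-meet = λ x y → k-injective (trans (ki (x ∧ y)) (trans (cong i (g-∧ x y)) (trans (i-meet _ _)
      (trans (cong₂ _∧_ (sym (ki x)) (sym (ki y))) (sym (k-∧ _ _))))))
  ; e⊑i = λ x → k-⊑⁻ (subst₂ _⊑_ (sym (ke x)) (sym (ki x)) (e⊑i (g x)))
  ; i<e = λ x y p → k-<⁻ (subst₂ _<T_ (sym (ki x)) (sym (ke y)) (i<e _ _ (g-< x y p)))
  ; branching = λ x d → k-injective (trans (ke x) (trans (branching (g x) (g-deg x d)) (sym (ki x))))
  ; s-e = λ x → trans (cong s (ke x)) (s-e (g x))
  ; s-i = λ x → trans (cong s (ki x)) (s-i (g x))
  ; values = λ y → value y (values (k y))
  }
  where
  open Placement P
  open Frame F
  value : ∀ y → (∃ λ l → s (k y) ≡ ρ l) ⊎ (∃ λ x → s (k y) ≡ κ x × e x ⊑ k y) →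
          (∃ λ l → s (k y) ≡ ρ l) ⊎ (∃ λ x → s (k y) ≡ κ (g x) × e′ x ⊑ y)
  value y (inj₁ c) = inj₁ c
  value y (inj₂ (x , eq , le)) with cover y x le
  ... | inj₁ (l , eq′)   = inj₁ (l , trans eq eq′)
  ... | inj₂ (x′ , refl) = inj₂ (x′ , eq , k-⊑⁻ (subst (_⊑ k y) (sym (ke x′)) le))

addConstant : ∀ {ρ : Fin a → V} {κ : Pos t → V} {s : Pos (node C) → V} x →
              Placement ρ κ s → Placement (x ◂ ρ) κ s
addConstant x P = record
  { e = e ; i = i ; e-mono = e-mono ; i-mono = i-mono ; e-meet = e-meet ; i-meet = i-meet
  ; e⊑i = e⊑i ; i<e = i<e ; branching = branching ; s-e = s-e ; s-i = s-i
  ; values = λ y → Sum.map₁ (λ { (l , eq) → suc l , eq }) (values y) }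
  where open Placement P

-- The invariant of `factorise`. As in `val`, the root is not a node of the forest: both embeddings
-- fix it, and its value is that of a constant.
record Planted {S} (ρ : Fin a → V) (κ : Pos (node S) → V) (s : Pos (node C) → V) : Set where
  field
    placement : Placement ρ κ s
  open Placement placement public
  field
    i-root : i root ≡ root
    constant-root : ∃ λ l → κ root ≡ ρ l

  e-root : e root ≡ root
  e-root = ⊑-antisym (subst (e root ⊑_) i-root (e⊑i root)) root⊑

  root<e : ∀ {x} → root <T x → root <T e x
  root<e p = subst (_<T e _) e-root (e-mono _ _ p)

-- A tree placed strictly above the root of `node C` is a forest of one tree in `C`, as in the
-- constructor `pass`; the label of the root becomes the value of the added root.
plant : ∀ {ρ : Fin a → V} {κ : Pos t → V} {s : Pos (node C) → V} (P : Placement ρ κ s) →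
        (∀ x → root <T Placement.e P x) → ∀ l → s root ≡ ρ l →
        Planted {S = t ∷ []} ρ (rooted (ρ l) κ) s
plant {ρ = ρ} {κ} {s} P e>root l s-root = record
  { placement = record
    { e = e′ ; i = i′
    ; e-mono = λ { root (child zero y) root< → e>root y ; (child zero x) (child zero y) (branch< ())
                 ; (child zero x) (child zero y) (deeper< p) → e-mono x y p }
    ; i-mono = λ { root (child zero y) root< → i>root y ; (child zero x) (child zero y) (branch< ())
                 ; (child zero x) (child zero y) (deeper< p) → i-mono x y p }
    ; e-meet = λ { root y → refl ; (child zero x) root → sym (∧-rootʳ (e x)) ; (child zero x) (child zero y) → e-meet x y }
    ; i-meet = λ { root y → refl ; (child zero x) root → sym (∧-rootʳ (i x)) ; (child zero x) (child zero y) → i-meet x y }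
    ; e⊑i = λ { root → root⊑ ; (child zero x) → e⊑i x }
    ; i<e = λ { root (child zero y) root< → e>root y ; (child zero x) (child zero y) (branch< ())
              ; (child zero x) (child zero y) (deeper< p) → i<e x y p }
    ; branching = λ { root d → refl ; (child zero x) d → branching x d }
    ; s-e = λ { root → s-root ; (child zero x) → s-e x }
    ; s-i = λ { root → s-root ; (child zero x) → s-i x }
    ; values = λ y → Sum.map₂ (λ { (x , c) → child zero x , c }) (values y) }
  ; i-root = refl
  ; constant-root = l , refl }
  where
  open Placement P
  e′ i′ : Pos (node (_ ∷ [])) → Pos (node _)
  e′ root           = root
  e′ (child zero x) = e x
  i′ root           = root
  i′ (child zero x) = i x
  i>root : ∀ x → root <T i x
  i>root x = <T-≤T-trans (e>root x) (⊑⇒≤T (e⊑i x))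

⊑-comparable : ∀ {x y z : Pos t} → x ⊑ z → y ⊑ z → x <T y → x ⊑ y
⊑-comparable root⊑      _          _           = root⊑
⊑-comparable (child⊑ p) (child⊑ q) (branch< l) = ⊥-elim (<-irrefl refl l)
⊑-comparable (child⊑ p) (child⊑ q) (deeper< l) = child⊑ (⊑-comparable p q l)

-- After the upper of the two images of the root of S₁ has been chosen, the lower one
-- counts as a constant.
mark : ∀ {ρ : Fin a → V} {κ : Pos (node S₁) → V} {s : Pos (node C) → V} → Low S₁ →
       (P : Placement ρ κ s) → ∀ l → κ root ≡ ρ l →
       Σ (Placement ρ κ s) λ Q → (Placement.e Q root ≡ Placement.i P root) × (Placement.i Q ≡ Placement.i P)
mark {S₁ = S₁} {ρ = ρ} {κ} {s} low P l κ-root = record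
  { e = e′ ; i = i
  ; e-mono = mono ; i-mono = i-mono
  ; e-meet = meet low ; i-meet = i-meet
  ; e⊑i = λ { root → ⊑-refl _ ; (child j x) → e⊑i (child j x) }
  ; i<e = λ { x (child j y) p → i<e x (child j y) p }
  ; branching = λ { root d → refl ; (child j x) d → branching (child j x) d }
  ; s-e = λ { root → s-i root ; (child j x) → s-e (child j x) }
  ; s-i = s-i
  ; values = λ y → value y (values y) } , refl , refl
  where
  open Placement P
  e′ : Pos (node S₁) → Pos (node _)
  e′ root          = i root
  e′ x@(child _ _) = e x
  mono : ∀ x y → x <T y → e′ x <T e′ y
  mono root        y@(child _ _) p = i<e root y p
  mono x@(child _ _) y@(child _ _) p = e-mono x y p
  root⊑e : ∀ j x → i root ⊑ e (child j x)
  root⊑e j x = ⊑-comparable (i-⊑ root⊑) (e⊑i (child j x)) (i<e root (child j x) root<)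
  meet : Low S₁ → ∀ x y → e′ (x ∧ y) ≡ e′ x ∧ e′ y
  meet _   root        root        = sym (⊑⇒∧ (⊑-refl _))
  meet _   root        (child j y) = sym (⊑⇒∧ (root⊑e j y))
  meet _   (child j x) root        = sym (trans (∧-comm (e (child j x)) (i root)) (⊑⇒∧ (root⊑e j x)))
  meet low (child j x) (child k y) = meet-child _ low j k x y refl
    where
    meet-child : ∀ S → Low S → (j k : Fin (length S₁)) (x : Pos (lookup S₁ j)) (y : Pos (lookup S₁ k)) → S ≡ S₁ →
                 e′ (child j x ∧ child k y) ≡ e (child j x) ∧ e (child k y)
    meet-child (_ ∷ []) _ zero zero x y refl = e-meet (child zero x) (child zero y)
  value : ∀ y → (∃ λ l → s y ≡ ρ l) ⊎ (∃ λ x → s y ≡ κ x × e x ⊑ y) →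
          (∃ λ l → s y ≡ ρ l) ⊎ (∃ λ x → s y ≡ κ x × e′ x ⊑ y)
  value y (inj₁ c)                     = inj₁ c
  value y (inj₂ (root , eq , le))      = inj₁ (l , trans eq κ-root)
  value y (inj₂ (child j x , eq , le)) = inj₂ (child j x , eq , le)

-- The doublings that arise from connections: every doubled node goes to its upper copy, and no
-- forest is added.
data IsDoubled : S ⇝ S′ → Set where
  []     : IsDoubled []
  keep   : ∀ {d : S₁ ⇝ S₁′} {d′ : S₂ ⇝ S₂′} → IsDoubled d → IsDoubled d′ → IsDoubled (keep d d′)
  double : ∀ {low} {d : S₁ ⇝ S₁′} {d′ : S₂ ⇝ S₂′} → IsDoubled d → IsDoubled d′ → IsDoubled (double true [] low d d′)

HeadKept : S ⇝ S′ → Set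
HeadKept (double _ _ _ _ _) = ⊥
HeadKept _                  = ⊤

SameHead : ∀ S → (Pos (node S) → Pos (node C)) → (Pos (node S) → Pos (node C)) → Set
SameHead []      e i = ⊤
SameHead (node _ ∷ S) e i = e (child zero root) ≡ i (child zero root)

-- `headKept` is for the recursion: after a root has been doubled, the search for its upper copy
-- continues with the two embeddings equal on it and must not double it again.
record Factorisation {a} {S} {C} {V : Set} {ρ : Fin (suc a) → V} {κ : Pos (node S) → V} {s : Pos (node C) → V}
                     (P : Planted ρ κ s) : Set where
  open Planted P
  field
    {target}  : Forest
    d         : S ⇝ target
    isDoubled : IsDoubled d
    headKept  : SameHead S e i → HeadKept d
    word      : Word (suc a) C target
    s-word    : ∀ y → s y ≡ val ρ (val ρ κ (baseWord d)) word y
    i-word    : ∀ x → i x ≡ pos word (pos (topWord {a = a} d) x)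

-- Without added forests the only constants in `baseWord d` are those bound within it. This is used
-- in `markFactor`, where the number of constants changes.
val-base-constants : ∀ {d : S ⇝ S′} → IsDoubled d → (ρ : Fin (suc a) → V) (ρ′ : Fin (suc b) → V) → ∀ κ y →
                     val ρ κ (baseWord d) y ≡ val ρ′ κ (baseWord d) y
val-base-constants D ρ ρ′ κ root = refl
val-base-constants (keep D D′) ρ ρ′ κ (child zero p)    = val-base-constants D _ _ (κ ∘ child zero) p
val-base-constants (keep D D′) ρ ρ′ κ (child (suc i) p) = val-base-constants D′ ρ ρ′ (κ ∘ shiftₚ) (child i p)
val-base-constants (double D D′) ρ ρ′ κ (child zero root) = refl
val-base-constants (double {low = low} {d = d} D D′) ρ ρ′ κ (child zero (child zero p)) =
  trans (val-raise [] low zero (baseWord d) _ (κ ∘ child zero) p)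
  (trans (val-base-constants D _ _ (override (κ (child zero root)) (κ ∘ child zero)) p)
         (sym (val-raise [] low zero (baseWord d) _ (κ ∘ child zero) p)))
val-base-constants (double D D′) ρ ρ′ κ (child (suc i) p) = val-base-constants D′ ρ ρ′ (κ ∘ shiftₚ) (child i p)

pos-top-constants : ∀ {d : S ⇝ S′} → IsDoubled d → ∀ x → pos (topWord {a = a} d) x ≡ pos (topWord {a = b} d) x
pos-top-constants D root = refl
pos-top-constants (keep D D′) (child zero q)      = cong (child zero) (pos-top-constants D q)
pos-top-constants (keep D D′) (child (suc j) q)   = cong shiftₚ (pos-top-constants D′ (child j q))
pos-top-constants (double D D′) (child zero q)    = cong (λ z → child zero (child zero z)) (pos-top-constants D q)
pos-top-constants (double D D′) (child (suc j) q) = cong shiftₚ (pos-top-constants D′ (child j q))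

-- Inverse to `child zero` on its image, with `root` as default elsewhere; `unshift` likewise.
unzero : Pos (node (node C₁ ∷ C₂)) → Pos (node C₁)
unzero (child zero p) = p
unzero _              = root

unshift : Pos (node (t ∷ C)) → Pos (node C)
unshift (child (suc i) p) = child i p
unshift _                 = root

InHead InTail : Pos (node (t ∷ C)) → Set
InHead x = ∃ λ p → child zero p ≡ x
InTail x = ∃ λ z → shiftₚ z ≡ x

child-unzero : ∀ {x : Pos (node (node C₁ ∷ C₂))} → InHead x → child zero (unzero x) ≡ x
child-unzero (p , refl) = refl

shift-unshift : ∀ {x : Pos (node (t ∷ C))} → InTail x → shiftₚ (unshift x) ≡ x
shift-unshift (root , refl)      = refl
shift-unshift (child i p , refl) = refl

head-⊑ : ∀ {x y : Pos (node (t ∷ C))} → InHead x → x ⊑ y → InHead y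
head-⊑ (p , refl) (child⊑ _) = _ , refl

head-or-tail : ∀ (x : Pos (node (t ∷ C))) → InHead x ⊎ InTail x
head-or-tail root              = inj₂ (root , refl)
head-or-tail (child zero p)    = inj₁ (p , refl)
head-or-tail (child (suc i) p) = inj₂ (child i p , refl)

tail-≤ : ∀ {x y : Pos (node (t ∷ C))} → root <T x → InTail x → x ≤T y → InTail y
tail-≤ _  h                  (inj₂ refl) = h
tail-≤ () (root , refl)      (inj₁ _)
tail-≤ _  (child i p , refl) (inj₁ (branch< {j = suc j} {q = q} _)) = child j q , refl
tail-≤ _  (child i p , refl) (inj₁ (deeper< {q = q} _))             = child i q , refl

tail-∧ : ∀ {x y : Pos (node (t ∷ C))} → InHead x → x ∧ y ≡ root → InTail y
tail-∧ {y = y} (p , refl) e with head-or-tail y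
... | inj₂ h          = h
tail-∧ (p , refl) () | inj₁ (q , refl)

head⋢tail : ∀ {x y : Pos (node (t ∷ C))} → InHead x → InTail y → ¬ x ⊑ y
head⋢tail (p , refl) (root , refl)      ()
head⋢tail (p , refl) (child i q , refl) ()

tail⊑head : ∀ {x y : Pos (node (t ∷ C))} → InTail x → InHead y → x ⊑ y → x ≡ root
tail⊑head (root , refl) _ _ = refl
tail⊑head (child i q , refl) (p , refl) ()

rootOf⊑ : ∀ (q : Pos t) → rootOf t ⊑ q
rootOf⊑ {node _} q = root⊑

shift-deg : ∀ (x : Pos (node C)) → 2 ≤ deg x → 2 ≤ deg (shiftₚ {t = t} x)
shift-deg root        le = ≤-trans le (n≤1+n _)
shift-deg (child i x) le = le

empty : ∀ (ρ : Fin a → V) (κ : Pos (node []) → V) (s : Pos (node C) → V) → s root ≡ κ root → (∃ λ l → κ root ≡ ρ l) →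
        (∀ y → ∃ λ l → s y ≡ ρ l) → Planted {S = []} ρ κ s
empty ρ κ s s-root c values = record
  { placement = record
    { e = λ _ → root ; i = λ _ → root
    ; e-mono = λ { root root () } ; i-mono = λ { root root () }
    ; e-meet = λ _ _ → refl ; i-meet = λ _ _ → refl
    ; e⊑i = λ _ → root⊑ ; i<e = λ { root root () } ; branching = λ _ _ → refl
    ; s-e = λ { root → s-root } ; s-i = λ { root → s-root } ; values = λ y → inj₁ (values y) }
  ; i-root = refl
  ; constant-root = c }

-- The position of the image of `r` decides between `skip` and the other constructors of `Word`.
module Split {a} {V : Set} {ρ : Fin a → V} {t : Tree} {S₂ : Forest} {κ : Pos (node (t ∷ S₂)) → V} {C₁ C₂ : Forest}
             {s : Pos (node (node C₁ ∷ C₂)) → V} (P : Planted ρ κ s) where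

  open Planted P

  r : Pos (node (t ∷ S₂))
  r = child zero (rootOf t)

  restrict-tail : ∀ {S′} (g : Pos (node S′) → Pos (node (t ∷ S₂))) → g root ≡ root →
                  (∀ x y → x <T y → g x <T g y) → (∀ x y → g (x ∧ y) ≡ g x ∧ g y) →
                  (∀ x → 2 ≤ deg x → 2 ≤ deg (g x)) →
                  (∀ x → InTail (e (g x))) → (∀ x → InTail (i (g x))) →
                  (∀ y x → e x ⊑ shiftₚ y → ∃ λ x′ → g x′ ≡ x) →
                  Σ (Planted ρ (κ ∘ g) (s ∘ shiftₚ)) λ Q →
                    (∀ x → shiftₚ (Planted.e Q x) ≡ e (g x)) × (∀ x → shiftₚ (Planted.i Q x) ≡ i (g x))
  restrict-tail g g-root g-< g-∧ g-deg te ti cover = record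
    { placement = restrict placement shift-frame g-< g-∧ g-deg (unshift ∘ e ∘ g) (unshift ∘ i ∘ g)
                    (shift-unshift ∘ te) (shift-unshift ∘ ti) (λ y x le → inj₂ (cover y x le))
    ; i-root = cong unshift (trans (cong i g-root) i-root)
    ; constant-root = proj₁ constant-root , trans (cong κ g-root) (proj₂ constant-root) }
    , shift-unshift ∘ te , shift-unshift ∘ ti

  -- Among the nodes other than the root, `r` is the least. Once its image has left the first tree
  -- of the target, all later images have left it too.
  module Absent (r-tail : ¬ InHead (e r)) where

    e-tail : ∀ x → InTail (e x)
    e-tail root = root , sym e-root
    e-tail x@(child j q) with head-or-tail (e r)
    ... | inj₁ h = ⊥-elim (r-tail h)
    ... | inj₂ h = tail-≤ (root<e {r} root<) h (r-first (r≤ j q))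
      where
      r≤ : ∀ j q → r ≤T child j q
      r≤ zero    q = ⊑⇒≤T (child⊑ (rootOf⊑ q))
      r≤ (suc j) q = inj₁ (branch< (s≤s z≤n))
      r-first : r ≤T x → e r ≤T e x
      r-first = Sum.map (e-mono r x) (cong e)

    i-tail : ∀ x → InTail (i x)
    i-tail root = root , sym i-root
    i-tail x@(child j q) = tail-≤ (root<e {x} root<) (e-tail x) (⊑⇒≤T (e⊑i x))

    tailPart : _
    tailPart = restrict-tail id refl (λ _ _ → id) (λ _ _ → refl) (λ _ → id) e-tail i-tail (λ y x _ → x , refl)

    constants : ∀ p → ∃ λ l → s (child zero p) ≡ ρ l
    constants p with values (child zero p)
    ... | inj₁ c = c
    ... | inj₂ (root , eq , _) = proj₁ constant-root , trans eq (proj₂ constant-root)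
    ... | inj₂ (x@(child j q) , _ , le) =
      ⊥-elim (<T-irrefl (subst (root <T_) (tail⊑head (e-tail x) (p , refl) le) (root<e {x} root<)))

  -- The nodes above `r` stay above its image. Those of the other trees meet `r` in the root, so
  -- their images lie outside the first tree of the target.
  module Present (r-head : InHead (e r)) where

    e-head : ∀ q → InHead (e (child zero q))
    e-head q = head-⊑ r-head (e-⊑ (child⊑ (rootOf⊑ q)))

    i-head : ∀ q → InHead (i (child zero q))
    i-head q = head-⊑ (e-head q) (e⊑i (child zero q))

    e-tail : ∀ y → InTail (e (shiftₚ y))
    e-tail y = tail-∧ r-head (trans (sym (e-meet r (shiftₚ y))) (trans (cong e (zero-∧-shift _ y)) e-root))

    i-tail : ∀ y → InTail (i (shiftₚ y))
    i-tail y = tail-∧ (head-⊑ r-head (e⊑i r)) (trans (sym (i-meet r (shiftₚ y))) (trans (cong i (zero-∧-shift _ y)) i-root))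

    tailPart : _
    tailPart = restrict-tail shiftₚ refl (λ _ _ → shiftₚ-<) shiftₚ-∧ shift-deg e-tail i-tail cover
      where
      cover : ∀ y x → e x ⊑ shiftₚ y → ∃ λ x′ → shiftₚ x′ ≡ x
      cover y x le with head-or-tail x
      ... | inj₂ c          = c
      ... | inj₁ (q , refl) = ⊥-elim (head⋢tail (e-head q) (y , refl) le)

    headPart : Placement ρ (κ ∘ child zero) (s ∘ child zero)
    headPart = restrict placement zero-frame (λ _ _ → deeper<) (λ _ _ → refl) (λ _ → id)
                 (λ q → unzero (e (child zero q))) (λ q → unzero (i (child zero q)))
                 (child-unzero ∘ e-head) (child-unzero ∘ i-head) cover
      where
      cover : ∀ y x → e x ⊑ child zero y → (∃ λ l → κ x ≡ ρ l) ⊎ (∃ λ q → child zero q ≡ x)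
      cover y x le with head-or-tail x
      ... | inj₁ c = inj₂ c
      ... | inj₂ (root , refl) = inj₁ constant-root
      ... | inj₂ (z@(child j q) , refl) =
        ⊥-elim (<T-irrefl (subst (root <T_) (tail⊑head (e-tail z) (y , refl) le) (root<e {shiftₚ z} root<)))

    e-headPart : ∀ q → child zero (Placement.e headPart q) ≡ e (child zero q)
    e-headPart q = child-unzero (e-head q)

    i-headPart : ∀ q → child zero (Placement.i headPart q) ≡ i (child zero q)
    i-headPart q = child-unzero (i-head q)

module Assemble {a} {V : Set} {ρ : Fin (suc a) → V} {C₁ C₂ : Forest} {s : Pos (node (node C₁ ∷ C₂)) → V} where

  skipFactor : ∀ {S} {κ : Pos (node S) → V} (P : Planted ρ κ s) l →
               {κ₁ : Pos (node []) → V} {P₁ : Planted ρ κ₁ (s ∘ child zero)} → κ₁ root ≡ ρ l → Factorisation P₁ →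
               {P₂ : Planted ρ κ (s ∘ shiftₚ)} →
               (∀ x → shiftₚ (Planted.e P₂ x) ≡ Planted.e P x) → (∀ x → shiftₚ (Planted.i P₂ x) ≡ Planted.i P x) →
               Factorisation P₂ → Factorisation P
  skipFactor {S} {κ} P l κ₁-root F₁ ei ii F₂ with F₁
  ... | record { d = [] ; word = w ; s-word = s-w } = record
    { d = F₂.d ; isDoubled = F₂.isDoubled ; headKept = F₂.headKept ∘ sameHead S ei ii
    ; word = skip l w F₂.word
    ; s-word = λ { root → F₂.s-word root
                 ; (child zero p) → trans (s-w p) (val-cong (λ _ → refl) (λ { root → κ₁-root ; (child () _) }) w p)
                 ; (child (suc i) p) → F₂.s-word (child i p) }
    ; i-word = λ x → trans (sym (ii x)) (trans (cong shiftₚ (F₂.i-word x)) (sym (pos-skip F₂.word (pos (topWord F₂.d) x)))) }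
    where
    module F₂ = Factorisation F₂
    sameHead : ∀ S {e i : Pos (node S) → Pos (node C₂)} {e′ i′} → (∀ x → shiftₚ (e x) ≡ e′ x) → (∀ x → shiftₚ (i x) ≡ i′ x) →
               SameHead S e′ i′ → SameHead S e i
    sameHead []           ei ii _  = tt
    sameHead (node _ ∷ S) ei ii eq = Frame.k-injective shift-frame (trans (ei _) (trans eq (sym (ii _))))

  module _ {S₁ S₂ : Forest} {κ : Pos (node (node S₁ ∷ S₂)) → V} (P : Planted ρ κ s)
           {P₂ : Planted ρ (κ ∘ shiftₚ) (s ∘ shiftₚ)} (i₂ : ∀ x → shiftₚ (Planted.i P₂ x) ≡ Planted.i P (shiftₚ x))
           (F₂ : Factorisation P₂) where

    open Planted P
    module F₂ = Factorisation F₂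

    s-root : s root ≡ κ root
    s-root = trans (cong s (sym e-root)) (s-e root)

    passFactor : ∀ l {P₁ : Planted {S = node S₁ ∷ []} ρ (rooted (ρ l) (κ ∘ child zero)) (s ∘ child zero)} →
                 (∀ q → child zero (Planted.e P₁ (child zero q)) ≡ e (child zero q)) →
                 (∀ q → child zero (Planted.i P₁ (child zero q)) ≡ i (child zero q)) →
                 Factorisation P₁ → Factorisation P
    passFactor l e₁ i₁ F₁ with F₁
    ... | record { d = keep d [] ; isDoubled = keep D [] ; word = w ; s-word = s-w ; i-word = i-w } = record
      { d = keep d F₂.d ; isDoubled = keep D F₂.isDoubled ; headKept = λ _ → tt
      ; word = pass l w F₂.word
      ; s-word = λ { root → s-root
                   ; (child zero p) → trans (s-w p) (val-cong (λ _ → refl) (λ { root → refl ; (child zero q) → refl }) w p)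
                   ; (child (suc i) p) → trans (F₂.s-word (child i p))
                       (val-cong (λ _ → refl) (λ x → sym (val-bind (baseWord F₂.d) ρ κ x)) F₂.word (child i p)) }
      ; i-word = λ { root → i-root
                   ; (child zero q) → trans (sym (i₁ q)) (cong (child zero) (i-w (child zero q)))
                   ; (child (suc j) q) → trans (sym (i₂ (child j q)))
                       (trans (cong shiftₚ (F₂.i-word (child j q))) (sym (pos-pass F₂.word (pos (topWord F₂.d) (child j q))))) } }
    ... | record { d = double _ _ low d [] ; isDoubled = double D [] ; headKept = kept ; word = w ; s-word = s-w ; i-word = i-w } = record
      { d = double true [] low d F₂.d ; isDoubled = double D F₂.isDoubled
      ; headKept = λ eq → kept (child-injective (trans (e₁ root) (trans eq (sym (i₁ root)))))
      ; word = pass l w F₂.word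
      ; s-word = λ { root → s-root
                   ; (child zero p) → trans (s-w p) (val-cong (λ _ → refl) (λ { root → refl ; (child zero q) → refl }) w p)
                   ; (child (suc i) p) → trans (F₂.s-word (child i p))
                       (val-cong (λ _ → refl) (λ x → sym (val-bind (baseWord F₂.d) ρ κ x)) F₂.word (child i p)) }
      ; i-word = λ { root → i-root
                   ; (child zero q) → trans (sym (i₁ q)) (cong (child zero) (i-w (child zero q)))
                   ; (child (suc j) q) → trans (sym (i₂ (child j q)))
                       (trans (cong shiftₚ (F₂.i-word (child j q))) (sym (pos-pass F₂.word (pos (topWord F₂.d) (child j q))))) } }

    bindFactor : {P₁ : Planted {S = S₁} (κ (child zero root) ◂ ρ) (κ ∘ child zero) (s ∘ child zero)} →
                 (∀ q → child zero (Planted.i P₁ q) ≡ i (child zero q)) →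
                 Factorisation P₁ → Factorisation P
    bindFactor i₁ F₁ = record
      { d = keep F₁.d F₂.d ; isDoubled = keep F₁.isDoubled F₂.isDoubled ; headKept = λ _ → tt
      ; word = bind F₁.word F₂.word
      ; s-word = λ { root → s-root
                   ; (child zero p) → F₁.s-word p
                   ; (child (suc i) p) → trans (F₂.s-word (child i p))
                       (val-cong (λ _ → refl) (λ x → sym (val-bind (baseWord F₂.d) ρ κ x)) F₂.word (child i p)) }
      ; i-word = λ { root → i-root
                   ; (child zero q) → trans (sym (i₁ q)) (cong (child zero) (F₁.i-word q))
                   ; (child (suc j) q) → trans (sym (i₂ (child j q)))
                       (trans (cong shiftₚ (F₂.i-word (child j q))) (sym (pos-bind F₂.word (pos (topWord F₂.d) (child j q))))) } }
      where module F₁ = Factorisation F₁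

    -- The root of the tree that `F₁` places becomes the upper copy, and the lower copy is obtained
    -- by binding the root of the first tree of the target. By `headKept` the upper copy is not
    -- doubled in `F₁`.
    markFactor : Low S₁ → ¬ e (child zero root) ≡ i (child zero root) →
                 {P₁ : Planted {S = node S₁ ∷ []} (κ (child zero root) ◂ ρ) (rooted (κ (child zero root)) (κ ∘ child zero)) (s ∘ child zero)} →
                 Planted.e P₁ (child zero root) ≡ Planted.i P₁ (child zero root) →
                 (∀ q → child zero (Planted.i P₁ (child zero q)) ≡ i (child zero q)) →
                 Factorisation P₁ → Factorisation P
    markFactor low e≢i same i₁ F₁ with F₁
    ... | record { d = double _ _ _ _ _ ; headKept = kept } = ⊥-elim (kept same)
    ... | record { d = keep d [] ; isDoubled = keep D [] ; word = w ; s-word = s-w ; i-word = i-w } = record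
      { d = double true [] low d F₂.d ; isDoubled = double D F₂.isDoubled ; headKept = e≢i
      ; word = bind w F₂.word
      ; s-word = λ { root → s-root
                   ; (child zero p) → trans (s-w p) (val-cong (λ _ → refl) pointwise w p)
                   ; (child (suc i) p) → trans (F₂.s-word (child i p))
                       (val-cong (λ _ → refl) (λ x → sym (val-bind (baseWord F₂.d) ρ κ x)) F₂.word (child i p)) }
      ; i-word = λ { root → i-root
                   ; (child zero q) → trans (sym (i₁ q)) (cong (child zero)
                       (trans (i-w (child zero q)) (cong (λ z → pos w (child zero z)) (pos-top-constants D q))))
                   ; (child (suc j) q) → trans (sym (i₂ (child j q)))
                       (trans (cong shiftₚ (F₂.i-word (child j q))) (sym (pos-bind F₂.word (pos (topWord F₂.d) (child j q))))) } }
      where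
      x₀ : V
      x₀ = κ (child zero root)
      pointwise : ∀ x → val (x₀ ◂ ρ) (rooted x₀ (κ ∘ child zero)) (baseWord (keep d [])) x
                        ≡ val ρ κ (baseWord (double true [] low d F₂.d)) (child zero x)
      pointwise root           = refl
      pointwise (child zero q) = trans (val-base-constants D _ _ (κ ∘ child zero) q)
        (trans (val-cong (λ _ → refl) (λ { root → refl ; (child _ _) → refl }) (baseWord d) q)
               (sym (val-raise [] low zero (baseWord d) (x₀ ◂ ρ) (κ ∘ child zero) q)))

low-if : ∀ {S : Forest} → ¬ 2 ≤ length S → Low S
low-if {[]}        _ = tt
low-if {_ ∷ []}    _ = tt
low-if {_ ∷ _ ∷ _} h = ⊥-elim (h (s≤s (s≤s z≤n)))

-- The images of the root of the first tree of `S` determine the constructor: `skip` if they avoid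
-- the first tree of `C`, `bind` if both are the root of that tree, `pass` if both are strictly
-- above it. If only `i` moves it off that root, it is low by `branching` and gets doubled.
factorise : ∀ {a} {V : Set} C S {ρ : Fin (suc a) → V} {κ : Pos (node S) → V} {s : Pos (node C) → V} (P : Planted ρ κ s) → Factorisation P
factorise [] [] {s = s} P = record
  { d = [] ; isDoubled = [] ; headKept = λ _ → tt ; word = []
  ; s-word = λ { root → trans (cong s (sym e-root)) (s-e root) ; (child () _) }
  ; i-word = λ { root → i-root ; (child () _) } }
  where open Planted P
factorise [] (t ∷ S) P with Planted.e P (child zero (rootOf t)) | Planted.root<e P {child zero (rootOf t)} root<
... | child () _ | _
factorise (node C₁ ∷ C₂) [] {ρ} {κ} {s} P =
  skipFactor P l refl (factorise C₁ [] P₁) (λ { root → sym e-root ; (child () _) }) (λ { root → sym i-root ; (child () _) })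
             (factorise C₂ [] P₂)
  where
  open Planted P
  open Assemble
  constants : ∀ y → ∃ λ l → s y ≡ ρ l
  constants y with values y
  ... | inj₁ c                 = c
  ... | inj₂ (root , eq , _)   = proj₁ constant-root , trans eq (proj₂ constant-root)
  l = proj₁ (constants (child zero root))
  P₁ = empty ρ (λ _ → ρ l) (s ∘ child zero) (proj₂ (constants (child zero root))) (l , refl) (constants ∘ child zero)
  P₂ = empty ρ κ (s ∘ shiftₚ) (trans (cong s (sym e-root)) (s-e root)) constant-root (constants ∘ shiftₚ)
factorise {V = V} (node C₁ ∷ C₂) (node S₁ ∷ S) {ρ} {κ} {s} P with head-or-tail (Planted.e P (child zero root))
... | inj₂ r-tail = skipFactor P l refl (factorise C₁ [] P₁) (proj₁ (proj₂ tailPart)) (proj₂ (proj₂ tailPart))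
                      (factorise C₂ (node S₁ ∷ S) (proj₁ tailPart))
  where
  open Planted P
  open Split P
  open Absent (λ h → <T-irrefl (subst (root <T_) (tail⊑head r-tail h (⊑-refl _)) (root<e {child zero root} root<)))
  open Assemble
  l = proj₁ (constants root)
  P₁ = empty ρ (λ _ → ρ l) (s ∘ child zero) (proj₂ (constants root)) (l , refl) constants
... | inj₁ r-head = dispatch (H.e root) (H.i root) refl refl
  where
  open Planted P
  open Split.Present P r-head
  open Assemble
  module H = Placement headPart
  r : Pos (node (node S₁ ∷ S))
  r = child zero root
  x₀ : V
  x₀ = κ r
  F₂ : Factorisation (proj₁ tailPart)
  F₂ = factorise C₂ S (proj₁ tailPart)
  i₂ : ∀ x → shiftₚ (Planted.i (proj₁ tailPart) x) ≡ i (shiftₚ x)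
  i₂ = proj₂ (proj₂ tailPart)
  root<H : ∀ {j p} → H.e root ≡ child j p → ∀ x → root <T H.e x
  root<H eq x = <T-≤T-trans (subst (root <T_) (sym eq) root<) (⊑⇒≤T (H.e-⊑ root⊑))
  constant-at-root : ∀ {j p} → H.e root ≡ child j p → ∃ λ l → s (child zero root) ≡ ρ l
  constant-at-root eq with H.values root
  ... | inj₁ c            = c
  ... | inj₂ (x , _ , le) = ⊥-elim (<T-irrefl (<T-≤T-trans (root<H eq x) (⊑⇒≤T le)))
  dispatch : ∀ e₀ i₀ → H.e root ≡ e₀ → H.i root ≡ i₀ → Factorisation P
  dispatch root root e-eq i-eq = bindFactor P i₂ F₂ {P₁} i-headPart (factorise C₁ S₁ P₁)
    where
    P₁ : Planted (x₀ ◂ ρ) (κ ∘ child zero) (s ∘ child zero)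
    P₁ = record { placement = addConstant x₀ headPart ; i-root = i-eq ; constant-root = zero , refl }
  dispatch (child j p) _ e-eq i-eq with constant-at-root e-eq
  ... | l , eq = passFactor P i₂ F₂ l {P₁} e-headPart i-headPart (factorise C₁ (node S₁ ∷ []) P₁)
    where
    P₁ : Planted {S = node S₁ ∷ []} ρ (rooted (ρ l) (κ ∘ child zero)) (s ∘ child zero)
    P₁ = plant headPart (root<H e-eq) l eq
  dispatch root (child j p) e-eq i-eq =
    markFactor P i₂ F₂ low e≢i {P₁} (trans e-Q (sym (cong (λ f → f root) i-Q)))
               (λ q → trans (cong (λ f → child zero (f q)) i-Q) (i-headPart q)) (factorise C₁ (node S₁ ∷ []) P₁)
    where
    e≢iᴴ : ¬ H.e root ≡ H.i root
    e≢iᴴ eq with trans (sym e-eq) (trans eq i-eq)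
    ... | ()
    e≢i : ¬ e r ≡ i r
    e≢i eq = e≢iᴴ (child-injective (trans (e-headPart root) (trans eq (sym (i-headPart root)))))
    low : Low S₁
    low = low-if {S₁} (λ two → e≢iᴴ (H.branching root two))
    marking : Σ (Placement (x₀ ◂ ρ) (κ ∘ child zero) (s ∘ child zero)) λ Q →
              (Placement.e Q root ≡ H.i root) × (Placement.i Q ≡ H.i)
    marking = mark low (addConstant x₀ headPart) zero refl
    Q = proj₁ marking
    e-Q = proj₁ (proj₂ marking)
    i-Q = proj₂ (proj₂ marking)
    root<Q : ∀ x → root <T Placement.e Q x
    root<Q x = <T-≤T-trans (subst (root <T_) (sym (trans e-Q i-eq)) root<) (⊑⇒≤T (Placement.e-⊑ Q {root} {x} root⊑))
    s-root-κ : s (child zero root) ≡ x₀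
    s-root-κ = trans (cong (s ∘ child zero) (sym e-eq)) (H.s-e root)
    P₁ : Planted {S = node S₁ ∷ []} (x₀ ◂ ρ) (rooted x₀ (κ ∘ child zero)) (s ∘ child zero)
    P₁ = plant Q root<Q zero s-root-κ

-- Connections as placements

two-successors : ∀ (x : Pos t) → 2 ≤ deg x → Σ (Pos t) λ y → Σ (Pos t) λ z → y ∧ z ≡ x × x <T y × x <T z
two-successors {node (node _ ∷ node _ ∷ _)} root _ = child zero root , child (suc zero) root , refl , root< , root<
two-successors {node (_ ∷ [])} root (s≤s ())
two-successors (child i x) le with two-successors x le
... | y , z , eq , x<y , x<z = child i y , child i z , trans (∧-same i y z) (cong (child i) eq) , deeper< x<y , deeper< x<z

-- The branches to `p` and `q` have already parted, so going further up does not change where.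
∧-⊑-⊑ : ∀ {p p′ q q′ : Pos t} → p ⊑ p′ → q ⊑ q′ → ¬ p ⊑ q → ¬ q ⊑ p → p ∧ q ≡ p′ ∧ q′
∧-⊑-⊑ root⊑ _ p⋢q _ = ⊥-elim (p⋢q root⊑)
∧-⊑-⊑ (child⊑ _) root⊑ _ q⋢p = ⊥-elim (q⋢p root⊑)
∧-⊑-⊑ (child⊑ {i = i} p) (child⊑ {i = j} q) p⋢q q⋢p with i Fin.≟ j
... | yes refl = cong (child i) (∧-⊑-⊑ p q (p⋢q ∘ child⊑) (q⋢p ∘ child⊑))
... | no _     = refl

module Connection {S C : Tree} (g : Hom S C) where
  open Conn g public

  e : Pos S → Pos C
  e = proj₁ s-rigid

  e-emb : IsEmbedding e
  e-emb = proj₁ (proj₂ s-rigid)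

  s-e : ∀ x → s (e x) ≡ x
  s-e = proj₁ (proj₂ (proj₂ s-rigid))

  e-s : ∀ y → e (s y) ⊑ y
  e-s = proj₂ (proj₂ (proj₂ s-rigid))

  e⊑i : ∀ x → e x ⊑ i x
  e⊑i x = subst (λ y → e y ⊑ i x) (retr x) (e-s (i x))

  -- If `e y` preceded `i x`, then by `below` its value `y` would be at most `x`; if they were
  -- equal, so would be their values.
  i<e : ∀ x y → x <T y → i x <T e y
  i<e x y x<y with <T-total (e y) (i x)
  ... | inj₂ lt         = lt
  ... | inj₁ (inj₁ lt)  = ⊥-elim (<T-irrefl (<T-≤T-trans x<y (subst (_≤T x) (s-e y) (below x (e y) lt))))
  ... | inj₁ (inj₂ eq)  = ⊥-elim (<T-irrefl (subst (x <T_) (trans (sym (s-e y)) (trans (cong s eq) (retr x))) x<y))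

  -- A branching node is the meet of two nodes above it whose images under `e` are incomparable.
  -- Replacing these by the images under `i` above them leaves the meet unchanged.
  branching : ∀ x → 2 ≤ deg x → e x ≡ i x
  branching x le with two-successors x le
  ... | y , z , eq , x<y , x<z = begin
    e x          ≡⟨ cong e (sym eq) ⟩
    e (y ∧ z)    ≡⟨ IsEmbedding.meet e-emb y z ⟩
    e y ∧ e z    ≡⟨ ∧-⊑-⊑ (e⊑i y) (e⊑i z) (incomparable x<y eq) (incomparable x<z (trans (∧-comm z y) eq)) ⟩
    i y ∧ i z    ≡⟨ sym (IsEmbedding.meet i-emb y z) ⟩
    i (y ∧ z)    ≡⟨ cong i eq ⟩
    i x          ∎
    where
    open ≡-Reasoning
    incomparable : ∀ {y z} → x <T y → y ∧ z ≡ x → ¬ e y ⊑ e z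
    incomparable {y} {z} x<y eq le = <T-irrefl (subst (_<T e y)
      (trans (cong e (sym eq)) (trans (IsEmbedding.meet e-emb y z) (⊑⇒∧ le))) (IsEmbedding.mono e-emb x y x<y))

-- Each `e x` is the least node of value `x`. Hence a colouring defined through `e` respects `_≈_`,
-- which compares only `s` and `i`.
e-unique : ∀ {S C : Tree} (g h : Hom S C) → (∀ y → Conn.s g y ≡ Conn.s h y) → ∀ x → Connection.e g x ≡ Connection.e h x
e-unique g h eq x = ⊑-antisym (le g h eq) (le h g (sym ∘ eq))
  where
  le : ∀ g h → (∀ y → Conn.s g y ≡ Conn.s h y) → Connection.e g x ⊑ Connection.e h x
  le g h eq = subst (λ z → Connection.e g z ⊑ Connection.e h x) (trans (eq _) (Connection.s-e h x))
                    (Connection.e-s g (Connection.e h x))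

planted : (g : Hom (node S) (node C)) → Planted {S = S} (λ (_ : Fin 1) → root) id (Conn.s g)
planted g = record
  { placement = record
    { e = e ; i = i ; e-mono = IsEmbedding.mono e-emb ; i-mono = IsEmbedding.mono i-emb
    ; e-meet = IsEmbedding.meet e-emb ; i-meet = IsEmbedding.meet i-emb
    ; e⊑i = e⊑i ; i<e = i<e ; branching = branching ; s-e = s-e ; s-i = retr
    ; values = λ y → inj₂ (s y , refl , e-s y) }
  ; i-root = IsEmbedding.root↦root i-emb
  ; constant-root = zero , refl }
  where open Connection g

unmarked : ∀ b → Σ (Bit b) λ x → marked b x ≡ false
unmarked true  = false , refl
unmarked false = tt , refl

-- Brings the doubling of a factorisation into the finite list indexed by marks. Pairs are compared
-- because the target forest varies with the mark.
isDoubled⇒ : ∀ {d : S ⇝ S′} → IsDoubled d → Σ (Mark S) λ m → _≡_ {A = ∃ (S ⇝_)} (S′ , d) (doubled S m , doubled⇝ S m)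
isDoubled⇒ [] = tt , refl
isDoubled⇒ {S = node S₁ ∷ S₂} (keep D D′) with isDoubled⇒ D | isDoubled⇒ D′
... | m₁ , refl | m₂ , refl with unmarked (length S₁ ≤ᵇ 1)
... | x , unmarked-x = (x , m₁ , m₂) , eq _ _ unmarked-x
  where
  eq : ∀ b low → b ≡ false → _≡_ {A = ∃ ((node S₁ ∷ S₂) ⇝_)} (_ , keep (doubled⇝ S₁ m₁) (doubled⇝ S₂ m₂))
                               (_ , doubledTree⇝ b low (doubled⇝ S₁ m₁) (doubled⇝ S₂ m₂))
  eq false low refl = refl
isDoubled⇒ {S = node S₁ ∷ S₂} (double {low = low} D D′) with isDoubled⇒ D | isDoubled⇒ D′
... | m₁ , refl | m₂ , refl with marked-if (length S₁ ≤ᵇ 1) low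
  where
  marked-if : ∀ b → T b → Σ (Bit b) λ x → marked b x ≡ true
  marked-if true _ = true , refl
... | x , marked-x = (x , m₁ , m₂) , eq _ (marked⇒ (length S₁ ≤ᵇ 1) x) marked-x
  where
  eq : ∀ b low′ → b ≡ true → _≡_ {A = ∃ ((node S₁ ∷ S₂) ⇝_)} (_ , double true [] low (doubled⇝ S₁ m₁) (doubled⇝ S₂ m₂))
                               (_ , doubledTree⇝ b low′ (doubled⇝ S₁ m₁) (doubled⇝ S₂ m₂))
  eq true low′ refl rewrite T-irrelevant low (low′ tt) = refl

-- The upper bound

identity : ∀ C → Word a C C
identity []            = []
identity (node C ∷ C′) = bind (identity C) (identity C′)

-- A colouring settled by `w` remains settled on `w • u`, so the forests can be dealt with one after
-- the other.
simultaneous : ∀ n (S : Fin n → Forest) B r → Σ Forest λ C → ∀ (χ : ∀ k → Word 1 C (S k) → Fin r) →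
               Σ (Word 1 C B) λ w → ∀ k v v′ → χ k (w • v) ≡ χ k (w • v′)
simultaneous zero    S B r = B , λ χ → identity B , λ ()
simultaneous (suc n) S B r with simultaneous n (S ∘ suc) B r
... | D , IH with ramsey (S zero) 0 D r
... | C , H = C , go
  where
  go : (χ : ∀ k → Word 1 C (S k) → Fin r) → Σ (Word 1 C B) λ w → ∀ k v v′ → χ k (w • v) ≡ χ k (w • v′)
  go χ with H (χ zero)
  ... | w , mono with IH (λ k u → χ (suc k) (w • u))
  ... | u , monos = w • u , λ
    { zero v v′ → trans (cong (χ zero) (•-assoc w u v)) (trans (mono (u • v) (u • v′) tt) (cong (χ zero) (sym (•-assoc w u v′))))
    ; (suc k) v v′ → trans (cong (χ (suc k)) (•-assoc w u v)) (trans (monos k v v′) (cong (χ (suc k)) (sym (•-assoc w u v′)))) }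

composite-≈ : ∀ (w : Word 1 C B) {g : Hom (node S) (node B)} (F : Factorisation (planted g)) (h : Hom (node S) (node C)) →
              IsComp h (wordConn w) g → h ≈ (wordConn (w • Factorisation.word F) ∘ᶜ extConn (Factorisation.d F))
composite-≈ w F h (hs , hi) =
  (λ z → trans (hs z) (trans (s-word (retraction w z))
     (trans (sym (val-natural base (word) (retraction w z)))
       (cong base (trans (val-natural (retraction word) w z) (sym (val-comp id w word _ id z))))))) ,
  (λ x → trans (hi x) (trans (cong (pos w) (i-word x)) (sym (pos-comp id w word (pos (topWord d) x)))))
  where
  open Factorisation F
  base = retraction (baseWord d)

upper : ∀ S B → RamseyProp S B (2 ^ countLow S)
upper (node S) (node B) r@(suc _) 0<r with simultaneous (2 ^ countLowList S) (doubled S ∘ Inverse.from (Mark↔ S)) B r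
... | C , H = node C , λ χ → go χ
  where
  open Inverse (Mark↔ S)
  go : (χ : Colouring r (node S) (node C)) → Σ (Hom (node B) (node C)) λ f → AtMostColours (2 ^ countLowList S) χ f
  go χ with H (λ k u → Colouring.col χ (wordConn u ∘ᶜ extConn (doubled⇝ S (from k))))
  ... | w , mono = wordConn w , List.tabulate (value ∘ from) , ≤-reflexive (length-tabulate (value ∘ from)) , λ g h hfg → covered g h hfg
    where
    open Colouring χ
    colour : ∀ m → Word 1 C (doubled S m) → Fin r
    colour m u = col (wordConn u ∘ᶜ extConn (doubled⇝ S m))
    colour-mono : ∀ m v v′ → colour m (w • v) ≡ colour m (w • v′)
    colour-mono m = subst (λ m → ∀ v v′ → colour m (w • v) ≡ colour m (w • v′)) (strictlyInverseʳ m) (mono (to m))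
    -- There may be no word from `B` to a doubled forest; the default colour for its mark exists
    -- because `r` is positive.
    some : ∀ {A : Set} → Finite A → (A → Fin r) → Fin r
    some FA f with size FA | enum FA
    ... | zero  | _ = zero
    ... | suc _ | x = f (x zero)
    value : Mark S → Fin r
    value m = some (Finite-Word 1 B (doubled S m)) (λ v → colour m (w • v))
    some-constant : ∀ {A : Set} (FA : Finite A) f → (∀ x y → f x ≡ f y) → ∀ x → f x ≡ some FA f
    some-constant FA f const x with size FA | enum FA | index FA x
    ... | suc _ | y | _ = const x (y zero)
    covered : ∀ g h → IsComp h (wordConn w) g → col h ∈ List.tabulate (value ∘ from)
    covered g h hfg with factorise B S (planted g)
    ... | F with isDoubled⇒ (Factorisation.isDoubled F)
    covered g h hfg | F@(record { word = v }) | m , refl =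
      subst (_∈ List.tabulate (value ∘ from)) (sym eq) (∈-tabulate⁺ (to m))
      where
      eq : col h ≡ value (from (to m))
      eq = trans (resp h _ (composite-≈ w F h hfg))
        (trans (some-constant (Finite-Word 1 B (doubled S m)) (λ v → colour m (w • v)) (colour-mono m) v)
               (cong value (sym (strictlyInverseʳ m))))

-- The lower bound

bit : ∀ b → Bool → Bit b
bit true  x = x
bit false _ = tt

read : ∀ S → (Pos (node S) → Bool) → Mark S
read []            f = tt
read (node S₁ ∷ S) f = bit (length S₁ ≤ᵇ 1) (f (child zero root)) , read S₁ (f ∘ child zero) , read S (f ∘ shiftₚ)

read-cong : ∀ S {f g : Pos (node S) → Bool} → (∀ x → f x ≡ g x) → read S f ≡ read S g
read-cong []            eq = refl
read-cong (node S₁ ∷ S) eq =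
  cong₂ _,_ (cong (bit _) (eq (child zero root))) (cong₂ _,_ (read-cong S₁ (eq ∘ child zero)) (read-cong S (eq ∘ shiftₚ)))

-- The bound on `deg z` is where the additional leaf in `full` enters: a doubled node that is sent
-- to its lower copy has a branching image.
Separates : ∀ {S′} → ℕ → S ⇝ S′ → (Pos (node S) → Bool) → Set
Separates a d f = ∀ j q → let x = child j q ; y = pos (baseWord {a = a} d) x ; z = pos (topWord {a = a} d) x in
  (y ≡ z → 2 ≤ deg z → f x ≡ false) × (¬ y ≡ z → f x ≡ true)

NonRoot-deg : ∀ {t S} {x : Pos (node S)} → NonRoot x → deg (shiftₚ {t = t} x) ≡ deg x
NonRoot-deg (child i p) = refl

separates-child : ∀ {t u} {y z : Pos t} {v : Bool} (k : Pos t → Pos u) → (∀ {y z} → k y ≡ k z → y ≡ z) →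
                  deg (k z) ≡ deg z → ∀ {y′ z′} → y′ ≡ k y → z′ ≡ k z →
                  (y′ ≡ z′ → 2 ≤ deg z′ → v ≡ false) × (¬ y′ ≡ z′ → v ≡ true) →
                  (y ≡ z → 2 ≤ deg z → v ≡ false) × (¬ y ≡ z → v ≡ true)
separates-child {z = z} k inj k-deg refl refl (same , different) =
  (λ eq le → same (cong k eq) (subst (2 ≤_) (sym k-deg) le)) , (λ neq → different (neq ∘ inj))

separates-step : ∀ b (low : T b → Low S₁) x (d₁ : S₁ ⇝ S₁′) (d₂ : S₂ ⇝ S₂′) f →
                 Separates a (fullTree⇝ b low x d₁ d₂) f →
                 bit b (f (child zero root)) ≡ x × Separates (suc a) d₁ (f ∘ child zero) × Separates a d₂ (f ∘ shiftₚ)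
separates-step {S₁ = S₁} {a = a} b low x d₁ d₂ f sep = bit-x b low x sep , below b low x sep , beside b low x sep
  where
  bit-x : ∀ b low x → Separates a (fullTree⇝ b low x d₁ d₂) f → bit b (f (child zero root)) ≡ x
  bit-x false low tt    sep = refl
  bit-x true  low false sep = proj₁ (sep zero root) refl (s≤s (s≤s z≤n))
  bit-x true  low true  sep = proj₂ (sep zero root) (λ ())
  below : ∀ b low x → Separates a (fullTree⇝ b low x d₁ d₂) f → Separates (suc a) d₁ (f ∘ child zero)
  below false low x sep j q =
    separates-child (child zero) child-injective refl refl refl (sep zero (child j q))
  below true low false sep j q =
    separates-child (λ z → child zero (child zero z)) (child-injective ∘ child-injective) refl
      (cong (child zero) (pos-raise (node [] ∷ []) (low tt) zero (baseWord d₁) j q))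
      (cong (child zero) (pos-raise (node [] ∷ []) (low tt) zero (topWord d₁) j q)) (sep zero (child j q))
  below true low true sep j q =
    separates-child (λ z → child zero (child zero z)) (child-injective ∘ child-injective) refl
      (cong (child zero) (pos-raise (node [] ∷ []) (low tt) zero (baseWord d₁) j q))
      refl (sep zero (child j q))
  beside : ∀ b low x → Separates a (fullTree⇝ b low x d₁ d₂) f → Separates a d₂ (f ∘ shiftₚ)
  beside false low x sep j q =
    separates-child shiftₚ (Frame.k-injective shift-frame) (NonRoot-deg (pos-NonRoot (topWord d₂) j q)) refl refl (sep (suc j) q)
  beside true low false sep j q =
    separates-child shiftₚ (Frame.k-injective shift-frame) (NonRoot-deg (pos-NonRoot (topWord d₂) j q)) refl refl (sep (suc j) q)
  beside true low true sep j q =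
    separates-child shiftₚ (Frame.k-injective shift-frame) (NonRoot-deg (pos-NonRoot (topWord d₂) j q)) refl refl (sep (suc j) q)

read-full : ∀ S m f → Separates a (full⇝ S m) f → read S f ≡ m
read-full []            tt            f sep = refl
read-full (node S₁ ∷ S) (x , m₁ , m) f sep with separates-step (length S₁ ≤ᵇ 1) id x (full⇝ S₁ m₁) (full⇝ S m) f sep
... | bit-x , sep₁ , sep₂ = cong₂ _,_ bit-x (cong₂ _,_ (read-full S₁ m₁ _ sep₁) (read-full S m _ sep₂))

moved : ∀ {S C : Tree} → Hom S C → Pos S → Bool
moved g x = not ⌊ Connection.e g x ≟ₚ Connection.i g x ⌋

-- The images of `x` are `f.e y` and `f.i z`. If `y` and `z` coincide in a branching node, so do
-- these; otherwise `f.e y ⊑ f.i y` and `f.i y` strictly precedes `f.i z`.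
moved-full : ∀ {C} (f : Hom (node (full S)) C) m → Separates 0 (full⇝ S m) (moved (f ∘ᶜ extConn (full⇝ S m)))
moved-full {S = S} f m j q = fixed , shifted
  where
  module f = Connection f
  x : Pos (node S)
  x = child j q
  y z : Pos (node (full S))
  y = pos (baseWord {a = 0} (full⇝ S m)) x
  z = pos (topWord {a = 0} (full⇝ S m)) x
  y⊑z : y ⊑ z
  y⊑z = Connection.e⊑i (extConn (full⇝ S m)) x
  fixed : y ≡ z → 2 ≤ deg z → not ⌊ f.e y ≟ₚ f.i z ⌋ ≡ false
  fixed y≡z le with f.e y ≟ₚ f.i z
  ... | yes _  = refl
  ... | no neq = ⊥-elim (neq (trans (cong f.e y≡z) (f.branching z le)))
  shifted : ¬ y ≡ z → not ⌊ f.e y ≟ₚ f.i z ⌋ ≡ true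
  shifted y≢z with f.e y ≟ₚ f.i z | ⊑⇒≤T y⊑z
  ... | no _   | _          = refl
  ... | yes _  | inj₂ y≡z   = ⊥-elim (y≢z y≡z)
  ... | yes eq | inj₁ y<z   = ⊥-elim (<T-irrefl (subst (_<T f.i z) eq
                                (≤T-<T-trans (⊑⇒≤T (f.e⊑i y)) (IsEmbedding.mono f.i-emb y z y<z))))

covering-length : ∀ {n} (L : List (Fin n)) → (∀ k → k ∈ L) → n ≤ length L
covering-length L cover = injective⇒≤ {f = λ k → ListAny.index (cover k)} (λ {k} {l} eq →
  trans (lookup-index (cover k)) (trans (cong (lookup L) eq) (sym (lookup-index (cover l)))))

fullOf : Tree → Tree
fullOf (node S) = node (full S)

-- The single tree `full S` receives a connection for every mark, and by `read-full` the mark can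
-- still be read off after composition with any `f`.
lower : ∀ S j → j < 2 ^ countLow S → ¬ RamseyProp S (fullOf S) j
lower (node S) j j<n P = refute (P (2 ^ countLowList S) (m^n>0 2 (countLowList S)))
  where
  open Inverse (Mark↔ S)
  refute : ¬ (Σ Tree λ C → ∀ (χ : Colouring (2 ^ countLowList S) (node S) C) →
              Σ (Hom (node (full S)) C) λ f → AtMostColours j χ f)
  refute (C , H) with H (record { col = λ h → to (read S (moved h)) ; resp = resp })
    where
    resp : ∀ h h′ → h ≈ h′ → to (read S (moved h)) ≡ to (read S (moved h′))
    resp h h′ (hs , hi) = cong to (read-cong S (λ x →
      cong₂ (λ y z → not ⌊ y ≟ₚ z ⌋) (e-unique h h′ hs x) (hi x)))
  ... | f , L , L≤j , covers = <-irrefl refl (<-≤-trans j<n (≤-trans (covering-length L all) L≤j))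
    where
    all : ∀ k → k ∈ L
    all k = subst (_∈ L)
      (trans (cong to (read-full S (from k) _ (moved-full f (from k)))) (strictlyInverseˡ k))
      (covers (extConn (full⇝ S (from k))) (f ∘ᶜ extConn (full⇝ S (from k))) ((λ _ → refl) , (λ _ → refl)))

theorem3p2 : ∀ (S : Tree) → IsRd S (2 ^ countLow S)
theorem3p2 S =
  (λ B k (_ , minimal) → ≮⇒≥ (λ n<k → minimal (2 ^ countLow S) n<k (upper S B))) ,
  (λ j j<n → fullOf S , 2 ^ countLow S , (upper S (fullOf S) , lower S) , j<n)
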